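{- There is a constant $\alpha > 0$ such that for every integer $t \ge 1$, every Eulerian digraph with minimum in-degree at least $\alpha t$ immerses $\overrightarrow{K}_t$.
   Context: A digraph here is simple: it has no loops and at most one copy of the edge $xy$ for each ordered pair $(x,y)$ of vertices (both $xy$ and $yx$ may be present). A digraph is Eulerian if every vertex has in-degree equal to its out-degree. $\overrightarrow{K}_k$ denotes the complete digraph on $k$ vertices: $k$ vertices with an edge in both directions between every two of them. A digraph $G$ immerses (contains an immersion of) a digraph $H$ if there is an injective map $f: V(H) \to V(G)$ and a collection of pairwise edge-disjoint directed paths $P_e$ in $G$, one for each edge $e = uv$ of $H$, such that $P_e$ starts at $f(u)$ and ends at $f(v)$. -}

module Defs where

open import Data.Nat using (ℕ; zero; suc)
open import Data.Bool using (Bool; true; false; if_then_else_)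
open import Data.Fin using (Fin)
open import Data.List using (List; []; _∷_; map; allFin)
open import Data.Nat.ListAction using (sum)
open import Data.List.Membership.Propositional using (_∈_; _∉_)
open import Data.List.Relation.Unary.Unique.Propositional using (Unique)
open import Data.Product using (_×_; _,_; Σ)
open import Data.Integer using (+_)
open import Data.Rational using (ℚ; _/_)
open import Relation.Binary.PropositionalEquality using (_≡_; _≢_)
open import Function.Definitions using (Injective)

record Digraph (n : ℕ) : Set where
  field
    E     : Fin n → Fin n → Bool
    loopless : ∀ v → E v v ≡ false
open Digraph public

ind : Bool → ℕ
ind true  = 1
ind false = 0

inDeg : ∀ {n} → Digraph n → Fin n → ℕ
inDeg {n} G v = sum (map (λ u → ind (E G u v)) (allFin n))

outDeg : ∀ {n} → Digraph n → Fin n → ℕ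
outDeg {n} G v = sum (map (λ w → ind (E G v w)) (allFin n))

Eulerian : ∀ {n} → Digraph n → Set
Eulerian G = ∀ v → inDeg G v ≡ outDeg G v

ℕtoℚ : ℕ → ℚ
ℕtoℚ k = (+ k) / 1

MinInDegAtLeast : ∀ {n} → Digraph n → ℚ → Set
MinInDegAtLeast G q = ∀ v → q Data.Rational.≤ ℕtoℚ (inDeg G v)

data Walk {n : ℕ} (G : Digraph n) : Fin n → Fin n → Set where
  stop : ∀ {x} → Walk G x x
  step : ∀ {x y z} → E G x y ≡ true → Walk G y z → Walk G x z

vertices : ∀ {n} {G : Digraph n} {x y} → Walk G x y → List (Fin n)
vertices {x = x} stop = x ∷ []
vertices {x = x} (step _ w) = x ∷ vertices w

edges : ∀ {n} {G : Digraph n} {x y} → Walk G x y → List (Fin n × Fin n)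
edges stop = []
edges {x = x} (step {y = y} _ w) = (x , y) ∷ edges w

IsPath : ∀ {n} {G : Digraph n} {x y} → Walk G x y → Set
IsPath w = Unique (vertices w)

EdgeDisjoint : ∀ {n} {G : Digraph n} {a b c d} → Walk G a b → Walk G c d → Set
EdgeDisjoint w w' = ∀ e → e ∈ edges w → e ∉ edges w'

-- G immerses the complete digraph K⃗_t: edges of K⃗_t are the ordered pairs (i , j), i ≢ j.
ImmersesComplete : ∀ {n} → Digraph n → ℕ → Set
ImmersesComplete {n} G t =
  Σ (Fin t → Fin n) λ f →
    Injective _≡_ _≡_ f ×
    Σ ((i j : Fin t) → i ≢ j → Walk G (f i) (f j)) λ P →
      (∀ i j (p : i ≢ j) → IsPath (P i j p)) ×
      (∀ i j (p : i ≢ j) i' j' (p' : i' ≢ j') →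
         (i , j) ≢ (i' , j') → EdgeDisjoint (P i j p) (P i' j' p'))

-- An edge list that can be turned into L by deleting edges and splicing (a , b) , (b , c) into (a , c) immerses L.  If in a balanced
-- list each of N vertices sends edges to the same 2 N vertices, then the edges outside this biclique can be spliced into a regular
-- bipartite multigraph leading back to the N vertices; Euler partitions split it into N perfect matchings, and splicing the i-th
-- matching to the star of the i-th vertex produces the complete digraph on the N vertices.
--
-- Suppose that no such biclique ever appears.  The digraph is first made d-regular by splicing along shortcuts, and then its vertices
-- are eliminated one by one by pairing the edges into a vertex v with those out of v.  This is controlled by a convex energy of the
-- edge multiplicities: expensive parallel edges at v are paired with single ones, which is cheap, and nearly all the others are paired
-- into new edges, which is free, since otherwise there is a biclique.  Either most of the energy at v is thereby recovered, or the
-- elimination costs some loops at one vertex but the energy drops by nearly the degree of v.  Choosing v suitably keeps the energy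
-- plus a penalty for lost degrees below a constant multiple of the number of vertices, which is impossible once fewer than d / 2
-- vertices are left, because then most edges have parallel copies.
module Submission where

open import Defs hiding (E; loopless)
open import Data.Bool using (Bool; true; false; T; _∧_)
import Data.Bool.Properties as Boolₚ
open import Data.Empty using (⊥; ⊥-elim)
open import Data.Fin as Fin using (Fin; zero; suc; #_; inject≤)
import Data.Fin.Properties as Finₚ
import Data.Integer as ℤ
import Data.Integer.Properties as ℤₚ
open import Data.List using (List; []; _∷_; _++_; map; length; replicate; cartesianProduct; take; drop; filter; allFin; lookup)
open import Data.List.Membership.Propositional using (_∈_; _∉_; find; lose)
open import Data.List.Membership.Propositional.Properties using (∈-∃++; ∈-++⁺ˡ; ∈-++⁺ʳ; ∈-++⁻; ∈-map⁺; ∈-map⁻; ∈-cartesianProduct⁺; ∈-cartesianProduct⁻; ∈-lookup; ∈-allFin; ∈-filter⁻)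
open import Data.List.Properties using (length-++; length-map; length-replicate; ++-assoc; ++-identityʳ; map-++; length-take; length-drop; take++drop≡id; length-tabulate; filter-++; cartesianProductWith-distribʳ-++)
open import Data.List.Relation.Binary.Permutation.Propositional
open import Data.List.Relation.Binary.Permutation.Propositional.Properties as ↭P using (↭-length; ∈-resp-↭; shift; drop-∷; map⁺)
open import Data.List.Relation.Unary.All as All using (All; []; _∷_)
open import Data.List.Relation.Unary.AllPairs using ([]; _∷_)
open import Data.List.Relation.Unary.Any using (here; there; any?)
open import Data.List.Relation.Unary.Unique.Propositional using (Unique)
import Data.List.Relation.Unary.Unique.Propositional.Properties as Uniqueₚ
open import Data.Nat
open import Data.Nat.Coprimality using (1-coprimeTo) renaming (sym to coprime-sym)
open import Data.Nat.ListAction using (sum)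
open import Data.Nat.Properties
open import Data.Nat.Tactic.RingSolver using (solve-∀)
open import Data.Product using (_×_; _,_; proj₁; proj₂; Σ; ∃; ∃₂)
open import Data.Product.Properties using (≡-dec)
open import Data.Rational as ℚ using (ℚ; mkℚ; Positive)
import Data.Rational.Properties as ℚₚ
open import Data.Rational.Unnormalised as ℚᵘ using (mkℚᵘ; *≤*)
import Data.Rational.Unnormalised.Properties as ℚᵘₚ
open import Data.Sum using (_⊎_; inj₁; inj₂; [_,_]′)
open import Data.Unit using (⊤; tt)
open import Data.Vec using (Vec; []; _∷_; zipWith)
open import Function using (_∘_; id)
open import Function.Bundles using (Equivalence)
open import Relation.Binary.Definitions using (DecidableEquality)
open import Relation.Binary.PropositionalEquality using (_≡_; _≢_; refl; sym; cong; cong₂; subst; subst₂) renaming (trans to _⊙_)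
open import Relation.Nullary
open import Relation.Nullary.Decidable using (decidable-stable)
open import Relation.Unary using (Decidable)

-- The numbers in the energy meet two needs. Eliminating a vertex of average energy must recover
-- more than half of the energy there, because every edge is counted at both of its ends, which
-- makes the average twice the energy per vertex. Hence a further copy costs 4 below multiplicity
-- `M` and 13 from there on: a class of at least `4 + 9 * M` parallel edges holds 12 per edge, a
-- pair using one of them costs 4, and two thirds are kept. On the other hand, where expensive edges
-- have to be paired with each other or with other parallel edges, a pair costs up to 13 but
-- releases 12 at one end and at least 2 at the other, so a gain of 1 per unit of degree remains.
-- This gain pays for loops, the real obstacle: if one vertex makes up more than half of the ends at
-- `v`, loops are unavoidable and that vertex loses degree. The parameter `M` limits how many cheap
-- partners can be spoiled: a vertex of degree at most `d` has `M` parallel edges to at most `d / M`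
-- others, a small fraction of `d`.

data Lin (n : ℕ) : Set where
  nil : Lin n
  var : Fin n → Lin n
  _⊞_ : Lin n → Lin n → Lin n
  _⊠_ : ℕ → Lin n → Lin n

infixl 6 _⊞_
infixl 7 _⊠_

-- Linear inequalities over the naturals from explicit multipliers

module Linear {n : ℕ} where

  at : ∀ {n} → Vec ℕ n → Fin n → ℕ
  at (x ∷ ρ) zero    = x
  at (x ∷ ρ) (suc i) = at ρ i

  eval : Vec ℕ n → Lin n → ℕ
  eval ρ nil     = 0
  eval ρ (var i) = at ρ i
  eval ρ (e ⊞ f) = eval ρ e + eval ρ f
  eval ρ (k ⊠ e) = k * eval ρ e

  dot : ∀ {n} → Vec ℕ n → Vec ℕ n → ℕ
  dot [] [] = 0
  dot (a ∷ u) (x ∷ ρ) = a * x + dot u ρ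

  zeros : ∀ n → Vec ℕ n
  zeros zero    = []
  zeros (suc n) = 0 ∷ zeros n

  unit : ∀ {n} → Fin n → Vec ℕ n
  unit {suc n} zero    = 1 ∷ zeros n
  unit         (suc i) = 0 ∷ unit i

  scale : ∀ {n} → ℕ → Vec ℕ n → Vec ℕ n
  scale k []      = []
  scale k (a ∷ u) = k * a ∷ scale k u

  coefficients : Lin n → Vec ℕ n
  coefficients nil     = zeros n
  coefficients (var i) = unit i
  coefficients (e ⊞ f) = zipWith _+_ (coefficients e) (coefficients f)
  coefficients (k ⊠ e) = scale k (coefficients e)

  dot-zeros : ∀ {n} (ρ : Vec ℕ n) → dot (zeros n) ρ ≡ 0
  dot-zeros []      = refl
  dot-zeros (x ∷ ρ) = dot-zeros ρ

  dot-unit : ∀ {n} (i : Fin n) ρ → dot (unit i) ρ ≡ at ρ i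
  dot-unit zero (x ∷ ρ)    = cong₂ _+_ (+-identityʳ x) (dot-zeros ρ) ⊙ +-identityʳ x
  dot-unit (suc i) (x ∷ ρ) = dot-unit i ρ

  dot-+ : ∀ {n} (u v ρ : Vec ℕ n) → dot (zipWith _+_ u v) ρ ≡ dot u ρ + dot v ρ
  dot-+ [] [] [] = refl
  dot-+ (a ∷ u) (b ∷ v) (x ∷ ρ) = cong ((a + b) * x +_) (dot-+ u v ρ) ⊙ lem a b x (dot u ρ) (dot v ρ)
    where
    lem : ∀ a b x p q → (a + b) * x + (p + q) ≡ a * x + p + (b * x + q)
    lem = solve-∀

  dot-* : ∀ {n} k (u ρ : Vec ℕ n) → dot (scale k u) ρ ≡ k * dot u ρ
  dot-* k [] [] = sym (*-zeroʳ k)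
  dot-* k (a ∷ u) (x ∷ ρ) = cong₂ _+_ (*-assoc k a x) (dot-* k u ρ) ⊙ sym (*-distribˡ-+ k (a * x) (dot u ρ))

  eval-dot : ∀ ρ e → eval ρ e ≡ dot (coefficients e) ρ
  eval-dot ρ nil     = sym (dot-zeros ρ)
  eval-dot ρ (var i) = sym (dot-unit i ρ)
  eval-dot ρ (e ⊞ f) = cong₂ _+_ (eval-dot ρ e) (eval-dot ρ f) ⊙ sym (dot-+ (coefficients e) (coefficients f) ρ)
  eval-dot ρ (k ⊠ e) = cong (k *_) (eval-dot ρ e) ⊙ sym (dot-* k (coefficients e) ρ)

  dominates : ∀ {n} → Vec ℕ n → Vec ℕ n → Bool
  dominates [] []           = true
  dominates (a ∷ u) (b ∷ v) = (a ≤ᵇ b) ∧ dominates u v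

  dot-mono : ∀ {n} (u v ρ : Vec ℕ n) → T (dominates u v) → dot u ρ ≤ dot v ρ
  dot-mono [] [] [] _ = z≤n
  dot-mono (a ∷ u) (b ∷ v) (x ∷ ρ) t =
    let p , q = Equivalence.to (Boolₚ.T-∧ {a ≤ᵇ b}) t in +-mono-≤ (*-monoˡ-≤ x (≤ᵇ⇒≤ a b p)) (dot-mono u v ρ q)

  Hypothesis : Set
  Hypothesis = ℕ × Lin n × Lin n

  lhs rhs : List Hypothesis → Lin n
  lhs []                 = nil
  lhs ((k , l , r) ∷ hs) = k ⊠ l ⊞ lhs hs
  rhs []                 = nil
  rhs ((k , l , r) ∷ hs) = k ⊠ r ⊞ rhs hs

  Holds : Vec ℕ n → List Hypothesis → Set
  Holds ρ []                 = ⊤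
  Holds ρ ((k , l , r) ∷ hs) = eval ρ l ≤ eval ρ r × Holds ρ hs

  combine : ∀ ρ hs → Holds ρ hs → eval ρ (lhs hs) ≤ eval ρ (rhs hs)
  combine ρ [] _ = z≤n
  combine ρ ((k , _) ∷ hs) (h , hh) = +-mono-≤ (*-monoʳ-≤ k h) (combine ρ hs hh)

  -- Farkas: the inequality l ≤ r is the combination of the hypotheses with the given multipliers, up to nonnegative terms.
  entail : ∀ ρ (l r : Lin n) hs → {_ : T (dominates (coefficients (l ⊞ rhs hs)) (coefficients (r ⊞ lhs hs)))} →
           Holds ρ hs → eval ρ l ≤ eval ρ r
  entail ρ l r hs {t} h = +-cancelʳ-≤ (eval ρ (rhs hs)) _ _ (≤-trans
    (≤-trans (≤-reflexive (eval-dot ρ (l ⊞ rhs hs))) (≤-trans (dot-mono (coefficients (l ⊞ rhs hs)) (coefficients (r ⊞ lhs hs)) ρ t)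
       (≤-reflexive (sym (eval-dot ρ (r ⊞ lhs hs))))))
    (+-monoʳ-≤ (eval ρ r) (combine ρ hs h)))

-- Lists as multisets, compared by multiplicities

ι : ∀ {P : Set} → Dec P → ℕ
ι (yes _) = 1
ι (no _)  = 0

ι-yes : ∀ {P : Set} (d : Dec P) → P → ι d ≡ 1
ι-yes (yes _) _ = refl
ι-yes (no ¬p) p = ⊥-elim (¬p p)

ι-no : ∀ {P : Set} (d : Dec P) → ¬ P → ι d ≡ 0
ι-no (yes p) ¬p = ⊥-elim (¬p p)
ι-no (no _) _ = refl

∈-↭ : ∀ {A : Set} {x : A} {xs} → x ∈ xs → ∃ λ ys → xs ↭ x ∷ ys
∈-↭ x∈ with ∈-∃++ x∈
... | h , t , refl = h ++ t , shift _ h t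

Unique-++ʳ : ∀ {A : Set} (xs : List A) {ys} → Unique (xs ++ ys) → Unique ys
Unique-++ʳ []       u       = u
Unique-++ʳ (x ∷ xs) (_ ∷ u) = Unique-++ʳ xs u

module Counting {A : Set} (_≟_ : DecidableEquality A) where

  count : A → List A → ℕ
  count x []       = 0
  count x (y ∷ ys) = ι (x ≟ y) + count x ys

  count-++ : ∀ x xs ys → count x (xs ++ ys) ≡ count x xs + count x ys
  count-++ x [] ys = refl
  count-++ x (y ∷ xs) ys rewrite count-++ x xs ys = sym (+-assoc (ι (x ≟ y)) _ _)

  count-↭ : ∀ x {xs ys} → xs ↭ ys → count x xs ≡ count x ys
  count-↭ x refl = refl
  count-↭ x (prep y p) = cong (ι (x ≟ y) +_) (count-↭ x p)
  count-↭ x (swap y z p) rewrite count-↭ x p = lem (ι (x ≟ y)) (ι (x ≟ z)) _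
    where
    lem : ∀ a b c → a + (b + c) ≡ b + (a + c)
    lem = solve-∀
  count-↭ x (trans p q) = _⊙_ (count-↭ x p) (count-↭ x q)

  count-here : ∀ x xs → count x (x ∷ xs) ≡ suc (count x xs)
  count-here x xs rewrite ι-yes (x ≟ x) refl = refl

  count-there : ∀ {x y} → x ≢ y → ∀ xs → count x (y ∷ xs) ≡ count x xs
  count-there {x} {y} x≢y xs rewrite ι-no (x ≟ y) x≢y = refl

  count-∈ : ∀ {x xs} → x ∈ xs → 1 ≤ count x xs
  count-∈ {x} {y ∷ xs} (here refl) rewrite count-here x xs = s≤s z≤n
  count-∈ {x} {y ∷ xs} (there p) = ≤-trans (count-∈ p) (m≤n+m _ (ι (x ≟ y)))

  ∈-count : ∀ {x xs} → 1 ≤ count x xs → x ∈ xs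
  ∈-count {x} {y ∷ xs} p with x ≟ y
  ... | yes refl = here refl
  ... | no _ = there (∈-count p)

  count-∉ : ∀ {x xs} → x ∉ xs → count x xs ≡ 0
  count-∉ {x} {xs} x∉ with count x xs in eq
  ... | zero = refl
  ... | suc k = ⊥-elim (x∉ (∈-count (subst (1 ≤_) (sym eq) (s≤s z≤n))))

  ∉-count : ∀ {x xs} → count x xs ≡ 0 → x ∉ xs
  ∉-count eq x∈ with ≤-trans (count-∈ x∈) (≤-reflexive eq)
  ... | ()

  counts⇒↭ : ∀ xs ys → (∀ x → count x xs ≡ count x ys) → xs ↭ ys
  counts⇒↭ [] [] h = refl
  counts⇒↭ [] (y ∷ ys) h with _⊙_ (h y) (count-here y ys)
  ... | ()
  counts⇒↭ (x ∷ xs) ys h with ∈-↭ (∈-count {x} {ys} (subst (1 ≤_) (h x) (count-∈ {x} {x ∷ xs} (here refl))))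
  ... | zs , p = ↭-trans (prep x (counts⇒↭ xs zs λ y → +-cancelˡ-≡ (ι (y ≟ x)) _ _
                   (_⊙_ (h y) (count-↭ y p)))) (↭-sym p)

  Unique⇒count≤1 : ∀ {xs} → Unique xs → ∀ x → count x xs ≤ 1
  Unique⇒count≤1 [] x = z≤n
  Unique⇒count≤1 {y ∷ ys} (y∉ ∷ u) x with x ≟ y
  ... | yes refl = s≤s (≤-reflexive (count-∉ λ x∈ → All.lookup y∉ x∈ refl))
  ... | no _ = Unique⇒count≤1 u x

  count≤1⇒Unique : ∀ xs → (∀ x → count x xs ≤ 1) → Unique xs
  count≤1⇒Unique [] h = []
  count≤1⇒Unique (y ∷ ys) h =
    All.tabulate (λ {z} z∈ y≡z → <⇒≱ (s≤s (count-∈ (subst (_∈ ys) (sym y≡z) z∈)))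
       (≤-trans (≤-reflexive (sym (count-here y ys))) (h y)))
    ∷ count≤1⇒Unique ys (λ x → ≤-trans (m≤n+m _ (ι (x ≟ y))) (h x))

  Unique-↭ : ∀ {xs ys} → xs ↭ ys → Unique xs → Unique ys
  Unique-↭ {xs} {ys} p u = count≤1⇒Unique ys λ x → subst (_≤ 1) (count-↭ x p) (Unique⇒count≤1 u x)

  gather : ∀ x xs → ∃ λ ys → xs ↭ replicate (count x xs) x ++ ys × x ∉ ys
  gather x [] = [] , refl , λ ()
  gather x (y ∷ xs) with x ≟ y | gather x xs
  ... | yes refl | ys , p , x∉ = ys , prep x p , x∉
  ... | no x≢y | ys , p , x∉ = y ∷ ys , ↭-trans (prep y p) (↭-sym (shift y (replicate (count x xs) x) ys))
                             , λ { (here e) → x≢y e ; (there q) → x∉ q }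

  count-self : ∀ m x → count x (replicate m x) ≡ m
  count-self zero x = refl
  count-self (suc m) x = count-here x (replicate m x) ⊙ cong suc (count-self m x)

  count-other : ∀ m {x y} → x ≢ y → count x (replicate m y) ≡ 0
  count-other zero ne = refl
  count-other (suc m) {x} {y} ne = count-there ne (replicate m y) ⊙ count-other m ne

  ∈-tail : ∀ {x y} {xs : List A} → y ≢ x → y ∈ x ∷ xs → y ∈ xs
  ∈-tail y≢x (here e)  = ⊥-elim (y≢x e)
  ∈-tail y≢x (there q) = q

  sublist-↭ : ∀ {xs ys} → Unique xs → (∀ {x} → x ∈ xs → x ∈ ys) → ∃ λ zs → ys ↭ xs ++ zs
  sublist-↭ {[]} {ys} u h = ys , refl
  sublist-↭ {x ∷ xs} {ys} (x∉ ∷ u) h =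
    let ys' , p = ∈-↭ (h (here refl))
        zs , q = sublist-↭ u (λ y∈ → ∈-tail (λ e → All.lookup x∉ y∈ (sym e)) (∈-resp-↭ p (h (there y∈))))
    in zs , ↭-trans p (prep x q)

  module Gather (x : A) (xs : List A) where
    rest : List A
    rest = proj₁ (gather x xs)

    gather-↭ : xs ↭ replicate (count x xs) x ++ rest
    gather-↭ = proj₁ (proj₂ (gather x xs))

    x∉rest : x ∉ rest
    x∉rest = proj₂ (proj₂ (gather x xs))

    rest-⊆ : ∀ {y} → y ∈ rest → y ∈ xs
    rest-⊆ y∈ = ∈-resp-↭ (↭-sym gather-↭) (∈-++⁺ʳ (replicate (count x xs) x) y∈)

    count-rest : ∀ y → count y rest ≤ count y xs
    count-rest y = ≤-trans (m≤n+m _ (count y (replicate (count x xs) x)))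
      (≤-reflexive (sym (count-↭ y gather-↭ ⊙ count-++ y (replicate (count x xs) x) rest)))

    length-rest : length xs ≡ count x xs + length rest
    length-rest = ↭-length gather-↭ ⊙ (length-++ (replicate (count x xs) x) ⊙
      cong (_+ length rest) (length-replicate (count x xs)))

  -- Discarding all copies of one element shortens the list by at most `m`, so there are `k` rounds,
  -- each yielding a new element.
  spread : ∀ m k xs → 1 ≤ m → (∀ x → count x xs ≤ m) → k * m ≤ length xs →
           ∃ λ ys → Unique ys × length ys ≡ k × (∀ {y} → y ∈ ys → y ∈ xs)
  spread m zero xs _ _ _ = [] , [] , refl , λ ()
  spread m (suc k) [] 1≤m h le = ⊥-elim (<⇒≱ 1≤m (≤-trans (m≤m+n m (k * m)) le))
  spread m (suc k) (x ∷ xs) 1≤m h le =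
    let open Gather x (x ∷ xs)
        ys , u , l , sub = spread m k rest 1≤m (λ y → ≤-trans (count-rest y) (h y))
          (+-cancelˡ-≤ m _ _ (≤-trans le (≤-trans (≤-reflexive length-rest) (+-monoˡ-≤ (length rest) (h x)))))
    in x ∷ ys , All.tabulate (λ y∈ e → x∉rest (subst (_∈ rest) (sym e) (sub y∈))) ∷ u , cong suc l
       , λ { (here refl) → here refl ; (there y∈) → rest-⊆ (sub y∈) }

  avoid : ∀ ps {ys} → Unique ys → ∃ λ zs → Unique zs × (∀ {z} → z ∈ zs → z ∈ ys) ×
          (∀ {z} → z ∈ zs → z ∉ ps) × length ys ≤ length zs + length ps
  avoid [] {ys} u = ys , u , id , (λ _ ()) , m≤m+n _ 0
  avoid (p ∷ ps) u =
    let zs , uz , sub , av , le = avoid ps u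
        open Gather p zs
    in rest , count≤1⇒Unique rest (λ x → ≤-trans (count-rest x) (Unique⇒count≤1 uz x))
     , (λ z∈ → sub (rest-⊆ z∈))
     , (λ { z∈ (here refl) → x∉rest z∈ ; z∈ (there r) → av (rest-⊆ z∈) r })
     , ≤-trans le (≤-trans (+-monoˡ-≤ (length ps) (≤-trans (≤-reflexive length-rest)
         (+-monoˡ-≤ (length rest) (Unique⇒count≤1 uz p)))) (≤-reflexive (sym (+-suc (length rest) (length ps)))))

-- The convex energy of multiplicities

module Slope (M : ℕ) (1≤M : 1 ≤ M) where

  -- slope m is the price of one more copy of an edge of multiplicity m, so energy m is the price of m parallel edges.
  slope : ℕ → ℕ
  slope m = ι (1 ≤? m) * 4 + ι (M ≤? m) * 9

  energy : ℕ → ℕ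
  energy m = 4 * (m ∸ 1) + 9 * (m ∸ M)

  ∸-suc : ∀ k m → suc m ∸ k ≡ (m ∸ k) + ι (k ≤? m)
  ∸-suc k m with k ≤? m
  ... | yes k≤m = +-∸-assoc 1 k≤m ⊙ sym (+-comm (m ∸ k) 1)
  ... | no k≰m = m≤n⇒m∸n≡0 (≰⇒> k≰m) ⊙ sym (+-identityʳ _ ⊙ m≤n⇒m∸n≡0 (<⇒≤ (≰⇒> k≰m)))

  energy-suc : ∀ m → energy (suc m) ≡ slope m + energy m
  energy-suc m = cong₂ (λ a b → 4 * a + 9 * b) (∸-suc 1 m) (∸-suc M m) ⊙ lem (m ∸ 1) (m ∸ M) (ι (1 ≤? m)) (ι (M ≤? m))
    where
    lem : ∀ a b x y → 4 * (a + x) + 9 * (b + y) ≡ x * 4 + y * 9 + (4 * a + 9 * b)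
    lem = solve-∀

  energy-0 : energy 0 ≡ 0
  energy-0 rewrite m≤n⇒m∸n≡0 {0} {M} z≤n = refl

  ι≤1 : ∀ {P : Set} (d : Dec P) → ι d ≤ 1
  ι≤1 (yes _) = s≤s z≤n
  ι≤1 (no _) = z≤n

  slope-0 : slope 0 ≡ 0
  slope-0 rewrite ι-no (M ≤? 0) (<⇒≱ 1≤M) = refl

  slope≤4 : ∀ {m} → m < M → slope m ≤ 4
  slope≤4 {m} m<M rewrite ι-no (M ≤? m) (<⇒≱ m<M) | +-identityʳ (ι (1 ≤? m) * 4) = *-monoˡ-≤ 4 (ι≤1 (1 ≤? m))

  slope≤13 : ∀ m → slope m ≤ 13
  slope≤13 m = +-mono-≤ (*-monoˡ-≤ 4 (ι≤1 (1 ≤? m))) (*-monoˡ-≤ 9 (ι≤1 (M ≤? m)))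

  -- The line that the convex function `energy` finally follows. Its offset `4 + 9 * M` becomes the
  -- threshold of heavy multiplicities: from there on the offset is at most one per copy, and 12 of
  -- the 13 remain.
  13*≤energy : ∀ m → 13 * m ≤ energy m + (4 + 9 * M)
  13*≤energy m = ≤-trans (≤-reflexive (l₁ m)) (≤-trans
      (+-mono-≤ (*-monoʳ-≤ 4 (m≤n+m∸n m 1)) (*-monoʳ-≤ 9 (m≤n+m∸n m M)))
      (≤-reflexive (l₂ (m ∸ 1) (m ∸ M) M)))
    where
    l₁ : ∀ m → 13 * m ≡ 4 * m + 9 * m
    l₁ = solve-∀
    l₂ : ∀ a b M → 4 * (1 + a) + 9 * (M + b) ≡ 4 * a + 9 * b + (4 + 9 * M)
    l₂ = solve-∀

  4*≤energy : ∀ m → 4 * m ≤ energy m + 4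
  4*≤energy m = ≤-trans (*-monoʳ-≤ 4 (m≤n+m∸n m 1)) (≤-trans (≤-reflexive (*-distribˡ-+ 4 1 (m ∸ 1) ⊙ +-comm 4 _))
     (+-monoˡ-≤ 4 (m≤m+n _ (9 * (m ∸ M)))))

  12*≤energy : ∀ {m} → 4 + 9 * M ≤ m → 12 * m ≤ energy m
  12*≤energy {m} h = +-cancelʳ-≤ m _ _ (≤-trans (≤-reflexive (l m)) (≤-trans (13*≤energy m) (+-monoʳ-≤ (energy m) h)))
    where
    l : ∀ m → 12 * m + m ≡ 13 * m
    l = solve-∀

  2*≤energy : ∀ {m} → 2 ≤ m → 2 * m ≤ energy m
  2*≤energy {m} h = +-cancelʳ-≤ 4 _ _ (≤-trans (+-monoʳ-≤ (2 * m) (*-monoʳ-≤ 2 h)) (≤-trans (≤-reflexive (l m)) (4*≤energy m)))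
    where
    l : ∀ m → 2 * m + 2 * m ≡ 4 * m
    l = solve-∀

  module Cost {A : Set} (_≟_ : DecidableEquality A) where
    open Counting _≟_ public

    -- Each element pays the slope of its multiplicity in the tail, which telescopes to the sum of
    -- `energy` over the distinct elements. So the order is immaterial, and adding one element costs
    -- exactly one slope.
    cost : List A → ℕ
    cost []       = 0
    cost (x ∷ xs) = slope (count x xs) + cost xs

    cost-↭ : ∀ {xs ys} → xs ↭ ys → cost xs ≡ cost ys
    cost-↭ refl = refl
    cost-↭ (prep x p) = cong₂ (λ k l → slope k + l) (count-↭ x p) (cost-↭ p)
    cost-↭ (swap {xs} {ys} x y p) with x ≟ y | y ≟ x
    ... | yes refl | yes _ = cong₂ (λ k l → slope (suc k) + (slope k + l)) (count-↭ x p) (cost-↭ p)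
    ... | yes e | no ne = ⊥-elim (ne (sym e))
    ... | no ne | yes e = ⊥-elim (ne (sym e))
    ... | no _ | no _ rewrite count-↭ x p | count-↭ y p | cost-↭ p = lem (slope (count x ys)) (slope (count y ys)) (cost ys)
      where
      lem : ∀ a b c → a + (b + c) ≡ b + (a + c)
      lem = solve-∀
    cost-↭ (trans p q) = cost-↭ p ⊙ cost-↭ q

    cost-++ : ∀ xs ys → (∀ {x} → x ∈ xs → x ∉ ys) → cost (xs ++ ys) ≡ cost xs + cost ys
    cost-++ [] ys h = refl
    cost-++ (x ∷ xs) ys h rewrite count-++ x xs ys | count-∉ (h (here refl)) | +-identityʳ (count x xs)
      | cost-++ xs ys (λ x∈ → h (there x∈)) = sym (+-assoc (slope (count x xs)) _ _)

    cost-replicate : ∀ m x → cost (replicate m x) ≡ energy m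
    cost-replicate zero x = sym energy-0
    cost-replicate (suc m) x rewrite count-self m x | cost-replicate m x = sym (energy-suc m)

    cost-gather : ∀ x xs → cost xs ≡ energy (count x xs) + cost (Gather.rest x xs)
    cost-gather x xs = let open Gather x xs in cost-↭ gather-↭
       ⊙ (cost-++ _ rest (λ y∈ y∈r → x∉rest (subst (_∈ rest) (replicated (count x xs) y∈) y∈r)) ⊙ cong (_+ cost rest) (cost-replicate (count x xs) x))
      where
      replicated : ∀ {y} m → y ∈ replicate m x → y ≡ x
      replicated (suc m) (here e) = e
      replicated (suc m) (there q) = replicated m q

    cost-Unique : ∀ {xs} → Unique xs → cost xs ≡ 0
    cost-Unique [] = refl
    cost-Unique {x ∷ xs} (x∉ ∷ u) rewrite count-∉ {x} {xs} (λ x∈ → All.lookup x∉ x∈ refl) | slope-0 = cost-Unique u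

    -- One copy of each element of `ws` is free and every other copy costs at least 4. This yields
    -- the final contradiction, when the edges out of a vertex have few possible targets.
    4*length≤cost : ∀ ws xs → (∀ {x} → x ∈ xs → x ∈ ws) → 4 * length xs ≤ cost xs + 4 * length ws
    4*length≤cost [] [] h = z≤n
    4*length≤cost [] (x ∷ xs) h with h (here refl)
    ... | ()
    4*length≤cost (w ∷ ws) xs h = ≤-trans (≤-reflexive (cong (4 *_) length-rest))
       (≤-trans (≤-reflexive (*-distribˡ-+ 4 (count w xs) (length rest)))
       (≤-trans (+-mono-≤ (4*≤energy (count w xs))
           (4*length≤cost ws rest (λ y∈ → ∈-tail (λ { refl → x∉rest y∈ }) (h (rest-⊆ y∈)))))
       (≤-reflexive (lem (energy (count w xs)) (cost rest) (length ws) ⊙ cong (_+ 4 * suc (length ws)) (sym (cost-gather w xs))))))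
      where
      open Gather w xs
      lem : ∀ e c l → e + 4 + (c + 4 * l) ≡ e + c + 4 * (1 + l)
      lem = solve-∀

    -- The intended classes are the multiplicities from `4 + 9 * M` on, those from 2 to `3 + 9 * M`,
    -- and 1; only the consequences are recorded. In `weight`, 12 and 2 are the energies guaranteed
    -- per copy. `moderate` makes a long remainder contain many distinct vertices, and `single`
    -- makes the light elements countable as distinct targets of parallel edges.
    record Classified (xs : List A) : Set where
      field
        heavy medium light : List A
        split    : xs ↭ heavy ++ medium ++ light
        weight   : 12 * length heavy + 2 * length medium ≤ cost xs
        single   : Unique light
        moderate : ∀ x → count x (medium ++ light) ≤ 3 + 9 * M

    classify′ : ∀ k xs → length xs ≤ k → Classified xs
    classify′ k [] le = record { heavy = [] ; medium = [] ; light = [] ; split = refl ; weight = z≤n ; single = []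
                              ; moderate = λ _ → z≤n }
    classify′ (suc k) (x ∷ xs) (s≤s le) = cases (4 + 9 * M ≤? m) (2 ≤? m)
      where
      open Gather x (x ∷ xs)
      m : ℕ
      m = count x (x ∷ xs)
      1≤m : 1 ≤ m
      1≤m = count-∈ {x} {x ∷ xs} (here refl)
      len : length rest ≤ k
      len = ≤-trans (+-cancelˡ-≤ 1 _ _ (≤-trans (+-monoˡ-≤ (length rest) 1≤m) (≤-reflexive (sym length-rest)))) le
      open Classified (classify′ k rest len)
      no-x : count x (medium ++ light) ≡ 0
      no-x = n≤0⇒n≡0 (≤-trans (m≤n+m _ (count x heavy)) (≤-reflexive
               (sym (count-++ x heavy (medium ++ light)) ⊙ (sym (count-↭ x split) ⊙ count-∉ x∉rest))))
      cost-m : cost (x ∷ xs) ≡ energy m + cost rest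
      cost-m = cost-gather x (x ∷ xs)
      lr = length-replicate m {x}
      base : x ∷ xs ↭ replicate m x ++ heavy ++ medium ++ light
      base = ↭-trans gather-↭ (↭P.++⁺ˡ (replicate m x) split)
      modest : m ≤ 3 + 9 * M → ∀ y → count y (replicate m x) + count y (medium ++ light) ≤ 3 + 9 * M
      modest h y with y ≟ x
      ... | yes refl = ≤-trans (≤-reflexive (cong₂ _+_ (count-self m y) no-x ⊙ +-identityʳ m)) h
      ... | no ne = ≤-trans (≤-reflexive (cong (_+ count y (medium ++ light)) (count-other m ne))) (moderate y)
      cases : Dec (4 + 9 * M ≤ m) → Dec (2 ≤ m) → Classified (x ∷ xs)
      cases (yes big) _ = record
        { heavy = replicate m x ++ heavy ; medium = medium ; light = light
        ; split = ↭-trans base (↭-reflexive (sym (++-assoc (replicate m x) heavy _)))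
        ; weight = ≤-trans (≤-reflexive (cong (λ z → 12 * z + 2 * length medium) (length-++ (replicate m x) ⊙ cong (_+ length heavy) lr)
                     ⊙ lem m (length heavy) (length medium)))
                   (≤-trans (+-mono-≤ (12*≤energy big) weight) (≤-reflexive (sym cost-m)))
        ; single = single ; moderate = moderate }
        where
        lem : ∀ m h n → 12 * (m + h) + 2 * n ≡ 12 * m + (12 * h + 2 * n)
        lem = solve-∀
      cases (no small) (yes two) = record
        { heavy = heavy ; medium = replicate m x ++ medium ; light = light
        ; split = ↭-trans base (↭-trans (↭P.shifts (replicate m x) heavy) (↭-reflexive (cong (heavy ++_) (sym (++-assoc (replicate m x) medium _)))))
        ; weight = ≤-trans (≤-reflexive (cong (λ z → 12 * length heavy + 2 * z) (length-++ (replicate m x) ⊙ cong (_+ length medium) lr)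
                     ⊙ lem m (length heavy) (length medium)))
                   (≤-trans (+-mono-≤ (2*≤energy two) weight) (≤-reflexive (sym cost-m)))
        ; single = single
        ; moderate = λ y → ≤-trans (≤-reflexive (cong (count y) (++-assoc (replicate m x) medium light) ⊙ count-++ y (replicate m x) (medium ++ light)))
                      (modest (≤-pred (≰⇒> small)) y) }
        where
        lem : ∀ m h n → 12 * h + 2 * (m + n) ≡ 2 * m + (12 * h + 2 * n)
        lem = solve-∀
      cases (no small) (no one) = record
        { heavy = heavy ; medium = medium ; light = replicate m x ++ light
        ; split = ↭-trans base (↭-trans (↭P.shifts (replicate m x) heavy) (↭P.++⁺ˡ heavy (↭P.shifts (replicate m x) medium)))
        ; weight = ≤-trans weight (≤-trans (m≤n+m _ (energy m)) (≤-reflexive (sym cost-m)))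
        ; single = count≤1⇒Unique _ λ y → ≤-trans (≤-reflexive (count-++ y (replicate m x) light)) (one′ y)
        ; moderate = λ y → ≤-trans (≤-reflexive (count-++ y medium _ ⊙ (cong (count y medium +_) (count-++ y (replicate m x) light)
                       ⊙ (lem (count y medium) (count y (replicate m x)) (count y light) ⊙ cong (count y (replicate m x) +_) (sym (count-++ y medium light))))))
                      (modest (≤-pred (≰⇒> small)) y) }
        where
        lem : ∀ a b c → a + (b + c) ≡ b + (a + c)
        lem = solve-∀
        one′ : ∀ y → count y (replicate m x) + count y light ≤ 1
        one′ y with y ≟ x
        ... | yes refl = ≤-trans (≤-reflexive (cong₂ _+_ (count-self m y)
              (n≤0⇒n≡0 (≤-trans (m≤n+m (count y light) (count y medium)) (≤-reflexive (sym (count-++ y medium light) ⊙ no-x))))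
              ⊙ +-identityʳ m)) (≤-pred (≰⇒> one))
        ... | no ne = ≤-trans (≤-reflexive (cong (_+ count y light) (count-other m ne))) (Unique⇒count≤1 single y)

    classify : ∀ xs → Classified xs
    classify xs = classify′ (length xs) xs ≤-refl

-- Immersions of edge lists

infix 3 _⇝_
infixr 4 _▷_

data _⇝_ {V : Set} : List (V × V) → List (V × V) → Set where
  permute : ∀ {L L′} → L ↭ L′ → L ⇝ L′
  delete  : ∀ {e L} → e ∷ L ⇝ L
  splice  : ∀ {a b c L} → (a , b) ∷ (b , c) ∷ L ⇝ (a , c) ∷ L
  _▷_     : ∀ {L L′ L″} → L ⇝ L′ → L′ ⇝ L″ → L ⇝ L″

module _ {V : Set} where

  ⇝-++ʳ : ∀ {L L′ : List (V × V)} R → L ⇝ L′ → L ++ R ⇝ L′ ++ R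
  ⇝-++ʳ R (permute p) = permute (↭P.++⁺ʳ R p)
  ⇝-++ʳ R delete      = delete
  ⇝-++ʳ R splice      = splice
  ⇝-++ʳ R (p ▷ q)     = ⇝-++ʳ R p ▷ ⇝-++ʳ R q

  ⇝-++ˡ : ∀ {L L′ : List (V × V)} R → L ⇝ L′ → R ++ L ⇝ R ++ L′
  ⇝-++ˡ {L} {L′} R p = permute (↭P.++-comm R L) ▷ ⇝-++ʳ R p ▷ permute (↭P.++-comm L′ R)

  ⇝-++ : ∀ {L₁ L₁′ L₂ L₂′ : List (V × V)} → L₁ ⇝ L₁′ → L₂ ⇝ L₂′ → L₁ ++ L₂ ⇝ L₁′ ++ L₂′
  ⇝-++ {L₁′ = L₁′} {L₂ = L₂} p q = ⇝-++ʳ L₂ p ▷ ⇝-++ˡ L₁′ q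

  ⇝-dropˡ : ∀ (L : List (V × V)) {R} → L ++ R ⇝ R
  ⇝-dropˡ []      = permute refl
  ⇝-dropˡ (e ∷ L) = delete ▷ ⇝-dropˡ L

-- From edge lists to edge-disjoint paths in a digraph

module Realize {n : ℕ} (G : Digraph n) where

  private
    Edge : Set
    Edge = Fin n × Fin n

  open Counting (≡-dec (Fin._≟_ {n}) (Fin._≟_ {n}))

  -- The edges of all walks are concatenated into one list, so that `Unique es` says at once that
  -- the walks are pairwise edge-disjoint. It is preserved by permuting, deleting and splicing.
  data Trails : List Edge → List Edge → Set where
    []   : Trails [] []
    _∷_  : ∀ {a b L es} (w : Walk G a b) → Trails L es → Trails ((a , b) ∷ L) (edges w ++ es)

  _⊕_ : ∀ {a b c} → Walk G a b → Walk G b c → Walk G a c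
  stop     ⊕ w′ = w′
  step e w ⊕ w′ = step e (w ⊕ w′)

  edges-⊕ : ∀ {a b c} (w : Walk G a b) (w′ : Walk G b c) → edges (w ⊕ w′) ≡ edges w ++ edges w′
  edges-⊕ stop w′       = refl
  edges-⊕ (step e w) w′ = cong (_ ∷_) (edges-⊕ w w′)

  trails-↭ : ∀ {L L′ es} → L ↭ L′ → Trails L es → ∃ λ es′ → Trails L′ es′ × es ↭ es′
  trails-↭ refl r = _ , r , refl
  trails-↭ (prep _ p) (w ∷ r) = let _ , r′ , q = trails-↭ p r in _ , w ∷ r′ , ↭P.++⁺ˡ (edges w) q
  trails-↭ (swap _ _ p) (w ∷ (w′ ∷ r)) = let _ , r′ , q = trails-↭ p r in _ , w′ ∷ (w ∷ r′)
    , ↭-trans (↭P.shifts (edges w) (edges w′)) (↭P.++⁺ˡ (edges w′) (↭P.++⁺ˡ (edges w) q))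
  trails-↭ (trans p p′) r = let _ , r′ , q = trails-↭ p r ; _ , r″ , q′ = trails-↭ p′ r′ in _ , r″ , ↭-trans q q′

  trails-⇝ : ∀ {L L′ es} → L ⇝ L′ → Trails L es → Unique es → ∃ λ es′ → Trails L′ es′ × Unique es′
  trails-⇝ (permute p) r u = let _ , r′ , q = trails-↭ p r in _ , r′ , Unique-↭ q u
  trails-⇝ delete (w ∷ r) u = _ , r , Unique-++ʳ (edges w) u
  trails-⇝ splice (w ∷ (w′ ∷ r)) u = _ , (w ⊕ w′) ∷ r
    , subst Unique (sym (++-assoc (edges w) (edges w′) _) ⊙ cong (_++ _) (sym (edges-⊕ w w′))) u
  trails-⇝ (p ▷ q) r u = let _ , r′ , u′ = trails-⇝ p r u in trails-⇝ q r′ u′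

  walk : ∀ {L es a b} → Trails L es → (a , b) ∈ L → Walk G a b
  walk (w ∷ r) (here refl) = w
  walk (w ∷ r) (there p)   = walk r p

  walk-edges : ∀ {L es a b} (r : Trails L es) (p : (a , b) ∈ L) → ∀ {e} → e ∈ edges (walk r p) → e ∈ es
  walk-edges (w ∷ r) (here refl) e∈ = ∈-++⁺ˡ e∈
  walk-edges (w ∷ r) (there p)   e∈ = ∈-++⁺ʳ (edges w) (walk-edges r p e∈)

  Unique-disjoint : ∀ (xs : List Edge) {ys} → Unique (xs ++ ys) → ∀ {e} → e ∈ xs → e ∉ ys
  Unique-disjoint (x ∷ xs) (x∉ ∷ u) (here refl) e∈ys = All.lookup x∉ (∈-++⁺ʳ xs e∈ys) refl
  Unique-disjoint (x ∷ xs) (x∉ ∷ u) (there e∈)  e∈ys = Unique-disjoint xs u e∈ e∈ys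

  walk-disjoint : ∀ {L es a b c d} (r : Trails L es) → Unique es → (p : (a , b) ∈ L) (q : (c , d) ∈ L) →
                  (a , b) ≢ (c , d) → ∀ {e} → e ∈ edges (walk r p) → e ∉ edges (walk r q)
  walk-disjoint (w ∷ r) u (here refl) (here refl) ne e∈ = ⊥-elim (ne refl)
  walk-disjoint (w ∷ r) u (here refl) (there q) ne e∈ e∈′ = Unique-disjoint (edges w) u e∈ (walk-edges r q e∈′)
  walk-disjoint (w ∷ r) u (there p) (here refl) ne e∈ e∈′ = Unique-disjoint (edges w) u e∈′ (walk-edges r p e∈)
  walk-disjoint (w ∷ r) u (there p) (there q) ne = walk-disjoint r (Unique-++ʳ (edges w) u) p q ne

  Path : ∀ {a b} → Walk G a b → Fin n → Set
  Path {b = b} w x = Σ (Walk G x b) λ w′ → IsPath w′ × (∀ {e} → e ∈ edges w′ → e ∈ edges w)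

  suffix : ∀ {a b x} (w : Walk G a b) → IsPath w → x ∈ vertices w → Path w x
  suffix stop u (here refl) = stop , u , id
  suffix (step e w) u (here refl) = step e w , u , id
  suffix (step e w) (_ ∷ u) (there x∈) = let w′ , u′ , sub = suffix w u x∈ in w′ , u′ , there ∘ sub

  shorten : ∀ {a b} (w : Walk G a b) → Path w a
  shorten stop = stop , [] ∷ [] , λ ()
  shorten {a} (step e w) with shorten w
  ... | w′ , u , sub with Counting.count Fin._≟_ a (vertices w′) in eq
  ... | zero = step e w′ , All.tabulate (λ {x} x∈ a≡x → Counting.∉-count Fin._≟_ eq (subst (_∈ vertices w′) (sym a≡x) x∈)) ∷ u
             , λ { (here refl) → here refl ; (there e∈) → there (sub e∈) }
  ... | suc k = let w″ , u″ , sub″ = suffix w′ u (Counting.∈-count Fin._≟_ (subst (1 ≤_) (sym eq) (s≤s z≤n)))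
                in w″ , u″ , there ∘ sub ∘ sub″

  arcs : List Edge
  arcs = filter (λ (u , v) → Digraph.E G u v Boolₚ.≟ true) (cartesianProduct (allFin n) (allFin n))

  arcs-Unique : Unique arcs
  arcs-Unique = Uniqueₚ.filter⁺ (λ (u , v) → Digraph.E G u v Boolₚ.≟ true)
                  (Uniqueₚ.cartesianProduct⁺ (Uniqueₚ.allFin⁺ n) (Uniqueₚ.allFin⁺ n))

  arcs-trails : Trails arcs arcs
  arcs-trails = go (cartesianProduct (allFin n) (allFin n))
    where
    go : ∀ es → let es′ = filter (λ (u , v) → Digraph.E G u v Boolₚ.≟ true) es in Trails es′ es′
    go [] = []
    go ((u , v) ∷ es) with Digraph.E G u v in eq
    ... | true  = step eq stop ∷ go es
    ... | false = go es

  lookup-injective : ∀ {P : List (Fin n)} → Unique P → ∀ i j → lookup P i ≡ lookup P j → i ≡ j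
  lookup-injective (_ ∷ _) Fin.zero Fin.zero _ = refl
  lookup-injective {x ∷ P} (x∉ ∷ _) Fin.zero (Fin.suc j) eq = ⊥-elim (All.lookup x∉ (∈-lookup j) eq)
  lookup-injective {x ∷ P} (x∉ ∷ _) (Fin.suc i) Fin.zero eq = ⊥-elim (All.lookup x∉ (∈-lookup i) (sym eq))
  lookup-injective (_ ∷ u) (Fin.suc i) (Fin.suc j) eq = cong Fin.suc (lookup-injective u i j eq)

  -- Different pairs of indices give different edges of the product and therefore disjoint trails;
  -- shortening a trail to a simple path only removes edges.
  ⇝⇒ImmersesComplete : ∀ {t P} → Unique P → t ≤ length P → arcs ⇝ cartesianProduct P P → ImmersesComplete G t
  ⇝⇒ImmersesComplete {t} {P} uP t≤ im with trails-⇝ im arcs-trails arcs-Unique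
  ... | es , r , u = f , f-injective , (λ i j _ → proj₁ (path i j)) , (λ i j _ → proj₁ (proj₂ (path i j)))
    , λ i j _ i′ j′ _ ne e e∈ e∈′ → walk-disjoint r u (at i j) (at i′ j′)
         (λ eq → ne (cong₂ _,_ (f-injective (cong proj₁ eq)) (f-injective (cong proj₂ eq))))
         (proj₂ (proj₂ (path i j)) e∈) (proj₂ (proj₂ (path i′ j′)) e∈′)
    where
    f : Fin t → Fin n
    f i = lookup P (inject≤ i t≤)
    f-injective : ∀ {i j} → f i ≡ f j → i ≡ j
    f-injective eq = Finₚ.inject≤-injective t≤ t≤ _ _ (lookup-injective uP _ _ eq)
    at : ∀ i j → (f i , f j) ∈ cartesianProduct P P
    at i j = ∈-cartesianProduct⁺ (∈-lookup {xs = P} (inject≤ i t≤)) (∈-lookup {xs = P} (inject≤ j t≤))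
    path : ∀ i j → Path (walk r (at i j)) (f i)
    path i j = shorten (walk r (at i j))

-- From a biclique in a balanced list to a complete digraph

module Mixing {V : Set} (_≟_ : DecidableEquality V) where

  open Counting _≟_

  tails heads : List (V × V) → List V
  tails = map proj₁
  heads = map proj₂

  Balanced : List (V × V) → Set
  Balanced L = ∀ x → count x (tails L) ≡ count x (heads L)

  tail-∈ : ∀ {a L} → a ∈ tails L → ∃ λ b → ∃ λ L′ → L ↭ (a , b) ∷ L′
  tail-∈ a∈ with ∈-map⁻ proj₁ a∈
  ... | (_ , b) , e∈ , refl = let L′ , p = ∈-↭ e∈ in b , L′ , p

  head-∈ : ∀ {b L} → b ∈ heads L → ∃ λ a → ∃ λ L′ → L ↭ (a , b) ∷ L′
  head-∈ b∈ with ∈-map⁻ proj₂ b∈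
  ... | (a , _) , e∈ , refl = let L′ , p = ∈-↭ e∈ in a , L′ , p

  count-tails : ∀ x {L L′} → L ↭ L′ → count x (tails L) ≡ count x (tails L′)
  count-tails x p = count-↭ x (map⁺ proj₁ p)

  count-heads : ∀ x {L L′} → L ↭ L′ → count x (heads L) ≡ count x (heads L′)
  count-heads x p = count-↭ x (map⁺ proj₂ p)

  -- Flow decomposition: an edge leaving a source is spliced onward until it meets a sink.
  trails : ∀ k R S T → length R ≤ k → length S ≡ length T → (∀ {x} → x ∈ S → x ∉ T) →
           (∀ x → count x (tails R) + count x T ≡ count x (heads R) + count x S) →
           ∃ λ R′ → R ⇝ R′ × tails R′ ↭ S × heads R′ ↭ T
  trails k R [] [] le eq dis bal = [] , subst (_⇝ []) (++-identityʳ R) (⇝-dropˡ R) , refl , refl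
  trails k R (s ∷ S) T le eq dis bal
    -- The source `s` is no sink, so by balance an edge of `R` leaves it.
    with tail-∈ {s} {R} (∈-count (subst (1 ≤_) (sym (sym (+-identityʳ _) ⊙ (cong (_ +_) (sym (count-∉ (dis (here refl)))) ⊙ bal s)))
                 (≤-trans (count-∈ {s} {s ∷ S} (here refl)) (m≤n+m _ (count s (heads R))))))
  ... | y , R₁ , p = main k le (1 ≤? count y T)
    where
    len₁ : length R ≡ suc (length R₁)
    len₁ = ↭-length p
    bal₁ : ∀ x → (ι (x ≟ s) + count x (tails R₁)) + count x T ≡ (ι (x ≟ y) + count x (heads R₁)) + (ι (x ≟ s) + count x S)
    bal₁ x = cong (_+ count x T) (sym (count-tails x p)) ⊙ (bal x ⊙ cong (_+ (ι (x ≟ s) + count x S)) (count-heads x p))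
    cancel₁ : ∀ a b c d e f → (a + b) + (c + d) ≡ (c + e) + (a + f) → b + d ≡ e + f
    cancel₁ a b c d e f h = +-cancelˡ-≡ (a + c) _ _ (l₁ a b c d ⊙ (h ⊙ l₂ a c e f))
      where
      l₁ : ∀ a b c d → a + c + (b + d) ≡ (a + b) + (c + d)
      l₁ = solve-∀
      l₂ : ∀ a c e f → (c + e) + (a + f) ≡ a + c + (e + f)
      l₂ = solve-∀
    main : ∀ k → length R ≤ k → Dec (1 ≤ count y T) → ∃ λ R′ → R ⇝ R′ × tails R′ ↭ s ∷ S × heads R′ ↭ T
    main zero le′ _ with ≤-trans (≤-reflexive (sym len₁)) le′
    ... | ()
    main (suc k) le′ (yes y∈′) =
      let T′ , q = ∈-↭ (∈-count {y} {T} y∈′)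
          R′ , im , pt , ph = trails k R₁ S T′ (≤-pred (≤-trans (≤-reflexive (sym len₁)) le′))
             (suc-injective (eq ⊙ ↭-length q))
             (λ x∈ x∈T′ → dis (there x∈) (∈-resp-↭ (↭-sym q) (there x∈T′)))
             (λ x → cancel₁ (ι (x ≟ s)) _ (ι (x ≟ y)) _ _ _
                 (cong (ι (x ≟ s) + count x (tails R₁) +_) (sym (count-↭ x q)) ⊙ bal₁ x))
      in (s , y) ∷ R′ , (permute p ▷ ⇝-++ˡ ((s , y) ∷ []) im) , prep s pt , ↭-trans (prep y ph) (↭-sym q)
    main (suc k) le′ (no y∉′) = inner (y ≟ s)
      where
      no-y : count y T ≡ 0
      no-y = n<1⇒n≡0 (≰⇒> y∉′)
      inner : Dec (y ≡ s) → ∃ λ R′ → R ⇝ R′ × tails R′ ↭ s ∷ S × heads R′ ↭ T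
      inner (yes refl) =
        let R′ , im , pt , ph = trails k R₁ (s ∷ S) T (≤-pred (≤-trans (≤-reflexive (sym len₁)) le′)) eq dis
              (λ x → +-cancelˡ-≡ (ι (x ≟ s)) _ _ (sym (+-assoc (ι (x ≟ s)) _ _) ⊙ (bal₁ x ⊙ +-assoc (ι (x ≟ s)) _ _)))
        in R′ , (permute p ▷ delete ▷ im) , pt , ph
      inner (no y≢s) =
        -- Here `y` has an incoming edge and is neither a sink nor `s`, so by balance an edge leaves
        -- it. Splicing shortens the list, which ends the recursion.
        let z , R₂ , q = tail-∈ {y} {R₁} (∈-count (subst (1 ≤_) (sym (lhs ⊙ bal₁ y)) (≤-trans one (m≤m+n _ _))))
            len₂ = len₁ ⊙ cong suc (↭-length q)
            R′ , im , pt , ph = trails k ((s , z) ∷ R₂) (s ∷ S) T (≤-pred (≤-trans (≤-reflexive (sym len₂)) le′)) eq dis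
              (λ x → fin (ι (x ≟ s)) (ι (x ≟ y)) (count x (tails R₂)) (ι (x ≟ z)) (count x (heads R₂)) (count x T) (count x S)
                 (cong (λ w → ι (x ≟ s) + w + count x T) (sym (count-tails x q)) ⊙
                 (bal₁ x ⊙ cong (λ w → ι (x ≟ y) + w + (ι (x ≟ s) + count x S)) (count-heads x q))))
        in R′ , (permute (↭-trans p (prep (s , y) q)) ▷ splice ▷ im) , pt , ph
        where
        lhs : count y (tails R₁) ≡ ι (y ≟ s) + count y (tails R₁) + count y T
        lhs = sym (cong₂ (λ a b → a + count y (tails R₁) + b) (ι-no (y ≟ s) y≢s) no-y ⊙ +-identityʳ _)
        one : 1 ≤ ι (y ≟ y) + count y (heads R₁)
        one = subst (λ w → 1 ≤ w + count y (heads R₁)) (sym (ι-yes (y ≟ y) refl)) (s≤s z≤n)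
        fin : ∀ s y o z i t c → (s + (y + o)) + t ≡ (y + (z + i)) + (s + c) → (s + o) + t ≡ (z + i) + (s + c)
        fin s y o z i t c h = +-cancelˡ-≡ y _ _ (l₁ s y o t ⊙ (h ⊙ +-assoc y (z + i) (s + c)))
          where
          l₁ : ∀ s y o t → y + ((s + o) + t) ≡ (s + (y + o)) + t
          l₁ = solve-∀

  Even : ℕ → Set
  Even k = ∃ λ h → k ≡ h + h

  Even-2+ : ∀ {k} → Even (suc (suc k)) → Even k
  Even-2+ (suc h , eq) = h , suc-injective (suc-injective eq ⊙ +-suc h h)

  Even-1+ : ∀ {k} → Even (suc k) → 1 ≤ k
  Even-1+ {zero} (suc zero , ())
  Even-1+ {zero} (suc (suc h) , ())
  Even-1+ {suc k} _ = s≤s z≤n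

  Even-ι : ∀ {P : Set} (d : Dec P) {k} → Even (ι d + (ι d + k)) → Even k
  Even-ι (yes _) = Even-2+
  Even-ι (no _)  = id

  Halves : List (V × V) → Set
  Halves X = ∃₂ λ Y Z → X ↭ Y ++ Z × (∀ x → count x (tails Y) ≡ count x (tails Z)) × (∀ x → count x (heads Y) ≡ count x (heads Z))

  Halves-sym : ∀ {X} → Halves X → Halves X
  Halves-sym (Y , Z , p , t , h) = Z , Y , ↭-trans p (↭P.++-comm Y Z) , sym ∘ t , sym ∘ h

  -- Euler splitting: the path (x , y) , (x₁ , y) , (x₁ , y₂) is contracted to (x , y₂), and its edges alternate between the halves.
  halve : ∀ k X → length X ≤ k → (∀ x → Even (count x (tails X))) → (∀ y → Even (count y (heads X))) → Halves X
  halve k [] le et eh = [] , [] , refl , (λ _ → refl) , (λ _ → refl)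
  halve (suc k) ((x , y) ∷ X) (s≤s le) et eh
    with head-∈ {y} {X} (∈-count (Even-1+ (subst Even (count-here y (heads X)) (eh y))))
  ... | x₁ , X₂ , p with x₁ ≟ x
  ... | yes refl =
    let Y , Z , q , t , h = halve k X₂ (≤-trans (n≤1+n _) (≤-trans (≤-reflexive (sym (↭-length p))) le))
          (λ z → Even-ι (z ≟ x) (subst (λ w → Even (ι (z ≟ x) + w)) (count-tails z p) (et z)))
          (λ z → Even-ι (z ≟ y) (subst (λ w → Even (ι (z ≟ y) + w)) (count-heads z p) (eh z)))
    in (x , y) ∷ Y , (x , y) ∷ Z , prep _ (↭-trans p (↭-trans (prep _ q) (↭-sym (shift (x , y) Y Z))))
       , (λ z → cong (ι (z ≟ x) +_) (t z)) , (λ z → cong (ι (z ≟ y) +_) (h z))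
  ... | no x₁≢x with tail-∈ {x₁} {X₂} (∈-count (Even-1+ (subst Even
            (count-there x₁≢x (tails X) ⊙ (count-tails x₁ p ⊙ count-here x₁ (tails X₂))) (et x₁))))
  ... | y₂ , X₃ , q =
    let H = halve k ((x , y₂) ∷ X₃) (≤-trans (n≤1+n _) (≤-trans (≤-reflexive (sym (↭-length p ⊙ cong suc (↭-length q)))) le))
          (λ z → Even-ι (z ≟ x₁) (subst Even (l₁ (ι (z ≟ x)) (ι (z ≟ x₁)) (count z (tails X₃)))
              (subst (λ w → Even (ι (z ≟ x) + w)) (count-tails z p ⊙ cong (ι (z ≟ x₁) +_) (count-tails z q)) (et z))))
          (λ z → Even-ι (z ≟ y) (subst (λ w → Even (ι (z ≟ y) + w)) (count-heads z p ⊙ cong (ι (z ≟ y) +_) (count-heads z q)) (eh z)))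
    in insert (∈-++⁻ (proj₁ H) (∈-resp-↭ (proj₁ (proj₂ (proj₂ H))) (here refl))) H refl
    where
    l₁ : ∀ a b c → a + (b + (b + c)) ≡ b + (b + (a + c))
    l₁ = solve-∀
    l₂ : ∀ a b c d → a + (b + c) ≡ b + d → a + c ≡ d
    l₂ a b c d h = +-cancelˡ-≡ b _ _ (l a b c ⊙ h)
      where
      l : ∀ a b c → b + (a + c) ≡ a + (b + c)
      l = solve-∀
    -- In the half that contains the contracted edge, the outer edges `(x , y)` and `(x₁ , y₂)`
    -- replace it; the middle edge `(x₁ , y)` goes to the other half. Both halves gain `x₁` as a
    -- tail and `y` as a head.
    build : ∀ Y Z → (x , y₂) ∈ Y → (x , y₂) ∷ X₃ ↭ Y ++ Z → (∀ z → count z (tails Y) ≡ count z (tails Z)) →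
            (∀ z → count z (heads Y) ≡ count z (heads Z)) → Halves ((x , y) ∷ X)
    build Y Z e∈ r t h =
      let Y₁ , s = ∈-↭ e∈
          r′ = drop-∷ (↭-trans r (↭P.++⁺ʳ Z s))
      in (x , y) ∷ (x₁ , y₂) ∷ Y₁ , (x₁ , y) ∷ Z
         , prep _ (↭-trans p (↭-trans (prep _ (↭-trans q (prep _ r′))) (↭-sym (shift (x₁ , y) ((x₁ , y₂) ∷ Y₁) Z))))
         , (λ z → l₃ (ι (z ≟ x)) (ι (z ≟ x₁)) _ ⊙ cong (ι (z ≟ x₁) +_) (sym (count-tails z s) ⊙ t z))
         , (λ z → cong (ι (z ≟ y) +_) (sym (count-heads z s) ⊙ h z))
      where
      l₃ : ∀ a b c → a + (b + c) ≡ b + (a + c)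
      l₃ = solve-∀
    insert : ∀ {Y Z} → (x , y₂) ∈ Y ⊎ (x , y₂) ∈ Z → (H : Halves ((x , y₂) ∷ X₃)) → (Y , Z) ≡ (proj₁ H , proj₁ (proj₂ H)) → Halves ((x , y) ∷ X)
    insert (inj₁ e∈) (Y , Z , r , t , h) refl = build Y Z e∈ r t h
    insert (inj₂ e∈) (Y , Z , r , t , h) refl = Halves-sym (build Z Y e∈ (↭-trans r (↭P.++-comm Y Z)) (sym ∘ t) (sym ∘ h))

  -- Every star edge `(a , q)` is spliced to an edge `(q , p)` of `X`, which moves the star at `a`
  -- from the tails of `X` to its heads.
  glue : ∀ a X → map (a ,_) (tails X) ++ X ⇝ map (a ,_) (heads X)
  glue a []            = permute refl
  glue a ((q , p) ∷ X) = permute (prep _ (shift (q , p) (map (a ,_) (tails X)) X)) ▷ splice ▷ ⇝-++ˡ ((a , p) ∷ []) (glue a X)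

  -- The regular bipartite multigraph X splits into 2 ^ k perfect matchings; the i-th one is glued to the star of the i-th element of A.
  mix : ∀ k A Q P X → length A ≡ 2 ^ k → (∀ x → count x (tails X) ≡ 2 ^ k * count x Q) →
        (∀ x → count x (heads X) ≡ 2 ^ k * count x P) → cartesianProduct A Q ++ X ⇝ cartesianProduct A P
  mix zero (a ∷ []) Q P X len ht hh =
    permute (↭P.++⁺ʳ X (↭-trans (↭-reflexive (++-identityʳ _)) (map⁺ (a ,_) (counts⇒↭ Q (tails X) (λ x → sym (ht x ⊙ +-identityʳ _))))))
    ▷ glue a X ▷ permute (↭-trans (map⁺ (a ,_) (counts⇒↭ (heads X) P (λ x → hh x ⊙ +-identityʳ _))) (↭-reflexive (sym (++-identityʳ _))))
  mix (suc k) A Q P X len ht hh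
    with halve (length X) X ≤-refl (λ x → 2 ^ k * count x Q , ht x ⊙ l (2 ^ k) (count x Q)) (λ x → 2 ^ k * count x P , hh x ⊙ l (2 ^ k) (count x P))
    where
    l : ∀ a b → 2 * a * b ≡ a * b + a * b
    l = solve-∀
  ... | Y , Z , p , t , h = subst (λ w → cartesianProduct w Q ++ X ⇝ cartesianProduct w P) (take++drop≡id (2 ^ k) A) halves
    where
    A₁ A₂ : List V
    A₁ = take (2 ^ k) A
    A₂ = drop (2 ^ k) A
    len₁ : length A₁ ≡ 2 ^ k
    len₁ = length-take (2 ^ k) A ⊙ m≤n⇒m⊓n≡m (≤-trans (m≤m+n (2 ^ k) _) (≤-reflexive (sym len)))
    len₂ : length A₂ ≡ 2 ^ k
    len₂ = length-drop (2 ^ k) A ⊙ (cong (_∸ 2 ^ k) len ⊙ (m+n∸m≡n (2 ^ k) (2 ^ k + 0) ⊙ +-identityʳ _))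
    half : ∀ a b c d → a ≡ b → a + b ≡ 2 * c * d → a ≡ c * d
    half a b c d refl eq = *-cancelˡ-≡ a (c * d) 2 (cong (a +_) (+-identityʳ a) ⊙ (eq ⊙ *-assoc 2 c d))
    tY : ∀ x → count x (tails Y) ≡ 2 ^ k * count x Q
    tY x = half _ _ (2 ^ k) _ (t x) (sym (count-++ x (tails Y) (tails Z)) ⊙ (cong (count x) (sym (map-++ proj₁ Y Z)) ⊙ (sym (count-tails x p) ⊙ ht x)))
    hY : ∀ x → count x (heads Y) ≡ 2 ^ k * count x P
    hY x = half _ _ (2 ^ k) _ (h x) (sym (count-++ x (heads Y) (heads Z)) ⊙ (cong (count x) (sym (map-++ proj₂ Y Z)) ⊙ (sym (count-heads x p) ⊙ hh x)))
    halves : cartesianProduct (A₁ ++ A₂) Q ++ X ⇝ cartesianProduct (A₁ ++ A₂) P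
    halves rewrite cartesianProductWith-distribʳ-++ _,_ A₁ A₂ Q | cartesianProductWith-distribʳ-++ _,_ A₁ A₂ P =
      permute (↭-trans (↭P.++⁺ˡ (cartesianProduct A₁ Q ++ cartesianProduct A₂ Q) p) (interchange (cartesianProduct A₁ Q) (cartesianProduct A₂ Q) Y Z))
      ▷ ⇝-++ (mix k A₁ Q P Y len₁ tY hY)
             (mix k A₂ Q P Z len₂ (λ x → sym (t x) ⊙ tY x) (λ x → sym (h x) ⊙ hY x))
      where
      interchange : ∀ (a b c d : List (V × V)) → (a ++ b) ++ (c ++ d) ↭ (a ++ c) ++ (b ++ d)
      interchange a b c d = ↭-trans (↭-reflexive (++-assoc a b (c ++ d))) (↭-trans (↭P.++⁺ˡ a (↭P.shifts b c)) (↭-reflexive (sym (++-assoc a c (b ++ d)))))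

  tails-product : ∀ x P Q → count x (tails (cartesianProduct P Q)) ≡ length Q * count x P
  tails-product x [] Q = sym (*-zeroʳ (length Q))
  tails-product x (p ∷ P) Q = cong (count x) (map-++ proj₁ (map (p ,_) Q) (cartesianProduct P Q))
    ⊙ (count-++ x (tails (map (p ,_) Q)) (tails (cartesianProduct P Q))
    ⊙ (cong₂ _+_ (star Q) (tails-product x P Q) ⊙ sym (*-distribˡ-+ (length Q) (ι (x ≟ p)) (count x P))))
    where
    star : ∀ Q → count x (tails (map (p ,_) Q)) ≡ length Q * ι (x ≟ p)
    star [] = refl
    star (q ∷ Q) = cong (ι (x ≟ p) +_) (star Q)

  heads-product : ∀ x P Q → count x (heads (cartesianProduct P Q)) ≡ length P * count x Q
  heads-product x [] Q = refl
  heads-product x (p ∷ P) Q = cong (count x) (map-++ proj₂ (map (p ,_) Q) (cartesianProduct P Q))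
    ⊙ (count-++ x (heads (map (p ,_) Q)) (heads (cartesianProduct P Q)) ⊙ cong₂ _+_ (star Q) (heads-product x P Q))
    where
    star : ∀ Q → count x (heads (map (p ,_) Q)) ≡ count x Q
    star [] = refl
    star (q ∷ Q) = cong (ι (x ≟ q) +_) (star Q)

  -- Outside the biclique `C`, balance leaves each element of `Q` with `2 ^ k` surplus outgoing
  -- edges and each element of `P` with `2 ^ k` surplus incoming ones. So `heads C` and `tails C`
  -- are the sources and sinks for `trails`, and they are disjoint because `P` and `Q` are.
  biclique : ∀ k {L P Q} → Balanced L → Unique P → Unique Q → length P ≡ 2 ^ k → length Q ≡ 2 ^ k →
             (∀ {x} → x ∈ Q → x ∉ P) → (∀ {p q} → p ∈ P → q ∈ Q → (p , q) ∈ L) → L ⇝ cartesianProduct P P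
  biclique k {L} {P} {Q} bal uP uQ lP lQ dis complete =
    let R , p = Counting.sublist-↭ (≡-dec _≟_ _≟_) (Uniqueₚ.cartesianProduct⁺ uP uQ)
                  (λ e∈ → let a , b = ∈-cartesianProduct⁻ P Q e∈ in complete a b)
        R′ , im , pt , ph = trails (length R) R (heads C) (tails C) ≤-refl (length-map proj₂ C ⊙ sym (length-map proj₁ C))
           (λ x∈ x∈′ → dis (inQ x∈) (inP x∈′))
           (λ x → +-comm (count x (tails R)) _ ⊙ (sym (count-++ x (tails C) (tails R)) ⊙ (cong (count x) (sym (map-++ proj₁ C R)) ⊙
              (sym (count-tails x p) ⊙ (bal x ⊙ (count-heads x p ⊙ (cong (count x) (map-++ proj₂ C R) ⊙ (count-++ x (heads C) (heads R)
              ⊙ +-comm (count x (heads C)) _))))))))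
    in permute p ▷ ⇝-++ˡ C im ▷ mix k P Q P R′ lP
         (λ x → count-↭ x pt ⊙ (heads-product x P Q ⊙ cong (_* count x Q) lP))
         (λ x → count-↭ x ph ⊙ (tails-product x P Q ⊙ cong (_* count x P) lQ))
    where
    C : List (V × V)
    C = cartesianProduct P Q
    inQ : ∀ {x} → x ∈ heads C → x ∈ Q
    inQ x∈ with ∈-map⁻ proj₂ x∈
    ... | (a , b) , e∈ , refl = proj₂ (∈-cartesianProduct⁻ P Q e∈)
    inP : ∀ {x} → x ∈ tails C → x ∈ P
    inP x∈ with ∈-map⁻ proj₁ x∈
    ... | (a , b) , e∈ , refl = proj₁ (∈-cartesianProduct⁻ P Q e∈)

  in-take : ∀ n {Z : List V} {z} → z ∈ take n Z → z ∈ Z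
  in-take (suc n) {_ ∷ Z} (here e) = here e
  in-take (suc n) {_ ∷ Z} (there z∈) = there (in-take n z∈)

  -- X and Y may overlap, so Y is given twice the length of X and its elements in X are discarded.
  stuck : ∀ k {L X Y} → Balanced L → Unique X → Unique Y → length X ≡ 2 ^ k → length Y ≡ 2 * 2 ^ k →
          (∀ {x y} → x ∈ X → y ∈ Y → x ≢ y → (x , y) ∈ L) → L ⇝ cartesianProduct X X
  stuck k {L} {X} {Y} bal uX uY lX lY adj =
    let Z , uZ , sub , av , le = avoid X uY
        N = 2 ^ k
        N≤Z = +-cancelʳ-≤ N _ _ (≤-trans (≤-reflexive (cong (N +_) (sym (+-identityʳ N)) ⊙ sym lY)) (≤-trans le (≤-reflexive (cong (length Z +_) lX))))
    in biclique k bal uX (Uniqueₚ.take⁺ N uZ) lX (length-take N Z ⊙ m≤n⇒m⊓n≡m N≤Z)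
         (λ z∈ → av (in-take N z∈))
         (λ x∈ z∈ → adj x∈ (sub (in-take N z∈)) (λ { refl → av (in-take N z∈) x∈ }))

-- The edges at a vertex and greedy pairings of their ends

module Vertex {V : Set} (_≟_ : DecidableEquality V) (M : ℕ) (1≤M : 1 ≤ M) where

  open Mixing _≟_ public
  open Slope M 1≤M public
  open Cost _≟_ public

  _≟ᴱ_ : DecidableEquality (V × V)
  _≟ᴱ_ = ≡-dec _≟_ _≟_

  module Edges = Cost _≟ᴱ_

  mult : V × V → List (V × V) → ℕ
  mult = Edges.count

  Loopless : List (V × V) → Set
  Loopless L = ∀ {a b} → (a , b) ∈ L → a ≢ b

  into from : V → List V → List (V × V)
  into v = map (_, v)
  from v = map (v ,_)

  ι-cong : ∀ {P Q : Set} (p : Dec P) (q : Dec Q) → (P → Q) → (Q → P) → ι p ≡ ι q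
  ι-cong (yes p) q f g = sym (ι-yes q (f p))
  ι-cong (no ¬p) q f g = sym (ι-no q (¬p ∘ g))

  module Injection (f : V → V × V) (f-injective : ∀ {x y} → f x ≡ f y → x ≡ y) where

    mult-map : ∀ x xs → mult (f x) (map f xs) ≡ count x xs
    mult-map x [] = refl
    mult-map x (y ∷ xs) = cong₂ _+_ (ι-cong (f x ≟ᴱ f y) (x ≟ y) f-injective (cong f)) (mult-map x xs)

    cost-map : ∀ xs → Edges.cost (map f xs) ≡ cost xs
    cost-map [] = refl
    cost-map (x ∷ xs) = cong₂ (λ m c → slope m + c) (mult-map x xs) (cost-map xs)

  tails-into : ∀ v I → tails (into v I) ≡ I
  tails-into v [] = refl
  tails-into v (a ∷ I) = cong (a ∷_) (tails-into v I)

  heads-from : ∀ v O → heads (from v O) ≡ O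
  heads-from v [] = refl
  heads-from v (b ∷ O) = cong (b ∷_) (heads-from v O)

  count-tails-from : ∀ x v O → count x (tails (from v O)) ≡ length O * ι (x ≟ v)
  count-tails-from x v [] = refl
  count-tails-from x v (b ∷ O) = cong (ι (x ≟ v) +_) (count-tails-from x v O)

  count-heads-into : ∀ x v I → count x (heads (into v I)) ≡ length I * ι (x ≟ v)
  count-heads-into x v [] = refl
  count-heads-into x v (a ∷ I) = cong (ι (x ≟ v) +_) (count-heads-into x v I)

  count-tails-++ : ∀ x L R → count x (tails (L ++ R)) ≡ count x (tails L) + count x (tails R)
  count-tails-++ x L R = cong (count x) (map-++ proj₁ L R) ⊙ count-++ x (tails L) (tails R)

  count-heads-++ : ∀ x L R → count x (heads (L ++ R)) ≡ count x (heads L) + count x (heads R)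
  count-heads-++ x L R = cong (count x) (map-++ proj₂ L R) ⊙ count-++ x (heads L) (heads R)

  star-tails : ∀ x v I O L → count x (tails (into v I ++ from v O ++ L)) ≡ count x I + (length O * ι (x ≟ v) + count x (tails L))
  star-tails x v I O L = count-tails-++ x (into v I) _ ⊙ cong₂ _+_ (cong (count x) (tails-into v I))
    (count-tails-++ x (from v O) L ⊙ cong (_+ count x (tails L)) (count-tails-from x v O))

  star-heads : ∀ x v I O L → count x (heads (into v I ++ from v O ++ L)) ≡ length I * ι (x ≟ v) + (count x O + count x (heads L))
  star-heads x v I O L = count-heads-++ x (into v I) _ ⊙ cong₂ _+_ (count-heads-into x v I)
    (count-heads-++ x (from v O) L ⊙ cong (_+ count x (heads L)) (cong (count x) (heads-from v O)))

  ins outs : V → List (V × V) → List V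
  ins v [] = []
  ins v ((a , b) ∷ L) with b ≟ v
  ... | yes _ = a ∷ ins v L
  ... | no _  = ins v L
  outs v [] = []
  outs v ((a , b) ∷ L) with a ≟ v
  ... | yes _ = b ∷ outs v L
  ... | no _  = outs v L

  others : V → List (V × V) → List (V × V)
  others v [] = []
  others v ((a , b) ∷ L) with a ≟ v | b ≟ v
  ... | no _ | no _ = (a , b) ∷ others v L
  ... | _    | _    = others v L

  at-vertex : ∀ v L → Loopless L → L ↭ into v (ins v L) ++ from v (outs v L) ++ others v L
  at-vertex v [] ll = refl
  at-vertex v ((a , b) ∷ L) ll with a ≟ v | b ≟ v | at-vertex v L (ll ∘ there)
  ... | yes refl | yes refl | _ = ⊥-elim (ll (here refl) refl)
  ... | yes refl | no _     | p = ↭-trans (prep _ p) (↭-sym (shift (v , b) (into v (ins v L)) _))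
  ... | no _     | yes refl | p = prep _ p
  ... | no _     | no _     | p = ↭-trans (prep _ p) (↭-trans (↭-sym (shift (a , b) (into v (ins v L)) _))
                                    (↭P.++⁺ˡ (into v (ins v L)) (↭-sym (shift (a , b) (from v (outs v L)) _))))

  others-⊆ : ∀ v L {e} → e ∈ others v L → e ∈ L
  others-⊆ v ((a , b) ∷ L) e∈ with a ≟ v | b ≟ v
  others-⊆ v ((a , b) ∷ L) (here e)   | no _  | no _  = here e
  others-⊆ v ((a , b) ∷ L) (there e∈) | no _  | no _  = there (others-⊆ v L e∈)
  others-⊆ v ((a , b) ∷ L) e∈         | yes _ | yes _ = there (others-⊆ v L e∈)
  others-⊆ v ((a , b) ∷ L) e∈         | yes _ | no _  = there (others-⊆ v L e∈)
  others-⊆ v ((a , b) ∷ L) e∈         | no _  | yes _ = there (others-⊆ v L e∈)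

  others-avoid : ∀ v L {a b} → (a , b) ∈ others v L → a ≢ v × b ≢ v
  others-avoid v ((a , b) ∷ L) e∈ with a ≟ v | b ≟ v
  others-avoid v ((a , b) ∷ L) (here refl) | no p  | no q  = p , q
  others-avoid v ((a , b) ∷ L) (there e∈)  | no _  | no _  = others-avoid v L e∈
  others-avoid v ((a , b) ∷ L) e∈          | yes _ | yes _ = others-avoid v L e∈
  others-avoid v ((a , b) ∷ L) e∈          | yes _ | no _  = others-avoid v L e∈
  others-avoid v ((a , b) ∷ L) e∈          | no _  | yes _ = others-avoid v L e∈

  ins-∈ : ∀ v L {a} → a ∈ ins v L → (a , v) ∈ L
  ins-∈ v ((a , b) ∷ L) a∈ with b ≟ v
  ins-∈ v ((a , b) ∷ L) (here refl) | yes refl = here refl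
  ins-∈ v ((a , b) ∷ L) (there a∈)  | yes refl = there (ins-∈ v L a∈)
  ins-∈ v ((a , b) ∷ L) a∈          | no _     = there (ins-∈ v L a∈)

  outs-∈ : ∀ v L {b} → b ∈ outs v L → (v , b) ∈ L
  outs-∈ v ((a , b) ∷ L) b∈ with a ≟ v
  outs-∈ v ((a , b) ∷ L) (here refl) | yes refl = here refl
  outs-∈ v ((a , b) ∷ L) (there b∈)  | yes refl = there (outs-∈ v L b∈)
  outs-∈ v ((a , b) ∷ L) b∈          | no _     = there (outs-∈ v L b∈)

  length-ins : ∀ v L → length (ins v L) ≡ count v (heads L)
  length-ins v [] = refl
  length-ins v ((a , b) ∷ L) with b ≟ v
  ... | yes refl rewrite ι-yes (v ≟ v) refl = cong suc (length-ins v L)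
  ... | no b≢v rewrite ι-no (v ≟ b) (b≢v ∘ sym) = length-ins v L

  length-outs : ∀ v L → length (outs v L) ≡ count v (tails L)
  length-outs v [] = refl
  length-outs v ((a , b) ∷ L) with a ≟ v
  ... | yes refl rewrite ι-yes (v ≟ v) refl = cong suc (length-outs v L)
  ... | no a≢v rewrite ι-no (v ≟ a) (a≢v ∘ sym) = length-outs v L

  count-ins : ∀ a v L → count a (ins v L) ≡ mult (a , v) L
  count-ins a v [] = refl
  count-ins a v ((a′ , b) ∷ L) with b ≟ v
  ... | yes refl = cong₂ _+_ (ι-cong (a ≟ a′) ((a , v) ≟ᴱ (a′ , v)) (cong (_, v)) (cong proj₁)) (count-ins a v L)
  ... | no b≢v rewrite ι-no ((a , v) ≟ᴱ (a′ , b)) (b≢v ∘ sym ∘ cong proj₂) = count-ins a v L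

  count-outs : ∀ b v L → count b (outs v L) ≡ mult (v , b) L
  count-outs b v [] = refl
  count-outs b v ((a , b′) ∷ L) with a ≟ v
  ... | yes refl = cong₂ _+_ (ι-cong (b ≟ b′) ((v , b) ≟ᴱ (v , b′)) (cong (v ,_)) (cong proj₂)) (count-outs b v L)
  ... | no a≢v rewrite ι-no ((v , b) ≟ᴱ (a , b′)) (a≢v ∘ sym ∘ cong proj₁) = count-outs b v L

  -- The edges into `v`, out of `v` and elsewhere have no edge in common, so no class of parallel
  -- edges is split.
  cost-at-vertex : ∀ v L → Loopless L → Edges.cost L ≡ cost (ins v L) + (cost (outs v L) + Edges.cost (others v L))
  cost-at-vertex v L ll = Edges.cost-↭ (at-vertex v L ll)
    ⊙ (Edges.cost-++ (into v (ins v L)) _ into-disjoint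
    ⊙ cong₂ _+_ (Injection.cost-map (_, v) (cong proj₁) (ins v L))
      (Edges.cost-++ (from v (outs v L)) _ from-disjoint
      ⊙ cong (_+ Edges.cost (others v L)) (Injection.cost-map (v ,_) (cong proj₂) (outs v L))))
    where
    from-disjoint : ∀ {e} → e ∈ from v (outs v L) → e ∉ others v L
    from-disjoint e∈ e∈′ with ∈-map⁻ (v ,_) e∈
    ... | b , _ , refl = proj₁ (others-avoid v L e∈′) refl
    into-disjoint : ∀ {e} → e ∈ into v (ins v L) → e ∉ from v (outs v L) ++ others v L
    into-disjoint e∈ e∈′ with ∈-map⁻ (_, v) e∈ | ∈-++⁻ (from v (outs v L)) e∈′
    ... | a , a∈ , refl | inj₂ q = proj₂ (others-avoid v L q) refl
    ... | a , a∈ , refl | inj₁ q with ∈-map⁻ (v ,_) q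
    ... | b , b∈ , refl = ll (ins-∈ v L a∈) refl

  -- Each pair `(a , b)` of `Ps` is made by splicing one copy of `(a , v)` to one copy of `(v , b)`.
  contract : ∀ v Ps I O L → into v (tails Ps ++ I) ++ from v (heads Ps ++ O) ++ L ⇝ into v I ++ from v O ++ (Ps ++ L)
  contract v [] I O L = permute refl
  contract v ((a , b) ∷ Ps) I O L =
    permute (prep (a , v) (shift (v , b) (into v (tails Ps ++ I)) _)) ▷ splice
    ▷ ⇝-++ˡ ((a , b) ∷ []) (contract v Ps I O L)
    ▷ permute (↭-trans (↭-sym (shift (a , b) (into v I) _)) (↭P.++⁺ˡ (into v I) (↭-sym (shift (a , b) (from v O) (Ps ++ L)))))

  contract-↭ : ∀ v {I O I′ O′} Ps {L} → I ↭ tails Ps ++ I′ → O ↭ heads Ps ++ O′ →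
               into v I ++ from v O ++ L ⇝ into v I′ ++ from v O′ ++ (Ps ++ L)
  contract-↭ v Ps p q = permute (↭P.++⁺ (map⁺ (_, v) p) (↭P.++⁺ʳ _ (map⁺ (v ,_) q))) ▷ contract v Ps _ _ _

  -- Ok is tested on the multiplicity of a pair at the moment it is added, which bounds the energy it adds by s.
  record Matching (Ok : ℕ → Set) (s : ℕ) (X Y : List V) (L : List (V × V)) : Set where
    field
      pairs   : List (V × V)
      X′ Y′   : List V
      X-split : X ↭ tails pairs ++ X′
      Y-split : Y ↭ heads pairs ++ Y′
      proper  : Loopless pairs
      price   : Edges.cost (pairs ++ L) ≤ Edges.cost L + s * length pairs
      maximal : ∀ {a b} → a ∈ X′ → b ∈ Y′ → a ≢ b → ¬ Ok (mult (a , b) (pairs ++ L))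

    X-length : length X ≡ length pairs + length X′
    X-length = ↭-length X-split ⊙ (length-++ (tails pairs) ⊙ cong (_+ length X′) (length-map proj₁ pairs))

    Y-length : length Y ≡ length pairs + length Y′
    Y-length = ↭-length Y-split ⊙ (length-++ (heads pairs) ⊙ cong (_+ length Y′) (length-map proj₂ pairs))

  module Greedy {Ok : ℕ → Set} (Ok? : Decidable Ok) (s : ℕ) (cheap : ∀ {m} → Ok m → slope m ≤ s) where

    Pick : List (V × V) → V → V → Set
    Pick L a b = ¬ (a ≡ b) × Ok (mult (a , b) L)

    pick? : ∀ L a b → Dec (Pick L a b)
    pick? L a b = ¬? (a ≟ b) ×-dec Ok? (mult (a , b) L)

    greedy : ∀ k X Y L → length X ≤ k → Matching Ok s X Y L
    greedy k X Y L le with any? (λ a → any? (pick? L a) Y) X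
    ... | no none = record
      { pairs = [] ; X′ = X ; Y′ = Y ; X-split = refl ; Y-split = refl ; proper = λ () ; price = m≤m+n _ _
      ; maximal = λ a∈ b∈ a≢b ok → none (lose a∈ (lose b∈ (a≢b , ok))) }
    ... | yes some with find some
    ... | a , a∈ , some′ with find some′
    ... | b , b∈ , a≢b , ok with ∈-↭ a∈ | ∈-↭ b∈
    greedy zero X Y L le | yes _ | a , a∈ , _ | b , b∈ , a≢b , ok | X₁ , p | Y₁ , q with ≤-trans (≤-reflexive (sym (↭-length p))) le
    ... | ()
    greedy (suc k) X Y L le | yes _ | a , a∈ , _ | b , b∈ , a≢b , ok | X₁ , p | Y₁ , q = record
      { pairs = (a , b) ∷ pairs ; X′ = X′ ; Y′ = Y′
      ; X-split = ↭-trans p (prep a X-split) ; Y-split = ↭-trans q (prep b Y-split)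
      ; proper = λ { (here refl) → a≢b ; (there e∈) → proper e∈ }
      ; price = ≤-trans (≤-reflexive (Edges.cost-↭ (↭-sym sh)))
                (≤-trans price (≤-trans (+-monoˡ-≤ (s * length pairs) (+-monoˡ-≤ (Edges.cost L) (cheap ok)))
                (≤-reflexive (lem s (Edges.cost L) (length pairs)))))
      ; maximal = λ a∈ b∈ ne ok′ → maximal a∈ b∈ ne (subst Ok (Edges.count-↭ _ (↭-sym sh)) ok′) }
      where
      open Matching (greedy k X₁ Y₁ ((a , b) ∷ L) (≤-pred (≤-trans (≤-reflexive (sym (↭-length p))) le)))
      sh : pairs ++ (a , b) ∷ L ↭ (a , b) ∷ pairs ++ L
      sh = shift (a , b) pairs L
      lem : ∀ s c l → s + c + s * l ≡ c + s * (1 + l)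
      lem = solve-∀

  match : ∀ {Ok : ℕ → Set} (Ok? : Decidable Ok) s → (∀ {m} → Ok m → slope m ≤ s) → ∀ X Y L → Matching Ok s X Y L
  match Ok? s cheap X Y L = Greedy.greedy Ok? s cheap (length X) X Y L ≤-refl

  -- The edges at `a` are counted by their other ends, at least `M` for each element of `Y`.
  -- Abstracting `edge` and `π` lets one proof serve outgoing and incoming edges.
  crowded : ∀ (edge : V → V × V) (π : V × V → V) {a} → (∀ b → π (edge b) ≡ a) → (∀ {x y} → edge x ≡ edge y → x ≡ y) →
            ∀ Y L → Unique Y → (∀ {b} → b ∈ Y → M ≤ mult (edge b) L) → M * length Y ≤ count a (map π L)
  crowded edge π πe inj [] L u h = ≤-trans (≤-reflexive (*-zeroʳ M)) z≤n
  crowded edge π {a} πe inj (b ∷ Y) L (b∉ ∷ u) h =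
    ≤-trans (≤-reflexive (*-suc M (length Y))) (≤-trans (+-mono-≤ (h (here refl)) (crowded edge π πe inj Y rest u
       (λ {b′} b∈ → ≤-trans (h (there b∈)) (≤-reflexive (Edges.count-↭ (edge b′) gather-↭ ⊙
          (Edges.count-++ (edge b′) (replicate m (edge b)) rest ⊙
          cong (_+ mult (edge b′) rest) (Edges.count-other m (λ eq → All.lookup b∉ b∈ (sym (inj eq))))))))))
    (≤-reflexive (sym (count-↭ a (map⁺ π gather-↭) ⊙ (cong (count a) (map-++ π (replicate m (edge b)) rest) ⊙
       (count-++ a (map π (replicate m (edge b))) (map π rest) ⊙ cong (_+ count a (map π rest)) (copies m)))))))
    where
    open Edges.Gather (edge b) L
    m : ℕ
    m = mult (edge b) L
    copies : ∀ k → count a (map π (replicate k (edge b))) ≡ k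
    copies zero = refl
    copies (suc k) = cong₂ _+_ (ι-yes (a ≟ π (edge b)) (sym (πe b))) (copies k)

  -- A matching never uses equal ends, so its maximality says nothing about `a` itself; exempting
  -- `a` accounts for the extra `M`.
  crowded-except : ∀ (edge : V → V × V) (π : V × V → V) {a} → (∀ b → π (edge b) ≡ a) → (∀ {x y} → edge x ≡ edge y → x ≡ y) →
            ∀ Y L → Unique Y → (∀ {b} → b ∈ Y → a ≢ b → M ≤ mult (edge b) L) → M * length Y ≤ count a (map π L) + M
  crowded-except edge π {a} πe inj Y L u h =
    let Z , uZ , sub , av , le = avoid (a ∷ []) u
    in ≤-trans (*-monoʳ-≤ M le) (≤-trans (≤-reflexive (*-distribˡ-+ M (length Z) 1))
       (+-mono-≤ (crowded edge π πe inj Z L uZ (λ z∈ → h (sub z∈) (λ { refl → av z∈ (here refl) }))) (≤-reflexive (*-identityʳ M))))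

-- Energy estimates for the elimination of a vertex: c, cI, cO, c₀ are the energies of the digraph, of the edges into and out of the
-- vertex and of the rest, c′ is the energy afterwards, and nᵢ is the number of pairs matched in stage i.

-- A pair of stage 1 or 2 costs 4, a third of the 12 that its heavy edge held. So a third of
-- `cI + cO` pays for these pairs and two thirds are recovered. The exceptional pairs cost at most
-- 26 each, and `78 = 3 * 26`.
clean-bound : ∀ {c cI cO c₀ c′ n₁ n₂ h₁ h₂ mI mO g e} → c ≡ cI + (cO + c₀) → c′ ≤ c₀ + (4 * n₁ + (4 * n₂ + 26 * g)) →
  12 * (n₁ + h₁) + 2 * mI ≤ cI → 12 * (n₂ + h₂) + 2 * mO ≤ cO → g ≤ e → 3 * c′ + 2 * (cI + cO) ≤ 3 * c + 78 * e
clean-bound {c} {cI} {cO} {c₀} {c′} {n₁} {n₂} {h₁} {h₂} {mI} {mO} {g} {e} hc h₀ hI hO hg =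
  Linear.entail (c ∷ cI ∷ cO ∷ c₀ ∷ c′ ∷ n₁ ∷ n₂ ∷ h₁ ∷ h₂ ∷ mI ∷ mO ∷ g ∷ e ∷ [])
    (3 ⊠ C′ ⊞ 2 ⊠ (CI ⊞ CO)) (3 ⊠ C ⊞ 78 ⊠ E)
    ( (3 , CI ⊞ (CO ⊞ C₀) , C)
    ∷ (3 , C′ , C₀ ⊞ (4 ⊠ N₁ ⊞ (4 ⊠ N₂ ⊞ 26 ⊠ G)))
    ∷ (1 , 12 ⊠ (N₁ ⊞ H₁) ⊞ 2 ⊠ MI , CI)
    ∷ (1 , 12 ⊠ (N₂ ⊞ H₂) ⊞ 2 ⊠ MO , CO)
    ∷ (78 , G , E) ∷ [])
    (≤-reflexive (sym hc) , h₀ , hI , hO , hg , tt)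
  where
  C CI CO C₀ C′ N₁ N₂ H₁ H₂ MI MO G E : Lin 13
  C = var (# 0) ; CI = var (# 1) ; CO = var (# 2) ; C₀ = var (# 3) ; C′ = var (# 4) ; N₁ = var (# 5) ; N₂ = var (# 6)
  H₁ = var (# 7) ; H₂ = var (# 8) ; MI = var (# 9) ; MO = var (# 10) ; G = var (# 11) ; E = var (# 12)

-- Here `i` and `o` are the multiplicities of one vertex on the two sides. Since they add up to at
-- least `D`, the energy at the eliminated vertex is about `13 * D`, and the two thirds recovered
-- exceed `D`.
dominated-bound : ∀ {c c′ cI cO e K i o D} e₂ → 3 * c′ + 2 * (cI + cO) ≤ 3 * c + 78 * e → 13 * i ≤ cI + K → 13 * o ≤ cO + K →
  D ≤ i + o → c′ + D ≤ c + (26 * e + (2 * e₂ + 2 * K))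
dominated-bound {c} {c′} {cI} {cO} {e} {K} {i} {o} {D} e₂ h hi ho hD = *-cancelˡ-≤ 3 (
  Linear.entail (c ∷ c′ ∷ cI ∷ cO ∷ e ∷ K ∷ i ∷ o ∷ D ∷ e₂ ∷ [])
    (3 ⊠ (C′ ⊞ D′)) (3 ⊠ (C ⊞ (26 ⊠ E ⊞ (2 ⊠ E₂ ⊞ 2 ⊠ K′))))
    ( (1 , 3 ⊠ C′ ⊞ 2 ⊠ (CI ⊞ CO) , 3 ⊠ C ⊞ 78 ⊠ E)
    ∷ (2 , 13 ⊠ I , CI ⊞ K′) ∷ (2 , 13 ⊠ O , CO ⊞ K′) ∷ (3 , D′ , I ⊞ O) ∷ [])
    (h , hi , ho , hD , tt))
  where
  C C′ CI CO E K′ I O D′ E₂ : Lin 10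
  C = var (# 0) ; C′ = var (# 1) ; CI = var (# 2) ; CO = var (# 3) ; E = var (# 4) ; K′ = var (# 5)
  I = var (# 6) ; O = var (# 7) ; D′ = var (# 8) ; E₂ = var (# 9)

-- The remainder `r` consists on one side of heavy ends, up to `m₁ ≤ e`, each releasing 12. On the
-- other side the ends of the remainder and of stage 3 release at least 2 each, apart from the
-- `y ≤ e₂` light ones. Each pair of the remainder costs at most 13 against `12 + 2`, the pairs of
-- stage 3 are free, and those of stages 1 and 2 gain 8; so each of the `D` units of degree gains at
-- least 1.
profit-bound : ∀ {c cI cO c₀ c′ n₁ n₂ n₃ n₄ h₁ h₂ m₁ m₂ mI mO r y e e₂ D} K → c ≡ cI + (cO + c₀) →
  c′ ≤ c₀ + (4 * n₁ + (4 * n₂ + 13 * n₄)) → n₄ ≤ r → 12 * (n₁ + h₁) + 2 * mI ≤ cI → 12 * (n₂ + h₂) + 2 * mO ≤ cO →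
  m₁ ≤ e → y ≤ e₂ → h₁ + m₁ ≡ r → h₂ + m₂ ≡ r → mO + y ≡ n₃ + m₂ → D ≡ n₁ + (n₂ + (n₃ + r)) →
  c′ + D ≤ c + (26 * e + (2 * e₂ + 2 * K))
profit-bound {c} {cI} {cO} {c₀} {c′} {n₁} {n₂} {n₃} {n₄} {h₁} {h₂} {m₁} {m₂} {mI} {mO} {r} {y} {e} {e₂} {D} K
  hc h₀ hn hI hO hm hy rI rO eO hD =
  Linear.entail (c ∷ cI ∷ cO ∷ c₀ ∷ c′ ∷ n₁ ∷ n₂ ∷ n₃ ∷ n₄ ∷ h₁ ∷ h₂ ∷ m₁ ∷ m₂ ∷ mI ∷ mO ∷ r ∷ y ∷ e ∷ e₂ ∷ D ∷ K ∷ [])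
    (C′ ⊞ D′) (C ⊞ (26 ⊠ E ⊞ (2 ⊠ E₂ ⊞ 2 ⊠ K′)))
    ( (1 , CI ⊞ (CO ⊞ C₀) , C)
    ∷ (1 , C′ , C₀ ⊞ (4 ⊠ N₁ ⊞ (4 ⊠ N₂ ⊞ 13 ⊠ N₄)))
    ∷ (13 , N₄ , R)
    ∷ (1 , 12 ⊠ (N₁ ⊞ H₁) ⊞ 2 ⊠ MI , CI)
    ∷ (1 , 12 ⊠ (N₂ ⊞ H₂) ⊞ 2 ⊠ MO , CO)
    ∷ (12 , M₁ , E) ∷ (2 , Y , E₂)
    ∷ (12 , R , H₁ ⊞ M₁) ∷ (2 , R , H₂ ⊞ M₂)
    ∷ (2 , N₃ ⊞ M₂ , MO ⊞ Y)
    ∷ (1 , D′ , N₁ ⊞ (N₂ ⊞ (N₃ ⊞ R))) ∷ [])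
    (≤-reflexive (sym hc) , h₀ , hn , hI , hO , hm , hy , ≤-reflexive (sym rI) , ≤-reflexive (sym rO) , ≤-reflexive (sym eO) , ≤-reflexive hD , tt)
  where
  C CI CO C₀ C′ N₁ N₂ N₃ N₄ H₁ H₂ M₁ M₂ MI MO R Y E E₂ D′ K′ : Lin 21
  C = var (# 0) ; CI = var (# 1) ; CO = var (# 2) ; C₀ = var (# 3) ; C′ = var (# 4) ; N₁ = var (# 5) ; N₂ = var (# 6)
  N₃ = var (# 7) ; N₄ = var (# 8) ; H₁ = var (# 9) ; H₂ = var (# 10) ; M₁ = var (# 11) ; M₂ = var (# 12) ; MI = var (# 13)
  MO = var (# 14) ; R = var (# 15) ; Y = var (# 16) ; E = var (# 17) ; E₂ = var (# 18) ; D′ = var (# 19) ; K′ = var (# 20)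

-- Eliminating one vertex: states, outcomes and bookkeeping

module Elimination {V : Set} (_≟_ : DecidableEquality V) (M : ℕ) (1≤M : 1 ≤ M) (k d e₂ : ℕ) (few : d + M ≤ M * e₂) where

  open Vertex _≟_ M 1≤M public

  -- `bound` is the largest multiplicity that is not heavy, so `e₁` ends of smaller or equal
  -- multiplicity include `2 * N` distinct vertices. By `few`, a vertex has `M` parallel edges to at
  -- most `e₂` vertices, with one exempted vertex allowed for. `E₁` is the error of `profit-bound`
  -- with the offset `4 + 9 * M`.
  N bound e₁ E₁ : ℕ
  N     = 2 ^ k
  bound = 3 + 9 * M
  e₁    = 2 * N * bound
  E₁    = 26 * e₁ + (2 * e₂ + 2 * (4 + 9 * M))

  -- Only an upper bound on the degrees survives, since discarded loops lower them; lost degrees are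
  -- handled by the penalties.
  record State (L : List (V × V)) : Set where
    field
      balanced : Balanced L
      loopless : Loopless L
      degree   : ∀ x → count x (tails L) ≤ d

  Win : List (V × V) → Set
  Win L = ∃ λ P → Unique P × length P ≡ N × L ⇝ cartesianProduct P P

  -- The vertex v is eliminated at the price of f loops at a, which are discarded.
  record Reduced (L : List (V × V)) (v a : V) (f : ℕ) : Set where
    field
      L′    : List (V × V)
      im    : L ⇝ L′
      state : State L′
      gone  : count v (tails L′) ≡ 0
      left  : ∀ x → x ≢ v → count x (tails L′) + f * ι (x ≟ a) ≡ count x (tails L)

  -- In `clean` no loop is discarded, so the vertex of the loops is a placeholder, `v` itself. The
  -- factors 3 and 2 express in integers that two thirds of the energy at `v` are recovered, up to
  -- `26 * e₁`.
  data Outcome (L : List (V × V)) (v : V) : Set where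
    win   : Win L → Outcome L v
    clean : (r : Reduced L v v 0) →
            3 * Edges.cost (Reduced.L′ r) + 2 * (cost (ins v L) + cost (outs v L)) ≤ 3 * Edges.cost L + 78 * e₁ → Outcome L v
    lossy : ∀ {a f} (r : Reduced L v a f) → f ≤ count v (tails L) →
            Edges.cost (Reduced.L′ r) + count v (tails L) ≤ Edges.cost L + E₁ → Outcome L v

  cost-++ˡ : ∀ (xs : List (V × V)) ys → Edges.cost ys ≤ Edges.cost (xs ++ ys)
  cost-++ˡ [] ys = ≤-refl
  cost-++ˡ (x ∷ xs) ys = ≤-trans (cost-++ˡ xs ys) (m≤n+m _ _)

  cost-++≤ : ∀ (xs : List (V × V)) ys → Edges.cost (xs ++ ys) ≤ 13 * length xs + Edges.cost ys
  cost-++≤ [] ys = ≤-refl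
  cost-++≤ (x ∷ xs) ys = ≤-trans (+-mono-≤ (slope≤13 (mult x (xs ++ ys))) (cost-++≤ xs ys))
    (≤-reflexive (sym (+-assoc 13 (13 * length xs) _) ⊙ cong (_+ Edges.cost ys) (sym (*-suc 13 (length xs)))))

  module Eliminate (L : List (V × V)) (st : State L) (v : V) where

    open State st

    I O : List V
    I = ins v L
    O = outs v L

    L₀ : List (V × V)
    L₀ = others v L

    L↭ : L ↭ into v I ++ from v O ++ L₀
    L↭ = at-vertex v L loopless

    I-length : length I ≡ count v (tails L)
    I-length = length-ins v L ⊙ sym (balanced v)

    O-length : length O ≡ count v (tails L)
    O-length = length-outs v L

    tails-L : ∀ x → count x (tails L) ≡ count x I + (length O * ι (x ≟ v) + count x (tails L₀))
    tails-L x = count-tails x L↭ ⊙ star-tails x v I O L₀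

    heads-L : ∀ x → count x (heads L) ≡ length I * ι (x ≟ v) + (count x O + count x (heads L₀))
    heads-L x = count-heads x L↭ ⊙ star-heads x v I O L₀

    v∉I : count v I ≡ 0
    v∉I = count-∉ λ v∈ → loopless (ins-∈ v L v∈) refl

    v∉L₀ : count v (tails L₀) ≡ 0
    v∉L₀ = count-∉ v∉
      where
      v∉ : v ∉ tails L₀
      v∉ v∈ with ∈-map⁻ proj₁ v∈
      ... | _ , e∈ , refl = proj₁ (others-avoid v L e∈) refl

    -- The contributions of the two stars at their centre `v` cancel. What is left says that `I` and
    -- `O` are exactly the imbalance of `L₀`, so any pairing of `I` with `O` restores the balance.
    core : ∀ x → count x I + count x (tails L₀) ≡ count x O + count x (heads L₀)
    core x = +-cancelˡ-≡ (length O * ι (x ≟ v)) _ _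
      (l (length O * ι (x ≟ v)) (count x I) (count x (tails L₀)) ⊙ (sym (tails-L x) ⊙ (balanced x ⊙ (heads-L x ⊙
       cong (λ w → w * ι (x ≟ v) + (count x O + count x (heads L₀))) (I-length ⊙ sym O-length)))))
      where
      l : ∀ a b c → a + (b + c) ≡ b + (a + c)
      l = solve-∀

    module Partial (Ps : List (V × V)) {I′ O′ : List V} (p : I ↭ tails Ps ++ I′) (q : O ↭ heads Ps ++ O′) where

      -- The list with `v` only partly eliminated. A biclique has to be exploited in this form,
      -- before the remaining ends are paired at any price.
      current : List (V × V)
      current = into v I′ ++ from v O′ ++ (Ps ++ L₀)

      current-im : L ⇝ current
      current-im = permute L↭ ▷ contract-↭ v Ps p q

      count-I : ∀ x → count x I ≡ count x (tails Ps) + count x I′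
      count-I x = count-↭ x p ⊙ count-++ x (tails Ps) I′

      count-O : ∀ x → count x O ≡ count x (heads Ps) + count x O′
      count-O x = count-↭ x q ⊙ count-++ x (heads Ps) O′

      same-length : length I′ ≡ length O′
      same-length = +-cancelˡ-≡ (length Ps) _ _
        (cong (_+ length I′) (sym (length-map proj₁ Ps)) ⊙ (sym (length-++ (tails Ps)) ⊙ (sym (↭-length p) ⊙ (I-length ⊙ (sym O-length ⊙
        (↭-length q ⊙ (length-++ (heads Ps) ⊙ cong (_+ length O′) (length-map proj₂ Ps))))))))

      current-balanced : Balanced current
      current-balanced x = star-tails x v I′ O′ (Ps ++ L₀) ⊙ (cong (λ w → count x I′ + (length O′ * ι (x ≟ v) + w)) (count-tails-++ x Ps L₀)
        ⊙ (l₁ (count x I′) (length O′ * ι (x ≟ v)) (count x (tails Ps)) (count x (tails L₀))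
        ⊙ (cong₂ (λ w z → w * ι (x ≟ v) + (z + count x (tails L₀))) (sym same-length) (sym (count-I x))
        ⊙ (cong (length I′ * ι (x ≟ v) +_) (core x ⊙ (cong (_+ count x (heads L₀)) (count-O x) ⊙ (l₂ (count x (heads Ps)) (count x O′) (count x (heads L₀))
           ⊙ cong (count x O′ +_) (sym (count-heads-++ x Ps L₀)))))
        ⊙ sym (star-heads x v I′ O′ (Ps ++ L₀))))))
        where
        l₁ : ∀ i o p l → i + (o + (p + l)) ≡ o + ((p + i) + l)
        l₁ = solve-∀
        l₂ : ∀ p o l → p + o + l ≡ o + (p + l)
        l₂ = solve-∀

    -- A pair with tail `x` replaces an edge from `x` to `v`, so no out-degree grows. `X` may be a
    -- part of `I`, for use between the stages.
    degree-bound : ∀ (Ps : List (V × V)) {X X′ : List V} → (∀ x → count x X ≤ count x I) → X ↭ tails Ps ++ X′ → ∀ x → count x (tails (Ps ++ L₀)) ≤ d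
    degree-bound Ps {X} {X′} sub p x = ≤-trans (≤-reflexive (count-tails-++ x Ps L₀)) (≤-trans
      (+-monoˡ-≤ (count x (tails L₀)) (≤-trans (m≤m+n _ (count x X′)) (≤-trans (≤-reflexive (sym (count-++ x (tails Ps) X′) ⊙ sym (count-↭ x p))) (sub x))))
      (≤-trans (+-monoʳ-≤ (count x I) (m≤n+m _ (length O * ι (x ≟ v)))) (≤-trans (≤-reflexive (sym (tails-L x))) (degree x))))

    -- The loops at `a` are first contracted like the other pairs and then deleted. Each takes one
    -- outgoing and one incoming edge from `a`, so balance survives and only the degree of `a`
    -- drops.
    finish : ∀ Ps f a → I ↭ tails Ps ++ replicate f a → O ↭ heads Ps ++ replicate f a → Loopless Ps → Reduced L v a f
    finish Ps f a p q ll = record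
      { L′ = Ps ++ L₀
      ; im = permute L↭ ▷ contract-↭ v {I′ = []} {O′ = []} loops
               (↭-trans p (↭-reflexive (sym tails-loops)))
               (↭-trans q (↭-reflexive (sym heads-loops)))
             ▷ permute (↭-reflexive (++-assoc Ps (replicate f (a , a)) L₀))
             ▷ ⇝-++ˡ Ps (⇝-dropˡ (replicate f (a , a)))
      ; state = record
        { balanced = λ x → count-tails-++ x Ps L₀ ⊙ (+-cancelˡ-≡ (count x (replicate f a)) _ _
            (l (count x (replicate f a)) (count x (tails Ps)) (count x (tails L₀)) ⊙ (cong (_+ count x (tails L₀)) (sym (count-I x)) ⊙ (core x ⊙
            (cong (_+ count x (heads L₀)) (count-O x) ⊙ sym (l (count x (replicate f a)) (count x (heads Ps)) (count x (heads L₀)))))))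
            ⊙ sym (count-heads-++ x Ps L₀))
        ; loopless = λ e∈ → [_,_]′ ll (λ e∈₀ → loopless (others-⊆ v L e∈₀)) (∈-++⁻ Ps e∈)
        ; degree = degree-bound Ps (λ _ → ≤-refl) p }
      ; gone = count-tails-++ v Ps L₀ ⊙ (cong₂ _+_ (n≤0⇒n≡0 (≤-trans (m≤m+n _ _) (≤-reflexive (sym (count-I v) ⊙ v∉I)))) v∉L₀)
      ; left = λ x x≢v → cong₂ _+_ (count-tails-++ x Ps L₀) (sym (copies x f)) ⊙
          (l′ (count x (tails Ps)) (count x (tails L₀)) (count x (replicate f a)) ⊙ (cong (_+ count x (tails L₀)) (sym (count-I x)) ⊙
          sym (tails-L x ⊙ cong (λ w → count x I + (w + count x (tails L₀))) (cong (length O *_) (ι-no (x ≟ v) x≢v) ⊙ *-zeroʳ (length O))))) }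
      where

      open Partial Ps p q using (count-I; count-O)
      loops : List (V × V)
      loops = Ps ++ replicate f (a , a)
      map-replicate : ∀ (π : V × V → V) → π (a , a) ≡ a → ∀ f → map π (replicate f (a , a)) ≡ replicate f a
      map-replicate π e zero = refl
      map-replicate π e (suc f) = cong₂ _∷_ e (map-replicate π e f)
      tails-loops : tails loops ++ [] ≡ tails Ps ++ replicate f a
      tails-loops = ++-identityʳ _ ⊙ (map-++ proj₁ Ps _ ⊙ cong (tails Ps ++_) (map-replicate proj₁ refl f))
      heads-loops : heads loops ++ [] ≡ heads Ps ++ replicate f a
      heads-loops = ++-identityʳ _ ⊙ (map-++ proj₂ Ps _ ⊙ cong (heads Ps ++_) (map-replicate proj₂ refl f))
      copies : ∀ x f → count x (replicate f a) ≡ f * ι (x ≟ a)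
      copies x zero = refl
      copies x (suc f) = cong (ι (x ≟ a) +_) (copies x f)
      l : ∀ r p t → r + (p + t) ≡ p + r + t
      l = solve-∀
      l′ : ∀ p t r → p + t + r ≡ p + r + t
      l′ = solve-∀

-- The four stages of pairing, and the case analysis for one vertex

module Stages {V : Set} (_≟_ : DecidableEquality V) (M : ℕ) (1≤M : 1 ≤ M) (k d e₂ : ℕ) (few : d + M ≤ M * e₂) where

  open Elimination _≟_ M 1≤M k d e₂ few public

  -- Collects the matched ends `T₁`, `T₂`, `T₃` and the unmatched ends `H₁`, `N₁` after three
  -- stages. On the side of `O` the first two stages exchange their roles.
  assemble : ∀ {I H Z K T₁ H₁ T₂ K₂ T₃ N₁ : List V} → I ↭ H ++ Z ++ K → H ↭ T₁ ++ H₁ → K ↭ T₂ ++ K₂ → Z ++ K₂ ↭ T₃ ++ N₁ →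
             I ↭ (T₃ ++ (T₂ ++ T₁)) ++ (H₁ ++ N₁)
  assemble {I} {H} {Z} {K} {T₁} {H₁} {T₂} {K₂} {T₃} {N₁} p q r s =
    ↭-trans p (↭-trans (↭P.++⁺ q (↭P.++⁺ˡ Z r)) (↭-trans
      (counts⇒↭ ((T₁ ++ H₁) ++ Z ++ T₂ ++ K₂) ((T₂ ++ T₁ ++ H₁) ++ (Z ++ K₂)) λ x →
         count-++ x (T₁ ++ H₁) _ ⊙ (cong₂ _+_ (count-++ x T₁ H₁) (count-++ x Z _ ⊙ cong (count x Z +_) (count-++ x T₂ K₂))
         ⊙ (l₁ (count x T₁) (count x H₁) (count x Z) (count x T₂) (count x K₂)
         ⊙ sym (count-++ x (T₂ ++ T₁ ++ H₁) _ ⊙ cong₂ _+_ (count-++ x T₂ _ ⊙ cong (count x T₂ +_) (count-++ x T₁ H₁)) (count-++ x Z K₂)))))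
      (↭-trans (↭P.++⁺ˡ (T₂ ++ T₁ ++ H₁) s)
      (counts⇒↭ ((T₂ ++ T₁ ++ H₁) ++ (T₃ ++ N₁)) ((T₃ ++ (T₂ ++ T₁)) ++ (H₁ ++ N₁)) λ x →
         count-++ x (T₂ ++ T₁ ++ H₁) _ ⊙ (cong₂ _+_ (count-++ x T₂ _ ⊙ cong (count x T₂ +_) (count-++ x T₁ H₁)) (count-++ x T₃ N₁)
         ⊙ (l₂ (count x T₁) (count x H₁) (count x T₃) (count x T₂) (count x N₁)
         ⊙ sym (count-++ x (T₃ ++ (T₂ ++ T₁)) _ ⊙ cong₂ _+_ (count-++ x T₃ _ ⊙ cong (count x T₃ +_) (count-++ x T₂ T₁)) (count-++ x H₁ N₁))))))))
    where
    l₁ : ∀ t₁ h z t₂ k → (t₁ + h) + (z + (t₂ + k)) ≡ (t₂ + (t₁ + h)) + (z + k)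
    l₁ = solve-∀
    l₂ : ∀ t₁ h t₃ t₂ n → (t₂ + (t₁ + h)) + (t₃ + n) ≡ (t₃ + (t₂ + t₁)) + (h + n)
    l₂ = solve-∀

  extend : ∀ {I T X T′ X′ : List V} → I ↭ T ++ X → X ↭ T′ ++ X′ → I ↭ (T′ ++ T) ++ X′
  extend {T = T} {T′ = T′} {X′} p q = ↭-trans p (↭-trans (↭P.++⁺ˡ T q)
    (↭-trans (↭P.shifts T T′) (↭-reflexive (sym (++-assoc T′ T X′)))))

  remainder-moderate : ∀ {Z K T₂ K₂ T₃ N₁ : List V} {b} → (∀ x → count x (Z ++ K) ≤ b) → K ↭ T₂ ++ K₂ → Z ++ K₂ ↭ T₃ ++ N₁ → ∀ x → count x N₁ ≤ b
  remainder-moderate {Z} {K} {T₂} {K₂} {T₃} {N₁} h p q x = ≤-trans (m≤n+m _ (count x T₃))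
    (≤-trans (≤-reflexive (sym (count-++ x T₃ N₁) ⊙ (sym (count-↭ x q) ⊙ count-++ x Z K₂)))
    (≤-trans (+-monoʳ-≤ (count x Z) (≤-trans (m≤n+m _ (count x T₂)) (≤-reflexive (sym (count-++ x T₂ K₂) ⊙ sym (count-↭ x p)))))
    (≤-trans (≤-reflexive (sym (count-++ x Z K))) (h x))))

  -- `c` is the default value for empty lists.
  monochrome : ∀ (c : V) X Y → length X ≡ length Y → (∀ {a b} → a ∈ X → b ∈ Y → a ≡ b) →
               ∃ λ a → X ≡ replicate (length X) a × Y ≡ replicate (length X) a
  monochrome c [] [] _ _ = c , refl , refl
  monochrome c (x ∷ X) (y ∷ Y) eq h = x
    , constant (x ∷ X) (λ z∈ → h z∈ (here refl) ⊙ sym (h (here refl) (here refl)))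
    , (constant (y ∷ Y) (λ z∈ → sym (h (here refl) z∈)) ⊙ cong (λ n → replicate n x) (sym eq))
    where
    constant : ∀ {a : V} Z → (∀ {z} → z ∈ Z → z ≡ a) → Z ≡ replicate (length Z) a
    constant [] _ = refl
    constant (z ∷ Z) g = cong₂ _∷_ (g (here refl)) (constant Z (g ∘ there))

  Avoids : V → V × V → Set
  Avoids a (x , y) = x ≢ a × y ≢ a

  record Sorted (a : V) (Ps : List (V × V)) : Set where
    field
      avoiding hitting : List (V × V)
      sorted : Ps ↭ avoiding ++ hitting
      avoids : ∀ {e} → e ∈ avoiding → Avoids a e
      hits   : length hitting ≤ count a (tails hitting) + count a (heads hitting)

  sort : ∀ a Ps → Sorted a Ps
  sort a [] = record { avoiding = [] ; hitting = [] ; sorted = refl ; avoids = λ () ; hits = z≤n }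
  sort a ((x , y) ∷ Ps) with sort a Ps | x ≟ a | y ≟ a
  ... | S | no x≢a | no y≢a = record
    { avoiding = (x , y) ∷ S.avoiding ; hitting = S.hitting ; sorted = prep _ S.sorted
    ; avoids = λ { (here refl) → x≢a , y≢a ; (there e∈) → S.avoids e∈ } ; hits = S.hits }
    where module S = Sorted S
  ... | S | yes refl | _ = record
    { avoiding = S.avoiding ; hitting = (x , y) ∷ S.hitting ; sorted = ↭-trans (prep _ S.sorted) (↭-sym (shift (x , y) S.avoiding S.hitting))
    ; avoids = S.avoids
    ; hits = ≤-trans (s≤s S.hits) (+-mono-≤ (≤-reflexive (sym (count-here x (tails S.hitting)))) (m≤n+m _ (ι (x ≟ y)))) }
    where module S = Sorted S
  ... | S | no _ | yes refl = record
    { avoiding = S.avoiding ; hitting = (x , y) ∷ S.hitting ; sorted = ↭-trans (prep _ S.sorted) (↭-sym (shift (x , y) S.avoiding S.hitting))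
    ; avoids = S.avoids
    ; hits = ≤-trans (s≤s S.hits) (≤-trans (≤-reflexive (sym (+-suc (count y (tails S.hitting)) _)))
               (+-mono-≤ (m≤n+m _ (ι (y ≟ x))) (≤-reflexive (sym (count-here y (heads S.hitting)))))) }
    where module S = Sorted S

  -- The pair (x , y) and a loop at a have the same tails and heads as (x , a) and (a , y).
  reroute : V → List (V × V) → List (V × V)
  reroute a []             = []
  reroute a ((x , y) ∷ Ps) = (x , a) ∷ (a , y) ∷ reroute a Ps

  tails-reroute : ∀ a Ps → tails (reroute a Ps) ↭ tails Ps ++ replicate (length Ps) a
  tails-reroute a [] = refl
  tails-reroute a ((x , y) ∷ Ps) = prep x (↭-trans (prep a (tails-reroute a Ps)) (↭-sym (shift a (tails Ps) _)))

  heads-reroute : ∀ a Ps → heads (reroute a Ps) ↭ heads Ps ++ replicate (length Ps) a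
  heads-reroute a [] = refl
  heads-reroute a ((x , y) ∷ Ps) = ↭-trans (swap a y (heads-reroute a Ps)) (prep y (↭-sym (shift a (heads Ps) _)))

  length-reroute : ∀ a Ps → length (reroute a Ps) ≡ 2 * length Ps
  length-reroute a [] = refl
  length-reroute a ((x , y) ∷ Ps) = cong (2 +_) (length-reroute a Ps) ⊙ sym (*-suc 2 (length Ps))

  loopless-reroute : ∀ a Ps → (∀ {e} → e ∈ Ps → Avoids a e) → Loopless (reroute a Ps)
  loopless-reroute a ((x , y) ∷ Ps) h (here refl) = proj₁ (h (here refl))
  loopless-reroute a ((x , y) ∷ Ps) h (there (here refl)) = proj₂ (h (here refl)) ∘ sym
  loopless-reroute a ((x , y) ∷ Ps) h (there (there e∈)) = loopless-reroute a Ps (h ∘ there) e∈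

  loopless-++ : ∀ {Ps Qs} → Loopless Ps → Loopless Qs → Loopless (Ps ++ Qs)
  loopless-++ {Ps} p q e∈ with ∈-++⁻ Ps e∈
  ... | inj₁ e∈₁ = p e∈₁
  ... | inj₂ e∈₂ = q e∈₂

  13*count≤cost : ∀ a xs → 13 * count a xs ≤ cost xs + (4 + 9 * M)
  13*count≤cost a xs = ≤-trans (13*≤energy (count a xs)) (+-monoˡ-≤ (4 + 9 * M)
    (≤-trans (m≤m+n _ _) (≤-reflexive (sym (cost-gather a xs)))))

  nonempty : ∀ {X : List V} → 1 ≤ length X → ∃ λ a → a ∈ X
  nonempty {x ∷ X} _ = x , here refl

  module _ (L : List (V × V)) (st : State L) (v : V) where

    open State st
    open Eliminate L st v

    slope≤0 : ∀ {m} → m < 1 → slope m ≤ 0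
    slope≤0 {zero} _ = ≤-reflexive slope-0
    slope≤0 {suc m} (s≤s ())

    -- Stages 1 and 2 pair heavy ends with light ones, at price 4 as long as the new edge has
    -- multiplicity below `M`. Light ends left over join the medium ones in stage 3, which makes
    -- only edges that are absent and hence free. Stage 4 pairs everything else at up to 13, so that
    -- only equal ends stay unpaired.
    Stage₁ : Classified I → Classified O → Set
    Stage₁ KI KO = Matching (_< M) 4 (Classified.heavy KI) (Classified.light KO) L₀

    Stage₂ : (KI : Classified I) (KO : Classified O) → Stage₁ KI KO → Set
    Stage₂ KI KO m₁ = Matching (_< M) 4 (Classified.light KI) (Classified.heavy KO) (Matching.pairs m₁ ++ L₀)

    Stage₃ : (KI : Classified I) (KO : Classified O) (m₁ : Stage₁ KI KO) → Stage₂ KI KO m₁ → Set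
    Stage₃ KI KO m₁ m₂ = Matching (_< 1) 0 (Classified.medium KI ++ Matching.X′ m₂) (Classified.medium KO ++ Matching.Y′ m₁)
      (Matching.pairs m₂ ++ (Matching.pairs m₁ ++ L₀))

    Stage₄ : (KI : Classified I) (KO : Classified O) (m₁ : Stage₁ KI KO) (m₂ : Stage₂ KI KO m₁) → Stage₃ KI KO m₁ m₂ → Set
    Stage₄ KI KO m₁ m₂ m₃ = Matching (λ _ → ⊤) 13 (Matching.X′ m₁ ++ Matching.X′ m₃) (Matching.Y′ m₂ ++ Matching.Y′ m₃)
      (Matching.pairs m₃ ++ (Matching.pairs m₂ ++ (Matching.pairs m₁ ++ L₀)))

    module Matched (KI : Classified I) (KO : Classified O) (m₁ : Stage₁ KI KO) (m₂ : Stage₂ KI KO m₁)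
                   (m₃ : Stage₃ KI KO m₁ m₂) (m₄ : Stage₄ KI KO m₁ m₂ m₃) where

      open Classified KI using () renaming (heavy to HI; medium to MI; light to LI; split to I-split; weight to I-weight; single to LI-unique; moderate to I-moderate)
      open Classified KO using () renaming (heavy to HO; medium to MO; light to LO; split to O-split; weight to O-weight; single to LO-unique; moderate to O-moderate)
      module S₁ = Matching m₁
      module S₂ = Matching m₂
      module S₃ = Matching m₃
      module S₄ = Matching m₄

      L₁ L₂ L₃ L₄ : List (V × V)
      L₁ = S₁.pairs ++ L₀
      L₂ = S₂.pairs ++ L₁
      L₃ = S₃.pairs ++ L₂
      L₄ = S₄.pairs ++ L₃

      Ps₃ Ps₄ : List (V × V)
      Ps₃ = S₃.pairs ++ (S₂.pairs ++ S₁.pairs)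
      Ps₄ = S₄.pairs ++ Ps₃

      Ps₃-L₀ : Ps₃ ++ L₀ ≡ L₃
      Ps₃-L₀ = ++-assoc S₃.pairs _ L₀ ⊙ cong (S₃.pairs ++_) (++-assoc S₂.pairs S₁.pairs L₀)

      Ps₄-L₀ : Ps₄ ++ L₀ ≡ L₄
      Ps₄-L₀ = ++-assoc S₄.pairs Ps₃ L₀ ⊙ cong (S₄.pairs ++_) Ps₃-L₀

      map-Ps₃ : ∀ (π : V × V → V) → map π Ps₃ ≡ map π S₃.pairs ++ (map π S₂.pairs ++ map π S₁.pairs)
      map-Ps₃ π = map-++ π S₃.pairs _ ⊙ cong (map π S₃.pairs ++_) (map-++ π S₂.pairs S₁.pairs)

      I-split₃ : I ↭ tails Ps₃ ++ (S₁.X′ ++ S₃.X′)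
      I-split₃ = ↭-trans (assemble {Z = MI} {T₁ = tails S₁.pairs} {T₂ = tails S₂.pairs} {T₃ = tails S₃.pairs} I-split S₁.X-split S₂.X-split S₃.X-split)
        (↭-reflexive (cong (_++ (S₁.X′ ++ S₃.X′)) (sym (map-Ps₃ proj₁))))

      O-split₃ : O ↭ heads Ps₃ ++ (S₂.Y′ ++ S₃.Y′)
      O-split₃ = ↭-trans (assemble {Z = MO} {T₁ = heads S₂.pairs} {T₂ = heads S₁.pairs} {T₃ = heads S₃.pairs} O-split S₂.Y-split S₁.Y-split S₃.Y-split)
        (↭P.++⁺ʳ (S₂.Y′ ++ S₃.Y′) (↭-trans (↭P.++⁺ˡ (heads S₃.pairs) (↭P.++-comm (heads S₁.pairs) (heads S₂.pairs))) (↭-reflexive (sym (map-Ps₃ proj₂)))))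

      I-split₄ : I ↭ tails Ps₄ ++ S₄.X′
      I-split₄ = ↭-trans (extend {T = tails Ps₃} {T′ = tails S₄.pairs} I-split₃ S₄.X-split) (↭-reflexive (cong (_++ S₄.X′) (sym (map-++ proj₁ S₄.pairs Ps₃))))

      O-split₄ : O ↭ heads Ps₄ ++ S₄.Y′
      O-split₄ = ↭-trans (extend {T = heads Ps₃} {T′ = heads S₄.pairs} O-split₃ S₄.Y-split) (↭-reflexive (cong (_++ S₄.Y′) (sym (map-++ proj₂ S₄.pairs Ps₃))))

      Ps₄-loopless : Loopless Ps₄
      Ps₄-loopless = loopless-++ {S₄.pairs} S₄.proper (loopless-++ {S₃.pairs} S₃.proper (loopless-++ {S₂.pairs} S₂.proper S₁.proper))

      n₁ n₂ n₃ n₄ f r D : ℕ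
      n₁ = length S₁.pairs
      n₂ = length S₂.pairs
      n₃ = length S₃.pairs
      n₄ = length S₄.pairs
      f  = length S₄.X′
      r  = length (S₁.X′ ++ S₃.X′)
      D  = count v (tails L)

      r≡n₄+f : r ≡ n₄ + f
      r≡n₄+f = S₄.X-length

      r-I : length S₁.X′ + length S₃.X′ ≡ r
      r-I = sym (length-++ S₁.X′)

      r-O : length S₂.Y′ + length S₃.Y′ ≡ r
      r-O = sym (length-++ S₂.Y′) ⊙ sym (Partial.same-length Ps₃ I-split₃ O-split₃)

      D-Ps₄ : D ≡ length Ps₄ + f
      D-Ps₄ = sym I-length ⊙ (↭-length I-split₄ ⊙ (length-++ (tails Ps₄) ⊙ cong (_+ f) (length-map proj₁ Ps₄)))

      D-sum : D ≡ n₁ + (n₂ + (n₃ + r))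
      D-sum = D-Ps₄ ⊙ (cong (_+ f) (length-++ S₄.pairs ⊙ cong (n₄ +_) (length-++ S₃.pairs ⊙ cong (n₃ +_) (length-++ S₂.pairs)))
        ⊙ (l n₁ n₂ n₃ n₄ f ⊙ cong (λ w → n₁ + (n₂ + (n₃ + w))) (sym r≡n₄+f)))
        where
        l : ∀ a b c e f → e + (c + (b + a)) + f ≡ a + (b + (c + (e + f)))
        l = solve-∀

      c c₀ cI cO : ℕ
      c  = Edges.cost L
      c₀ = Edges.cost L₀
      cI = cost I
      cO = cost O

      c-split : c ≡ cI + (cO + c₀)
      c-split = cost-at-vertex v L loopless

      cost₄ : Edges.cost (Ps₄ ++ L₀) ≤ c₀ + (4 * n₁ + (4 * n₂ + 13 * n₄))
      cost₄ = ≤-trans (≤-reflexive (cong Edges.cost Ps₄-L₀)) (≤-trans S₄.price (≤-trans (+-monoˡ-≤ (13 * n₄) (≤-trans S₃.price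
        (≤-trans (≤-reflexive (+-identityʳ _)) (≤-trans S₂.price (+-monoˡ-≤ (4 * n₂) S₁.price)))))
        (≤-reflexive (l c₀ (4 * n₁) (4 * n₂) (13 * n₄)))))
        where
        l : ∀ c a b e → c + a + b + e ≡ c + (a + (b + e))
        l = solve-∀

      weight-I : 12 * (n₁ + length S₁.X′) + 2 * length MI ≤ cI
      weight-I = subst (λ w → 12 * w + 2 * length MI ≤ cI) S₁.X-length I-weight

      weight-O : 12 * (n₂ + length S₂.Y′) + 2 * length MO ≤ cO
      weight-O = subst (λ w → 12 * w + 2 * length MO ≤ cO) S₂.Y-length O-weight

      -- Two long remainders of moderate multiplicity contain `N` and `2 * N` distinct vertices, and
      -- by maximality of stage 3 any two distinct ones are already joined by an edge.
      blocked : e₁ ≤ length S₃.X′ → e₁ ≤ length S₃.Y′ → Win L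
      blocked h h′ =
        let X , uX , lX , subX = spread bound N S₃.X′ (s≤s z≤n) (remainder-moderate {MI} {T₂ = tails S₂.pairs} {T₃ = tails S₃.pairs} I-moderate S₂.X-split S₃.X-split)
                                   (≤-trans (*-monoˡ-≤ bound (m≤m+n N (N + 0))) h)
            Y , uY , lY , subY = spread bound (2 * N) S₃.Y′ (s≤s z≤n) (remainder-moderate {MO} {T₂ = heads S₁.pairs} {T₃ = heads S₃.pairs} O-moderate S₁.Y-split S₃.Y-split) h′
            open Partial Ps₃ I-split₃ O-split₃
        in X , uX , lX , (current-im ▷ stuck k current-balanced uX uY lX lY λ x∈ y∈ x≢y →
             ∈-++⁺ʳ (into v (S₁.X′ ++ S₃.X′)) (∈-++⁺ʳ (from v (S₂.Y′ ++ S₃.Y′)) (subst (_ ∈_) (sym Ps₃-L₀)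
               (Edges.∈-count (≮⇒≥ (S₃.maximal (subX x∈) (subY y∈) x≢y))))))

      -- Stage 4 accepts every pair of different ends, so each in-end it leaves equals each out-end
      -- it leaves.
      all-equal : ∃ λ a → S₄.X′ ≡ replicate f a × S₄.Y′ ≡ replicate f a
      all-equal = monochrome v S₄.X′ S₄.Y′ (Partial.same-length Ps₄ I-split₄ O-split₄)
        (λ {a} {b} a∈ b∈ → decidable-stable (a ≟ b) (λ a≢b → S₄.maximal a∈ b∈ a≢b tt))

      a : V
      a = proj₁ all-equal

      I-loops : I ↭ tails Ps₄ ++ replicate f a
      I-loops = subst (λ w → I ↭ tails Ps₄ ++ w) (proj₁ (proj₂ all-equal)) I-split₄

      O-loops : O ↭ heads Ps₄ ++ replicate f a
      O-loops = subst (λ w → O ↭ heads Ps₄ ++ w) (proj₂ (proj₂ all-equal)) O-split₄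

      with-loops : Reduced L v a f
      with-loops = finish Ps₄ f a I-loops O-loops Ps₄-loopless

      f≤D : f ≤ D
      f≤D = ≤-trans (m≤n+m f (length Ps₄)) (≤-reflexive (sym D-Ps₄))

      few-left : ∀ {n} → M * n ≤ d + M → n ≤ e₂
      few-left h = *-cancelˡ-≤ M {{>-nonZero 1≤M}} (≤-trans h few)

      -- A heavy in-end unmatched in stage 1 has at least `M` edges to each other light out-end left
      -- there. Its out-degree is at most `d`, so at most `e₂` light out-ends were left, which is
      -- the input of `profit-bound`.
      profitable-I : 1 ≤ length S₁.X′ → length S₃.X′ ≤ e₁ → Outcome L v
      profitable-I h h′ = lossy with-loops f≤D
        (profit-bound {n₁ = n₁} {n₂} {n₃} {n₄} {length S₁.X′} {length S₂.Y′} {length S₃.X′} {length S₃.Y′} {length MI} {length MO} (4 + 9 * M) c-split cost₄ (≤-trans (m≤m+n n₄ f) (≤-reflexive (sym r≡n₄+f))) weight-I weight-O h′ few-Y r-I r-O (sym (length-++ MO) ⊙ S₃.Y-length) D-sum)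
        where
        few-Y : length S₁.Y′ ≤ e₂
        few-Y = let x , x∈ = nonempty h in few-left (≤-trans
          (crowded-except (x ,_) proj₁ (λ _ → refl) (cong proj₂) S₁.Y′ L₁ (Unique-++ʳ (heads S₁.pairs) (Unique-↭ S₁.Y-split LO-unique))
             (λ b∈ x≢b → ≮⇒≥ (S₁.maximal x∈ b∈ x≢b)))
          (+-monoˡ-≤ M (degree-bound S₁.pairs (λ y → ≤-trans (m≤m+n _ _) (≤-reflexive (sym (count-↭ y I-split ⊙ count-++ y HI (MI ++ LI))))) S₁.X-split x)))

      -- The mirror image. The in-degrees, counted after both stages, are bounded by the out-degrees
      -- through balance.
      profitable-O : 1 ≤ length S₂.Y′ → length S₃.Y′ ≤ e₁ → Outcome L v
      profitable-O h h′ = lossy with-loops f≤D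
        (profit-bound {n₁ = n₂} {n₁} {n₃} {n₄} {length S₂.Y′} {length S₁.X′} {length S₃.Y′} {length S₃.X′} {length MO} {length MI}
          (4 + 9 * M) (c-split ⊙ x+y+z≡y+x+z cI cO c₀) (≤-trans cost₄ (≤-reflexive (cong (c₀ +_) (x+y+z≡y+x+z (4 * n₁) (4 * n₂) (13 * n₄)))))
          (≤-trans (m≤m+n n₄ f) (≤-reflexive (sym r≡n₄+f))) weight-O weight-I h′ few-X r-O r-I (sym (length-++ MI) ⊙ S₃.X-length)
          (D-sum ⊙ x+y+z≡y+x+z n₁ n₂ (n₃ + r)))
        where
        x+y+z≡y+x+z : ∀ x y z → x + (y + z) ≡ y + (x + z)
        x+y+z≡y+x+z = solve-∀
        in-bound : ∀ y → count y (heads L₂) ≤ d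
        in-bound y = ≤-trans (≤-reflexive (count-heads-++ y S₂.pairs L₁ ⊙ cong (count y (heads S₂.pairs) +_) (count-heads-++ y S₁.pairs L₀)))
          (≤-trans (≤-reflexive (sym (+-assoc (count y (heads S₂.pairs)) _ _)))
          (≤-trans (+-monoˡ-≤ (count y (heads L₀)) (≤-trans (+-mono-≤ (part {T = heads S₂.pairs} S₂.Y-split) (≤-trans (part {T = heads S₁.pairs} S₁.Y-split) (m≤n+m _ (count y MO))))
            (≤-reflexive (cong (count y HO +_) (sym (count-++ y MO LO)) ⊙ (sym (count-++ y HO (MO ++ LO)) ⊙ sym (count-↭ y O-split))))))
          (≤-trans (m≤n+m _ (length I * ι (y ≟ v))) (≤-trans (≤-reflexive (sym (heads-L y) ⊙ sym (balanced y))) (degree y)))))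
          where
          part : ∀ {Z T Z′} → Z ↭ T ++ Z′ → count y T ≤ count y Z
          part {T = T} {Z′} p = ≤-trans (m≤m+n _ (count y Z′)) (≤-reflexive (sym (count-++ y T Z′) ⊙ sym (count-↭ y p)))
        few-X : length S₂.X′ ≤ e₂
        few-X = let y , y∈ = nonempty h in few-left (≤-trans
          (crowded-except (_, y) proj₂ (λ _ → refl) (cong proj₁) S₂.X′ L₂ (Unique-++ʳ (tails S₂.pairs) (Unique-↭ S₂.X-split LI-unique))
             (λ a∈ y≢a → ≮⇒≥ (S₂.maximal a∈ y∈ (y≢a ∘ sym))))
          (+-monoˡ-≤ M (in-bound y)))

      cleaned : r ≤ e₁ → ∀ {c′ g} → c′ ≤ c₀ + (4 * n₁ + (4 * n₂ + 26 * g)) → g ≤ r → 3 * c′ + 2 * (cI + cO) ≤ 3 * c + 78 * e₁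
      cleaned r≤ h g≤ = clean-bound {n₁ = n₁} {n₂} {length S₁.X′} {length S₂.Y′} {length MI} {length MO} c-split h weight-I weight-O (≤-trans g≤ r≤)

      13≤26 : 13 * n₄ ≤ 26 * n₄
      13≤26 = *-monoˡ-≤ n₄ (m≤m+n 13 13)

      cost₄-26 : Edges.cost (Ps₄ ++ L₀) ≤ c₀ + (4 * n₁ + (4 * n₂ + 26 * n₄))
      cost₄-26 = ≤-trans cost₄ (+-monoʳ-≤ c₀ (+-monoʳ-≤ (4 * n₁) (+-monoʳ-≤ (4 * n₂) 13≤26)))

      n₄≤r : n₄ ≤ r
      n₄≤r = ≤-trans (m≤m+n n₄ f) (≤-reflexive (sym r≡n₄+f))

      module Rerouting (S : Sorted a Ps₄) (enough : f ≤ length (Sorted.avoiding S)) where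
        open Sorted S

        A₁ A₂ Qs : List (V × V)
        A₁ = take f avoiding
        A₂ = drop f avoiding
        Qs = reroute a A₁ ++ (A₂ ++ hitting)

        A₁-length : length A₁ ≡ f
        A₁-length = length-take f avoiding ⊙ m≤n⇒m⊓n≡m enough

        Ps₄-split : Ps₄ ↭ A₁ ++ (A₂ ++ hitting)
        Ps₄-split = ↭-trans sorted (↭-reflexive (cong (_++ hitting) (sym (take++drop≡id f avoiding)) ⊙ ++-assoc A₁ A₂ hitting))

        rerouted : ∀ (π : V × V → V) {X} → X ↭ map π Ps₄ ++ replicate f a → map π (reroute a A₁) ↭ map π A₁ ++ replicate (length A₁) a →
                   X ↭ map π Qs ++ replicate 0 v
        rerouted π {X} p q = ↭-trans p (↭-trans (↭P.++⁺ʳ (replicate f a) (map⁺ π Ps₄-split)) (↭-trans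
          (↭-reflexive (cong (_++ replicate f a) (map-++ π A₁ _) ⊙ ++-assoc (map π A₁) _ _)) (↭-trans
          (↭P.++⁺ˡ (map π A₁) (↭P.++-comm (map π (A₂ ++ hitting)) (replicate f a))) (↭-trans
          (↭-reflexive (sym (++-assoc (map π A₁) _ _) ⊙ cong (λ w → (map π A₁ ++ replicate w a) ++ map π (A₂ ++ hitting)) (sym A₁-length))) (↭-trans
          (↭P.++⁺ʳ (map π (A₂ ++ hitting)) (↭-sym q))
          (↭-reflexive (sym (map-++ π (reroute a A₁) _) ⊙ sym (++-identityʳ _))))))))

        Qs-loopless : Loopless Qs
        Qs-loopless = loopless-++ {reroute a A₁}
          (loopless-reroute a A₁ λ e∈ → avoids (subst (_ ∈_) (take++drop≡id f avoiding) (∈-++⁺ˡ e∈)))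
          (λ e∈ → Ps₄-loopless (∈-resp-↭ (↭-sym Ps₄-split) (∈-++⁺ʳ A₁ e∈)))

        -- Removing the pairs `A₁` does not raise the energy, and rerouting adds two edges per loop
        -- at 13 each. This is the origin of 26; with 26 also allowed per pair of stage 4, the total
        -- is `26 * r` because `r` is `n₄ + f`.
        Qs-cost : Edges.cost (Qs ++ L₀) ≤ c₀ + (4 * n₁ + (4 * n₂ + 26 * r))
        Qs-cost = ≤-trans (≤-reflexive (cong Edges.cost (++-assoc (reroute a A₁) _ L₀))) (≤-trans (cost-++≤ (reroute a A₁) ((A₂ ++ hitting) ++ L₀))
          (≤-trans (+-mono-≤ (≤-reflexive (cong (13 *_) (length-reroute a A₁ ⊙ cong (2 *_) A₁-length)))
            (≤-trans (cost-++ˡ A₁ ((A₂ ++ hitting) ++ L₀)) (≤-reflexive (cong Edges.cost (sym (++-assoc A₁ _ L₀)) ⊙ Edges.cost-↭ (↭-sym (↭P.++⁺ʳ L₀ Ps₄-split))))))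
          (≤-trans (+-monoʳ-≤ (13 * (2 * f)) cost₄-26) (≤-reflexive (l f c₀ (4 * n₁) (4 * n₂) n₄ ⊙ cong (λ w → c₀ + (4 * n₁ + (4 * n₂ + 26 * w))) (sym r≡n₄+f))))))
          where
          l : ∀ f c p q n → 13 * (2 * f) + (c + (p + (q + 26 * n))) ≡ c + (p + (q + 26 * (n + f)))
          l = solve-∀

        outcome : r ≤ e₁ → Outcome L v
        outcome r≤ = clean (finish Qs 0 v (rerouted proj₁ I-loops (tails-reroute a A₁)) (rerouted proj₂ O-loops (heads-reroute a A₁)) Qs-loopless)
          (cleaned r≤ Qs-cost ≤-refl)

      -- Each loop accounts for two ends equal to `a` and each hitting pair for at least one. As at
      -- most `f` pairs avoid `a`, the ends equal to `a` number at least `D`, and their energy alone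
      -- makes the elimination profitable.
      dominated : r ≤ e₁ → (S : Sorted a Ps₄) → length (Sorted.avoiding S) ≤ f → Outcome L v
      dominated r≤ S le = lossy with-loops f≤D
        (dominated-bound {c} {Edges.cost (Ps₄ ++ L₀)} {cI} {cO} {e₁} {4 + 9 * M} {count a I} {count a O} {D} e₂ (cleaned r≤ cost₄-26 n₄≤r) (13*count≤cost a I) (13*count≤cost a O) D≤)
        where
        open Sorted S
        count-loops : ∀ (π : V × V → V) {X} → X ↭ map π Ps₄ ++ replicate f a → count a (map π hitting) + f ≤ count a X
        count-loops π p = ≤-trans (+-mono-≤ (≤-trans (m≤n+m _ (count a (map π avoiding)))
            (≤-reflexive (sym (count-++ a (map π avoiding) _) ⊙ (cong (count a) (sym (map-++ π avoiding hitting)) ⊙ sym (count-↭ a (map⁺ π sorted))))))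
            (≤-reflexive (sym (count-self f a)))) (≤-reflexive (sym (count-↭ a p ⊙ count-++ a (map π Ps₄) _)))
        D≤ : D ≤ count a I + count a O
        D≤ = ≤-trans (≤-reflexive (D-Ps₄ ⊙ cong (_+ f) (↭-length sorted ⊙ length-++ avoiding)))
          (≤-trans (+-monoˡ-≤ f (+-mono-≤ le hits)) (≤-trans (≤-reflexive (l f (count a (tails hitting)) (count a (heads hitting))))
          (+-mono-≤ (count-loops proj₁ I-loops) (count-loops proj₂ O-loops))))
          where
          l : ∀ f x y → f + (x + y) + f ≡ (x + f) + (y + f)
          l = solve-∀

      positive : ∀ x y {z} → x + y ≡ z → e₁ < z → y ≤ e₁ → 1 ≤ x
      positive zero y refl h h′ = ⊥-elim (<⇒≱ h h′)
      positive (suc x) y _ _ _ = s≤s z≤n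

      -- If more than `e₁` ends reach stage 4, either both remainders of stage 3 are long and give a
      -- biclique, or one is short and there are heavy ends left on its side. If at most `e₁` ends
      -- reach it, only the loops matter: they are rerouted when enough pairs avoid `a`, and
      -- otherwise `a` dominates.
      outcome : Outcome L v
      outcome with r ≤? e₁ | e₁ ≤? length S₃.X′ | e₁ ≤? length S₃.Y′
      ... | no r≰ | yes p | yes q = win (blocked p q)
      ... | no r≰ | no ¬p | _     = profitable-I (positive (length S₁.X′) _ r-I (≰⇒> r≰) (<⇒≤ (≰⇒> ¬p))) (<⇒≤ (≰⇒> ¬p))
      ... | no r≰ | yes p | no ¬q = profitable-O (positive (length S₂.Y′) _ r-O (≰⇒> r≰) (<⇒≤ (≰⇒> ¬q))) (<⇒≤ (≰⇒> ¬q))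
      ... | yes r≤ | _ | _ with f ≤? length (Sorted.avoiding (sort a Ps₄))
      ...   | yes enough = Rerouting.outcome (sort a Ps₄) enough r≤
      ...   | no ¬enough = dominated r≤ (sort a Ps₄) (<⇒≤ (≰⇒> ¬enough))

    eliminate : Outcome L v
    eliminate = Matched.outcome (classify I) (classify O) m₁ m₂ m₃ (match (λ _ → yes tt) 13 (λ {m} _ → slope≤13 m) _ _ _)
      where
      m₁ : Stage₁ (classify I) (classify O)
      m₁ = match (_<? M) 4 slope≤4 _ _ _
      m₂ : Stage₂ (classify I) (classify O) m₁
      m₂ = match (_<? M) 4 slope≤4 _ _ _
      m₃ : Stage₃ (classify I) (classify O) m₁ m₂
      m₃ = match (_<? 1) 0 slope≤0 _ _ _

-- The potential and the descent over the vertices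

module Reduction {V : Set} (_≟_ : DecidableEquality V) (M : ℕ) (1≤M : 1 ≤ M) (k d e₂ : ℕ) (few : d + M ≤ M * e₂) where

  open Stages _≟_ M 1≤M k d e₂ few

  ∑ : (V → ℕ) → List V → ℕ
  ∑ g []      = 0
  ∑ g (x ∷ W) = g x + ∑ g W

  ∑-↭ : ∀ g {W W′} → W ↭ W′ → ∑ g W ≡ ∑ g W′
  ∑-↭ g refl = refl
  ∑-↭ g (prep x p) = cong (g x +_) (∑-↭ g p)
  ∑-↭ g (swap x y p) = l (g x) (g y) _ ⊙ cong (λ s → g y + (g x + s)) (∑-↭ g p)
    where
    l : ∀ a b c → a + (b + c) ≡ b + (a + c)
    l = solve-∀
  ∑-↭ g (trans p q) = ∑-↭ g p ⊙ ∑-↭ g q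

  ∑-+ : ∀ g h W → ∑ (λ x → g x + h x) W ≡ ∑ g W + ∑ h W
  ∑-+ g h [] = refl
  ∑-+ g h (x ∷ W) = cong (g x + h x +_) (∑-+ g h W) ⊙ l (g x) (h x) (∑ g W) (∑ h W)
    where
    l : ∀ a b c e → a + b + (c + e) ≡ a + c + (b + e)
    l = solve-∀

  ∑-mono : ∀ {g h} W → (∀ {x} → x ∈ W → g x ≤ h x) → ∑ g W ≤ ∑ h W
  ∑-mono [] _ = z≤n
  ∑-mono (x ∷ W) p = +-mono-≤ (p (here refl)) (∑-mono W (p ∘ there))

  ∑-const : ∀ m W → ∑ (λ _ → m) W ≡ m * length W
  ∑-const m [] = sym (*-zeroʳ m)
  ∑-const m (x ∷ W) = cong (m +_) (∑-const m W) ⊙ sym (*-suc m (length W))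

  ∑-indicator : ∀ a s W → ∑ (λ x → ι (a ≟ x) * s) W ≡ count a W * s
  ∑-indicator a s [] = refl
  ∑-indicator a s (x ∷ W) = cong (ι (a ≟ x) * s +_) (∑-indicator a s W) ⊙ sym (*-distribʳ-+ s (ι (a ≟ x)) (count a W))

  ∑-* : ∀ m g W → ∑ (λ x → m * g x) W ≡ m * ∑ g W
  ∑-* m g [] = sym (*-zeroʳ m)
  ∑-* m g (x ∷ W) = cong (m * g x +_) (∑-* m g W) ⊙ sym (*-distribˡ-+ m (g x) (∑ g W))

  ∑-average : ∀ g m W → 1 ≤ length W → m ≤ ∑ g W → ∃ λ v → v ∈ W × m ≤ length W * g v
  ∑-average g m W 1≤W h with any? (λ v → m ≤? length W * g v) W
  ... | yes some = find some
  ... | no none = ⊥-elim (<⇒≱ (*-monoʳ-< (length W) {{>-nonZero 1≤W}} (s≤s h))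
        (≤-trans (≤-reflexive (*-suc (length W) (∑ g W) ⊙ (cong₂ _+_ (sym (+-identityʳ (length W)) ⊙ sym (∑-const 1 W)) (sym (∑-* (length W) g W)) ⊙ sym (∑-+ (λ _ → 1) (λ v → length W * g v) W))))
        (≤-trans (∑-mono W λ v∈ → ≰⇒> (none ∘ lose v∈)) (≤-reflexive (∑-const m W ⊙ *-comm m (length W))))))

  deg : List (V × V) → V → ℕ
  deg L x = count x (tails L)

  cost-outs-∷ : ∀ v e L → cost (outs v (e ∷ L)) ≡ ι (proj₁ e ≟ v) * slope (mult e L) + cost (outs v L)
  cost-outs-∷ v (a , b) L with a ≟ v
  ... | yes refl = cong (_+ cost (outs v L)) (cong slope (count-outs b v L) ⊙ sym (+-identityʳ _))
  ... | no _     = refl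

  cost-ins-∷ : ∀ v e L → cost (ins v (e ∷ L)) ≡ ι (proj₂ e ≟ v) * slope (mult e L) + cost (ins v L)
  cost-ins-∷ v (a , b) L with b ≟ v
  ... | yes refl = cong (_+ cost (ins v L)) (cong slope (count-ins a v L) ⊙ sym (+-identityʳ _))
  ... | no _     = refl

  module Handshake (W : List V) (uW : Unique W) where

    count-W : ∀ {a} → a ∈ W → count a W ≡ 1
    count-W a∈ = ≤-antisym (Unique⇒count≤1 uW _) (count-∈ a∈)

    ∑-split : ∀ (c : V → List (V × V) → ℕ) (π : V × V → V) e L → (∀ v → c v (e ∷ L) ≡ ι (π e ≟ v) * slope (mult e L) + c v L) →
              π e ∈ W → Edges.cost L ≡ ∑ (λ v → c v L) W → Edges.cost (e ∷ L) ≡ ∑ (λ v → c v (e ∷ L)) W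
    ∑-split c π e L h e∈ ih = sym (cong-∑ W ⊙ (∑-+ (λ v → ι (π e ≟ v) * slope (mult e L)) (λ v → c v L) W
      ⊙ cong₂ _+_ (∑-indicator (π e) _ W ⊙ (cong (_* slope (mult e L)) (count-W e∈) ⊙ +-identityʳ _)) (sym ih)))
      where
      cong-∑ : ∀ W → ∑ (λ v → c v (e ∷ L)) W ≡ ∑ (λ v → ι (π e ≟ v) * slope (mult e L) + c v L) W
      cong-∑ [] = refl
      cong-∑ (v ∷ W) = cong₂ _+_ (h v) (cong-∑ W)

    -- Parallel edges have the same tail, so the slope paid by each edge can be charged to its tail.
    cost-outs : ∀ L → (∀ {x} → x ∈ tails L → x ∈ W) → Edges.cost L ≡ ∑ (λ v → cost (outs v L)) W
    cost-outs [] h = sym (∑-const 0 W)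
    cost-outs (e ∷ L) h = ∑-split (λ v L → cost (outs v L)) proj₁ e L (λ v → cost-outs-∷ v e L) (h (here refl)) (cost-outs L (h ∘ there))

    cost-ins : ∀ L → (∀ {x} → x ∈ heads L → x ∈ W) → Edges.cost L ≡ ∑ (λ v → cost (ins v L)) W
    cost-ins [] h = sym (∑-const 0 W)
    cost-ins (e ∷ L) h = ∑-split (λ v L → cost (ins v L)) proj₂ e L (λ v → cost-ins-∷ v e L) (h (here refl)) (cost-ins L (h ∘ there))

  Win-⇝ : ∀ {L L′} → L ⇝ L′ → Win L′ → Win L
  Win-⇝ im (P , u , l , im′) = P , u , l , (im ▷ im′)

  -- `pD` is the penalty of the removed vertex and `S` that of the others. The penalty `2 * β`
  -- covers the allowance `β` lost with the vertex and the error `26 * e`, which is at most `β / 3`.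
  clean-potential : ∀ {c c′ cv S S′ pD B β e} → c + (pD + S) ≤ β + B → 2 * β ≤ pD → 3 * c′ + 2 * cv ≤ 3 * c + 78 * e → 78 * e ≤ β → S′ ≤ S → c′ + S′ ≤ B
  clean-potential {c} {c′} {cv} {S} {S′} {pD} {B} {β} {e} h₁ h₂ h₃ h₄ h₅ = *-cancelˡ-≤ 3 (
    Linear.entail (c ∷ c′ ∷ cv ∷ S ∷ S′ ∷ pD ∷ B ∷ β ∷ e ∷ []) (3 ⊠ (C′ ⊞ T′)) (3 ⊠ B′)
      ((3 , C ⊞ (P ⊞ T₀) , β′ ⊞ B′) ∷ (3 , 2 ⊠ β′ , P) ∷ (1 , 3 ⊠ C′ ⊞ 2 ⊠ CV , 3 ⊠ C ⊞ 78 ⊠ E) ∷ (1 , 78 ⊠ E , β′) ∷ (3 , T′ , T₀) ∷ [])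
      (h₁ , h₂ , h₃ , h₄ , h₅ , tt))
    where
    C C′ CV T₀ T′ P B′ β′ E : Lin 9
    C = var (# 0) ; C′ = var (# 1) ; CV = var (# 2) ; T₀ = var (# 3) ; T′ = var (# 4) ; P = var (# 5) ; B′ = var (# 6) ; β′ = var (# 7) ; E = var (# 8)

  -- The penalty `4 * β` covers the lost allowance `β`, the error `E ≤ β` and the new penalty
  -- `2 * β`.
  small-potential : ∀ {c c′ S S′ pD B β E D} → c + (pD + S) ≤ β + B → 4 * β ≤ pD → c′ + D ≤ c + E → E ≤ β → S′ ≤ S + 2 * β → c′ + S′ ≤ B
  small-potential {c} {c′} {S} {S′} {pD} {B} {β} {E} {D} h₁ h₂ h₃ h₄ h₅ =
    Linear.entail (c ∷ c′ ∷ D ∷ S ∷ S′ ∷ pD ∷ B ∷ β ∷ E ∷ []) (C′ ⊞ T′) B′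
      ((1 , C ⊞ (P ⊞ T₀) , β′ ⊞ B′) ∷ (1 , 4 ⊠ β′ , P) ∷ (1 , C′ ⊞ D′ , C ⊞ E′) ∷ (1 , E′ , β′) ∷ (1 , T′ , T₀ ⊞ 2 ⊠ β′) ∷ [])
      (h₁ , h₂ , h₃ , h₄ , h₅ , tt)
    where
    C C′ D′ T₀ T′ P B′ β′ E′ : Lin 9
    C = var (# 0) ; C′ = var (# 1) ; D′ = var (# 2) ; T₀ = var (# 3) ; T′ = var (# 4) ; P = var (# 5) ; B′ = var (# 6) ; β′ = var (# 7) ; E′ = var (# 8)

  -- The energy drops by at least `5 * β`: the lost allowance and a new penalty of up to `4 * β`.
  large-potential : ∀ {c c′ S S′ pD B β E D} → c + (pD + S) ≤ β + B → 5 * β + E ≤ D → c′ + D ≤ c + E → S′ ≤ S + 4 * β → c′ + S′ ≤ B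
  large-potential {c} {c′} {S} {S′} {pD} {B} {β} {E} {D} h₁ h₂ h₃ h₄ =
    Linear.entail (c ∷ c′ ∷ D ∷ S ∷ S′ ∷ pD ∷ B ∷ β ∷ E ∷ []) (C′ ⊞ T′) B′
      ((1 , C ⊞ (P ⊞ T₀) , β′ ⊞ B′) ∷ (1 , 5 ⊠ β′ ⊞ E′ , D′) ∷ (1 , C′ ⊞ D′ , C ⊞ E′) ∷ (1 , T′ , T₀ ⊞ 4 ⊠ β′) ∷ [])
      (h₁ , h₂ , h₃ , h₄ , tt)
    where
    C C′ D′ T₀ T′ P B′ β′ E′ : Lin 9
    C = var (# 0) ; C′ = var (# 1) ; D′ = var (# 2) ; T₀ = var (# 3) ; T′ = var (# 4) ; P = var (# 5) ; B′ = var (# 6) ; β′ = var (# 7) ; E′ = var (# 8)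

  -- Two thirds of the average energy `2 * c / w` come back. For `c = β * w` this is `4 / 3` of `β`,
  -- the error is at most `1 / 3` of `β`, and the net gain is exactly the allowance of one vertex.
  -- Smaller `c` are covered because the factor `1 - 4 / (3 * w)` of `c` is nonnegative for `w ≥ 2`,
  -- hence `w = 2 + u`.
  average-potential : ∀ {c c′ cv β e} u → let w = 2 + u in c ≤ β * w → 2 * c ≤ w * cv → 3 * c′ + 2 * cv ≤ 3 * c + 78 * e → 78 * e ≤ β → c′ ≤ β * (1 + u)
  average-potential {c} {c′} {cv} {β} {e} u h₁ h₂ h₃ h₄ = *-cancelˡ-≤ (2 + u) (*-cancelˡ-≤ 3 (≤-trans
    (Linear.entail ((2 + u) * c′ ∷ (2 + u) * cv ∷ c ∷ u * c ∷ β * (2 + u) ∷ u * (β * (2 + u)) ∷ []) (3 ⊠ Q₁) (3 ⊠ (Q₄ ⊞ Q₅))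
      ((1 , 3 ⊠ Q₁ ⊞ 2 ⊠ Q₂ , 3 ⊠ (2 ⊠ C ⊞ Q₃) ⊞ Q₄) ∷ (2 , 2 ⊠ C , Q₂) ∷ (2 , C , Q₄) ∷ (3 , Q₃ , Q₅) ∷ [])
      (≤-trans (≤-reflexive (l₁ u c′ cv)) (≤-trans (*-monoʳ-≤ (2 + u) (≤-trans h₃ (+-monoʳ-≤ (3 * c) h₄))) (≤-reflexive (l₂ u c β))) , h₂ , h₁ , *-monoʳ-≤ u h₁ , tt))
    (≤-reflexive (cong (3 *_) (l₃ u β)))))
    where
    Q₁ Q₂ C Q₃ Q₄ Q₅ : Lin 6
    Q₁ = var (# 0) ; Q₂ = var (# 1) ; C = var (# 2) ; Q₃ = var (# 3) ; Q₄ = var (# 4) ; Q₅ = var (# 5)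
    l₁ : ∀ u c′ cv → 3 * ((2 + u) * c′) + 2 * ((2 + u) * cv) ≡ (2 + u) * (3 * c′ + 2 * cv)
    l₁ = solve-∀
    l₂ : ∀ u c β → (2 + u) * (3 * c + β) ≡ 3 * (2 * c + u * c) + β * (2 + u)
    l₂ = solve-∀
    l₃ : ∀ u β → β * (2 + u) + u * (β * (2 + u)) ≡ (2 + u) * (β * (1 + u))
    l₃ = solve-∀

  module Descent (β : ℕ) (78e₁≤β : 78 * e₁ ≤ β) (E₁≤β : E₁ ≤ β) (d-large : 2 * (5 * β + E₁) ≤ d) (2≤d : 2 ≤ d) (1≤β : 1 ≤ β) where

    -- There are two steps because a vertex below half of `d` must be able to pay for a lossy
    -- removal of its own: it causes fewer than `d / 2` loops, which raise another penalty by only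
    -- one step.
    penalty : ℕ → ℕ
    penalty D = ι (D <? d) * (2 * β) + ι (2 * D <? d) * (2 * β)

    penalty-0 : ∀ {D} → d ≤ D → penalty D ≡ 0
    penalty-0 {D} h rewrite ι-no (D <? d) (≤⇒≯ h) | ι-no (2 * D <? d) (≤⇒≯ (≤-trans h (m≤m+n D (D + 0)))) = refl

    penalty≤2β : ∀ {D} → d ≤ 2 * D → penalty D ≤ 2 * β
    penalty≤2β {D} h rewrite ι-no (2 * D <? d) (≤⇒≯ h) | +-identityʳ (ι (D <? d) * (2 * β)) =
      ≤-trans (*-monoˡ-≤ (2 * β) (ι≤1 (D <? d))) (≤-reflexive (+-identityʳ _))

    2β≤penalty : ∀ {D} → D < d → 2 * β ≤ penalty D
    2β≤penalty {D} h rewrite ι-yes (D <? d) h = ≤-trans (≤-reflexive (sym (+-identityʳ _))) (m≤m+n (1 * (2 * β)) _)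

    2β+2β : 1 * (2 * β) + 1 * (2 * β) ≡ 4 * β
    2β+2β = l β
      where
      l : ∀ b → 1 * (2 * b) + 1 * (2 * b) ≡ 4 * b
      l = solve-∀

    4β≤penalty : ∀ {D} → 2 * D < d → 4 * β ≤ penalty D
    4β≤penalty {D} h rewrite ι-yes (2 * D <? d) h | ι-yes (D <? d) (≤-<-trans (m≤m+n D (D + 0)) h) = ≤-reflexive (sym 2β+2β)

    penalty≤4β : ∀ D → penalty D ≤ 4 * β
    penalty≤4β D = ≤-trans (+-mono-≤ (*-monoˡ-≤ (2 * β) (ι≤1 (D <? d))) (*-monoˡ-≤ (2 * β) (ι≤1 (2 * D <? d)))) (≤-reflexive 2β+2β)

    -- Losing at most `d / 2` cannot cross both steps at once when starting from degree at least
    -- `d`.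
    penalty-drop : ∀ {D D′ f} → 2 * f ≤ d → D′ + f ≡ D → penalty D′ ≤ penalty D + 2 * β
    penalty-drop {D} {D′} {f} h eq with d ≤? D
    ... | no d≰D = ≤-trans (penalty≤4β D′) (≤-trans (≤-reflexive (*-distribʳ-+ β 2 2)) (+-monoˡ-≤ (2 * β) (2β≤penalty (≰⇒> d≰D))))
    ... | yes d≤D = ≤-trans (penalty≤2β (+-cancelʳ-≤ d _ _ (≤-trans (≤-reflexive (cong (d +_) (sym (+-identityʳ d))))
            (≤-trans (*-monoʳ-≤ 2 (≤-trans d≤D (≤-reflexive (sym eq)))) (≤-trans (≤-reflexive (*-distribˡ-+ 2 D′ f)) (+-monoʳ-≤ (2 * D′) h))))))
            (m≤n+m (2 * β) (penalty D))

    β≤d : β ≤ d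
    β≤d = ≤-trans (≤-trans (m≤m+n β (4 * β)) (≤-trans (m≤m+n (5 * β) E₁) (m≤m+n (5 * β + E₁) _))) d-large

    record Invariant (L : List (V × V)) (W : List V) : Set where
      field
        state     : State L
        unique    : Unique W
        support   : ∀ {x} → x ∈ tails L → x ∈ W
        potential : Edges.cost L + ∑ (penalty ∘ deg L) W ≤ β * length W

    module Step (L : List (V × V)) {W : List V} (inv : Invariant L W) where
      open Invariant inv
      open State state

      support-heads : ∀ {x} → x ∈ heads L → x ∈ W
      support-heads {x} x∈ = support (∈-count (subst (1 ≤_) (sym (balanced x)) (count-∈ x∈)))

      open Handshake W unique

      -- A vertex of degree at least `d` with at most `d / 2` possible targets spends at least
      -- `4 * d - 2 * d`, hence at least `2 * β`, on parallel edges; any other vertex has penalty at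
      -- least `2 * β`. In total this is twice the permitted potential.
      crowded-out : 1 ≤ length W → 2 * length W ≤ d → ⊥
      crowded-out 1≤W h = <⇒≱ (*-monoˡ-< (length W) {{>-nonZero 1≤W}} {β} {2 * β} (≤-trans (+-monoˡ-≤ β 1≤β) (≤-reflexive (cong (β +_) (sym (+-identityʳ β))))))
        (≤-trans (≤-reflexive (sym (∑-const (2 * β) W))) (≤-trans (∑-mono W each)
          (≤-trans (≤-reflexive (∑-+ (λ v → cost (outs v L)) (penalty ∘ deg L) W ⊙ cong (_+ ∑ (penalty ∘ deg L) W) (sym (cost-outs L support)))) potential)))
        where
        l : ∀ d → 2 * d + 2 * d ≡ 4 * d
        l = solve-∀
        each : ∀ {v} → v ∈ W → 2 * β ≤ cost (outs v L) + penalty (deg L v)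
        each {v} _ with d ≤? deg L v
        ... | no d≰D = ≤-trans (2β≤penalty (≰⇒> d≰D)) (m≤n+m _ (cost (outs v L)))
        ... | yes d≤D = ≤-trans (*-monoʳ-≤ 2 β≤d) (≤-trans (+-cancelʳ-≤ (2 * d) _ _
               (≤-trans (≤-reflexive (l d)) (≤-trans (*-monoʳ-≤ 4 (≤-trans d≤D (≤-reflexive (sym (length-outs v L)))))
               (≤-trans (4*length≤cost W (outs v L) (λ b∈ → support-heads (∈-map⁺ proj₂ (outs-∈ v L b∈))))
               (+-monoʳ-≤ (cost (outs v L)) (≤-trans (≤-reflexive (*-assoc 2 2 (length W))) (*-monoʳ-≤ 2 h))))))) (m≤m+n (cost (outs v L)) (penalty (deg L v))))

      module Remove {v : V} {W′ : List V} (p : W ↭ v ∷ W′) where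

        S : ℕ
        S = ∑ (penalty ∘ deg L) W′

        potential′ : Edges.cost L + (penalty (deg L v) + S) ≤ β + β * length W′
        potential′ = ≤-trans (≤-reflexive (cong (Edges.cost L +_) (sym (∑-↭ (penalty ∘ deg L) p)))) (≤-trans potential
          (≤-reflexive (cong (β *_) (↭-length p) ⊙ *-suc β (length W′))))

        v∷W′-unique : Unique (v ∷ W′)
        v∷W′-unique = Unique-↭ p unique

        v∉W′ : ∀ {x} → x ∈ W′ → x ≢ v
        v∉W′ x∈ eq with v∷W′-unique
        ... | v∉ ∷ _ = All.lookup v∉ x∈ (sym eq)

        W′-unique : Unique W′
        W′-unique with v∷W′-unique
        ... | _ ∷ u = u

        reduced : ∀ {a f} (r : Reduced L v a f) → let L′ = Reduced.L′ r in
                  Edges.cost L′ + ∑ (penalty ∘ deg L′) W′ ≤ β * length W′ → Invariant L′ W′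
        reduced {a} {f} r h = record { state = Reduced.state r ; unique = W′-unique ; support = support′ ; potential = h }
          where
          open Reduced r using (L′; gone; left)
          support′ : ∀ {x} → x ∈ tails L′ → x ∈ W′
          support′ {x} x∈ = ∈-tail x≢v (∈-resp-↭ p (support (∈-count (≤-trans (count-∈ x∈) (≤-trans (m≤m+n _ (f * ι (x ≟ a))) (≤-reflexive (left x x≢v)))))))
            where
            x≢v : x ≢ v
            x≢v refl = <⇒≱ (count-∈ x∈) (≤-reflexive gone)

        penalties-clean : (r : Reduced L v v 0) → ∑ (penalty ∘ deg (Reduced.L′ r)) W′ ≤ S
        penalties-clean r = ∑-mono W′ λ {x} x∈ → ≤-reflexive (cong penalty (sym (+-identityʳ _) ⊙ Reduced.left r x (v∉W′ x∈)))

        penalties-lossy : ∀ {a f} (r : Reduced L v a f) Δ → (∀ {D D′} → D′ + f ≡ D → penalty D′ ≤ penalty D + Δ) →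
                          ∑ (penalty ∘ deg (Reduced.L′ r)) W′ ≤ S + Δ
        penalties-lossy {a} {f} r Δ drop-by = ≤-trans (∑-mono W′ each) (≤-trans (≤-reflexive (∑-+ (penalty ∘ deg L) (λ x → ι (a ≟ x) * Δ) W′))
          (+-monoʳ-≤ S (≤-trans (≤-reflexive (∑-indicator a Δ W′)) (≤-trans (*-monoˡ-≤ Δ (Unique⇒count≤1 W′-unique a)) (≤-reflexive (+-identityʳ Δ))))))
          where
          open Reduced r using (L′; left)
          each : ∀ {x} → x ∈ W′ → penalty (deg L′ x) ≤ penalty (deg L x) + ι (a ≟ x) * Δ
          each {x} x∈ with a ≟ x
          ... | yes refl = ≤-trans (drop-by (cong (deg L′ x +_) (sym (cong (f *_) (ι-yes (x ≟ x) refl) ⊙ *-identityʳ f)) ⊙ left x (v∉W′ x∈)))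
                             (+-monoʳ-≤ (penalty (deg L x)) (≤-reflexive (sym (+-identityʳ Δ))))
          ... | no a≢x = ≤-reflexive (cong penalty (sym (+-identityʳ _) ⊙ (cong (deg L′ x +_) (sym (cong (f *_) (ι-no (x ≟ a) (a≢x ∘ sym)) ⊙ *-zeroʳ f)) ⊙ left x (v∉W′ x∈))) ⊙ sym (+-identityʳ _))

      -- Vertices that have lost degree are removed first: their penalty pays for the removal.
      data Removable (v : V) : Set where
        poor    : 2 * deg L v < d → Removable v
        lacking : deg L v < d → d ≤ 2 * deg L v → Removable v
        costly  : (∀ {x} → x ∈ W → d ≤ deg L x) → 2 * Edges.cost L ≤ length W * (cost (ins v L) + cost (outs v L)) → Removable v

      removable : 1 ≤ length W → ∃ λ v → v ∈ W × Removable v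
      removable 1≤W with any? (λ v → 2 * deg L v <? d) W
      ... | yes some = let v , v∈ , h = find some in v , v∈ , poor h
      ... | no none with any? (λ v → deg L v <? d) W
      ...   | yes some = let v , v∈ , h = find some in v , v∈ , lacking h (≮⇒≥ (none ∘ lose v∈))
      -- Each edge is charged at its head and at its tail, so the energies at the vertices add up to
      -- twice the total.
      ...   | no none′ = let v , v∈ , h = ∑-average (λ v → cost (ins v L) + cost (outs v L)) (2 * Edges.cost L) W 1≤W
                               (≤-reflexive (cong₂ _+_ (cost-ins L support-heads) (+-identityʳ _ ⊙ cost-outs L support)
                                 ⊙ sym (∑-+ (λ v → cost (ins v L)) (λ v → cost (outs v L)) W)))
                         in v , v∈ , costly (λ x∈ → ≮⇒≥ (none′ ∘ lose x∈)) h

      next : ∀ {v W′} → W ↭ v ∷ W′ → 1 ≤ length W′ → Removable v → Outcome L v → Win L ⊎ ∃ λ L′ → L ⇝ L′ × Invariant L′ W′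
      next p 1≤W′ rem (win w) = inj₁ w
      next {v} {W′} p 1≤W′ rem (lossy {a} {f} r f≤ pays) = inj₂ (Reduced.L′ r , Reduced.im r , reduced r (result rem))
        where
        open Remove p
        result : Removable v → Edges.cost (Reduced.L′ r) + ∑ (penalty ∘ deg (Reduced.L′ r)) W′ ≤ β * length W′
        large : d ≤ 2 * deg L v → Edges.cost (Reduced.L′ r) + ∑ (penalty ∘ deg (Reduced.L′ r)) W′ ≤ β * length W′
        large h = large-potential {Edges.cost L} {pD = penalty (deg L v)} {E = E₁} potential′ (*-cancelˡ-≤ 2 (≤-trans d-large h)) pays
          (penalties-lossy r (4 * β) (λ {D} {D′} _ → ≤-trans (penalty≤4β D′) (m≤n+m (4 * β) (penalty D))))
        result (poor h) = small-potential {Edges.cost L} {pD = penalty (deg L v)} {E = E₁} potential′ (4β≤penalty h) pays E₁≤β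
          (penalties-lossy r (2 * β) (penalty-drop (≤-trans (*-monoʳ-≤ 2 f≤) (<⇒≤ h))))
        result (lacking _ h) = large h
        result (costly h _) = large (≤-trans (h (∈-resp-↭ (↭-sym p) (here refl))) (m≤m+n _ _))
      next {v} {W′} p 1≤W′ rem (clean r pays) = inj₂ (Reduced.L′ r , Reduced.im r , reduced r (result rem))
        where
        open Remove p
        paid : 2 * β ≤ penalty (deg L v) → Edges.cost (Reduced.L′ r) + ∑ (penalty ∘ deg (Reduced.L′ r)) W′ ≤ β * length W′
        paid h = clean-potential {Edges.cost L} {cv = cost (ins v L) + cost (outs v L)} {e = e₁} potential′ h pays 78e₁≤β (penalties-clean r)
        average : ∀ n → length W′ ≡ suc n → 2 * Edges.cost L ≤ length W * (cost (ins v L) + cost (outs v L)) → Edges.cost (Reduced.L′ r) ≤ β * length W′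
        average u eq h = subst (λ m → Edges.cost (Reduced.L′ r) ≤ β * m) (sym eq) (average-potential {Edges.cost L} {cv = cost (ins v L) + cost (outs v L)} {e = e₁} u
          (subst (λ m → Edges.cost L ≤ β * m) W-length (≤-trans (m≤m+n _ _) potential))
          (subst (λ m → 2 * Edges.cost L ≤ m * (cost (ins v L) + cost (outs v L))) W-length h) pays 78e₁≤β)
          where
          W-length : length W ≡ 2 + u
          W-length = ↭-length p ⊙ cong suc eq
        result : Removable v → Edges.cost (Reduced.L′ r) + ∑ (penalty ∘ deg (Reduced.L′ r)) W′ ≤ β * length W′
        result (poor h) = paid (≤-trans (*-monoˡ-≤ β {2} {4} (s≤s (s≤s z≤n))) (4β≤penalty h))
        result (lacking h _) = paid (2β≤penalty h)
        result (costly h h′) = ≤-trans (+-monoʳ-≤ (Edges.cost (Reduced.L′ r)) (≤-trans (penalties-clean r)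
            (≤-trans (∑-mono {penalty ∘ deg L} {λ _ → 0} W′ λ x∈ → ≤-reflexive (penalty-0 (h (∈-resp-↭ (↭-sym p) (there x∈))))) (≤-reflexive (∑-const 0 W′)))))
          (≤-trans (≤-reflexive (+-identityʳ _)) (average (pred (length W′)) (sym (suc-pred (length W′) {{>-nonZero 1≤W′}})) h′))

    descend : ∀ n {L W} → length W ≤ n → 1 ≤ length W → Invariant L W → Win L
    descend zero h 1≤W _ = ⊥-elim (<⇒≱ 1≤W h)
    descend (suc n) {L} {W} h 1≤W inv = descend′ (2 * length W ≤? d) (Step.removable L inv 1≤W)
      where
      descend′ : Dec (2 * length W ≤ d) → (∃ λ v → v ∈ W × Step.Removable L inv v) → Win L
      descend′ (yes small) _ = ⊥-elim (Step.crowded-out L inv 1≤W small)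
      descend′ (no large) (v , v∈ , rem) = let W′ , p = ∈-↭ v∈ in continue W′ p (1≤W′ p)
        where
        1≤W′ : ∀ {W′} → W ↭ v ∷ W′ → 1 ≤ length W′
        -- Since `2 ≤ d < 2 * length W`, a second vertex is present.
        1≤W′ p = ≤-pred (≤-trans (*-cancelˡ-< 2 1 (length W) (≤-<-trans 2≤d (≰⇒> large))) (≤-reflexive (↭-length p)))
        continue : ∀ W′ → W ↭ v ∷ W′ → 1 ≤ length W′ → Win L
        continue W′ p 1≤W′ = [ id , (λ (L′ , im , inv′) → Win-⇝ im (descend n (≤-pred (≤-trans (≤-reflexive (sym (↭-length p))) h)) 1≤W′ inv′)) ]′
          (Step.next L inv p 1≤W′ rem (eliminate L (Invariant.state inv) v))

-- Making a simple balanced list regular by splicing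

module Regularization {V : Set} (_≟_ : DecidableEquality V) (M : ℕ) (1≤M : 1 ≤ M) (k d e₂ : ℕ) (few : d + M ≤ M * e₂) where

  open Stages _≟_ M 1≤M k d e₂ few
  open Reduction _≟_ M 1≤M k d e₂ few

  record Simple (L : List (V × V)) : Set where
    field
      unique   : Unique L
      balanced : Balanced L
      loopless : Loopless L
      degree   : ∀ x → d ≤ deg L x

  Shortcut : List (V × V) → V → V → Set
  Shortcut L a b = ¬ (a ≡ b) × mult (a , b) L < 1

  shortcut? : ∀ L a b → Dec (Shortcut L a b)
  shortcut? L a b = ¬? (a ≟ b) ×-dec (mult (a , b) L <? 1)

  Shorter : List (V × V) → Set
  Shorter L = ∃ λ L′ → L ⇝ L′ × Simple L′ × length L ≡ suc (length L′)

  -- Without shortcuts every in-neighbour of `v` is joined to every other out-neighbour, and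
  -- simplicity makes the `N` and `2 * N` chosen neighbours distinct.
  complete : ∀ {L v} → 2 * N ≤ d → Simple L → d < deg L v → (∀ {a b} → a ∈ ins v L → b ∈ outs v L → ¬ Shortcut L a b) → Win L
  complete {L} {v} 2N≤d simple h none = X , Uniqueₚ.take⁺ N ins-unique , X-length , stuck k balanced (Uniqueₚ.take⁺ N ins-unique)
      (Uniqueₚ.take⁺ (2 * N) outs-unique) X-length Y-length
      (λ a∈ b∈ a≢b → Edges.∈-count (≮⇒≥ λ h′ → none (in-take N a∈) (in-take (2 * N) b∈) (a≢b , h′)))
    where
    open Simple simple
    X Y : List V
    X = take N (ins v L)
    Y = take (2 * N) (outs v L)
    ins-unique : Unique (ins v L)
    ins-unique = count≤1⇒Unique _ λ a → ≤-trans (≤-reflexive (count-ins a v L)) (Edges.Unique⇒count≤1 unique (a , v))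
    outs-unique : Unique (outs v L)
    outs-unique = count≤1⇒Unique _ λ b → ≤-trans (≤-reflexive (count-outs b v L)) (Edges.Unique⇒count≤1 unique (v , b))
    2N≤deg : 2 * N ≤ deg L v
    2N≤deg = ≤-trans 2N≤d (<⇒≤ h)
    X-length : length X ≡ N
    X-length = length-take N (ins v L) ⊙ m≤n⇒m⊓n≡m (≤-trans (m≤m+n N (N + 0)) (≤-trans 2N≤deg (≤-reflexive (balanced v ⊙ sym (length-ins v L)))))
    Y-length : length Y ≡ 2 * N
    Y-length = length-take (2 * N) (outs v L) ⊙ m≤n⇒m⊓n≡m (≤-trans 2N≤deg (≤-reflexive (sym (length-outs v L))))

  -- Replacing `(a , v)` and `(v , b)` by the absent edge `(a , b)` keeps the list simple and lowers
  -- only the degree of `v`, which was strictly above `d`.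
  splice-at : ∀ {L v a b} → Simple L → d < deg L v → a ∈ ins v L → b ∈ outs v L → Shortcut L a b → Shorter L
  splice-at {L} {v} {a} {b} simple h a∈ b∈ (a≢b , fresh) = spliced (∈-↭ (ins-∈ v L a∈))
    where
    open Simple simple
    a≢v : a ≢ v
    a≢v = loopless (ins-∈ v L a∈)
    spliced : (∃ λ L₁ → L ↭ (a , v) ∷ L₁) → Shorter L
    spliced (L₁ , p) = spliced′ (∈-↭ (Edges.∈-tail (a≢v ∘ sym ∘ cong proj₁) (∈-resp-↭ p (outs-∈ v L b∈))))
      where
      spliced′ : (∃ λ L₂ → L₁ ↭ (v , b) ∷ L₂) → Shorter L
      spliced′ (L₂ , q) = (a , b) ∷ L₂ , (permute r ▷ splice) , simple′ , ↭-length r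
        where
        r : L ↭ (a , v) ∷ (v , b) ∷ L₂
        r = ↭-trans p (prep _ q)
        L₂⊆L : ∀ {e} → e ∈ L₂ → e ∈ L
        L₂⊆L e∈ = ∈-resp-↭ (↭-sym r) (there (there e∈))
        simple′ : Simple ((a , b) ∷ L₂)
        simple′ = record
          { unique = unique′ (Edges.Unique-↭ r unique)
          ; balanced = λ x → +-cancelˡ-≡ (ι (x ≟ v)) _ _ (l (ι (x ≟ v)) (ι (x ≟ a)) _ ⊙ (sym (count-tails x r) ⊙ (balanced x ⊙ count-heads x r)))
          ; loopless = λ { (here refl) → a≢b ; (there e∈) → loopless (L₂⊆L e∈) }
          ; degree = degree′ }
          where
          l : ∀ v a t → v + (a + t) ≡ a + (v + t)
          l = solve-∀
          unique′ : Unique ((a , v) ∷ (v , b) ∷ L₂) → Unique ((a , b) ∷ L₂)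
          unique′ (_ ∷ (_ ∷ u)) = All.tabulate (λ e∈ eq → <⇒≱ fresh (Edges.count-∈ (L₂⊆L (subst (_∈ L₂) (sym eq) e∈)))) ∷ u
          degree′ : ∀ x → d ≤ ι (x ≟ a) + deg L₂ x
          degree′ x with x ≟ v | ≤-reflexive (count-tails x r)
          ... | yes refl | _ = ≤-pred (≤-trans h (≤-reflexive (count-tails v r ⊙ (cong (ι (v ≟ a) +_) (count-here v (tails L₂)) ⊙ +-suc (ι (v ≟ a)) _))))
          ... | no _ | le = ≤-trans (degree x) le

  shorten-at : ∀ {L v} → 2 * N ≤ d → Simple L → d < deg L v → Win L ⊎ Shorter L
  shorten-at {L} {v} 2N≤d simple h with any? (λ a → any? (shortcut? L a) (outs v L)) (ins v L)
  ... | no none = inj₁ (complete 2N≤d simple h λ a∈ b∈ s → none (lose a∈ (lose b∈ s)))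
  ... | yes some = let a , a∈ , some′ = find some ; b , b∈ , s = find some′ in inj₂ (splice-at simple h a∈ b∈ s)

  regularize : ∀ n {L} W → 2 * N ≤ d → (∀ x → x ∈ W) → length L ≤ n → Simple L →
               Win L ⊎ ∃ λ L′ → L ⇝ L′ × Simple L′ × (∀ x → deg L′ x ≤ d)
  regularize n {L} W 2N≤d all∈ h simple with any? (λ v → d <? deg L v) W
  ... | no none = inj₂ (L , permute refl , simple , λ x → ≮⇒≥ (none ∘ lose (all∈ x)))
  ... | yes some = let v , _ , d< = find some in shorter n h (shorten-at 2N≤d simple d<)
    where
    shorter : ∀ n → length L ≤ n → Win L ⊎ Shorter L → Win L ⊎ ∃ λ L′ → L ⇝ L′ × Simple L′ × (∀ x → deg L′ x ≤ d)
    shorter n h (inj₁ w) = inj₁ w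
    shorter zero h (inj₂ (L′ , _ , _ , eq)) = ⊥-elim (<⇒≱ (s≤s z≤n) (≤-trans (≤-reflexive (sym eq)) h))
    shorter (suc n) h (inj₂ (L′ , im , simple′ , eq)) =
      [ inj₁ ∘ Win-⇝ im , (λ (L″ , im′ , rest) → inj₂ (L″ , (im ▷ im′) , rest)) ]′
        (regularize n W 2N≤d all∈ (≤-pred (≤-trans (≤-reflexive (sym eq)) h)) simple′)

  module _ (β : ℕ) (78e₁≤β : 78 * e₁ ≤ β) (E₁≤β : E₁ ≤ β) (d-large : 2 * (5 * β + E₁) ≤ d) (2≤d : 2 ≤ d) (1≤β : 1 ≤ β) (2N≤d : 2 * N ≤ d) where

    open Descent β 78e₁≤β E₁≤β d-large 2≤d 1≤β

    simple⇒win : ∀ {L W} → Unique W → 1 ≤ length W → (∀ x → x ∈ W) → Simple L → Win L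
    simple⇒win {L} {W} uW 1≤W all∈ simple = [ id , regular ]′ (regularize (length L) W 2N≤d all∈ ≤-refl simple)
      where
      regular : (∃ λ L′ → L ⇝ L′ × Simple L′ × (∀ x → deg L′ x ≤ d)) → Win L
      regular (L′ , im , simple′ , le) = Win-⇝ im (descend (length W) ≤-refl 1≤W record
        { state = record { balanced = balanced ; loopless = loopless ; degree = le }
        ; unique = uW ; support = λ {x} _ → all∈ x
        -- A simple regular list has neither energy nor penalties, so the potential starts at 0.
        ; potential = ≤-trans (+-mono-≤ (≤-reflexive (Edges.cost-Unique unique))
            (≤-trans (∑-mono {penalty ∘ deg L′} {λ _ → 0} W λ {x} _ → ≤-reflexive (penalty-0 (degree x))) (≤-reflexive (∑-const 0 W)))) z≤n })
        where open Simple simple′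

-- Numerical conditions, independent of the size of the complete digraph

module Constants {V : Set} (_≟_ : DecidableEquality V) (k M K B C : ℕ) (1≤M : 1 ≤ M) (2≤K : 2 ≤ K) (1≤B : 1 ≤ B) (few : K + M ≤ M * C)
  (B₁ : 78 * (2 * (3 + 9 * M)) ≤ B) (B₂ : 26 * (2 * (3 + 9 * M)) + (2 * C + 2 * (4 + 9 * M)) ≤ B) (large : 12 * B ≤ K) where

  1≤2^k : 1 ≤ 2 ^ k
  1≤2^k = m^n>0 2 k

  -- All conditions are scaled by `2 ^ k`; a summand without that factor is absorbed by `1 ≤ 2 ^ k`.
  few′ : 2 ^ k * K + M ≤ M * (2 ^ k * C)
  few′ = ≤-trans (+-monoʳ-≤ (2 ^ k * K) (≤-trans (≤-reflexive (sym (+-identityʳ M))) (*-monoˡ-≤ M 1≤2^k)))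
    (≤-trans (≤-reflexive (sym (*-distribˡ-+ (2 ^ k) K M))) (≤-trans (*-monoʳ-≤ (2 ^ k) few) (≤-reflexive (l (2 ^ k) M C))))
    where
    l : ∀ n m c → n * (m * c) ≡ m * (n * c)
    l = solve-∀

  open Regularization _≟_ M 1≤M k (2 ^ k * K) (2 ^ k * C) few′ public
  open Stages _≟_ M 1≤M k (2 ^ k * K) (2 ^ k * C) few′ public using (e₁; E₁; Win; tails; heads; Balanced; Loopless; count)

  78e₁≤β : 78 * e₁ ≤ 2 ^ k * B
  78e₁≤β = ≤-trans (≤-reflexive (l (2 ^ k) (3 + 9 * M))) (*-monoʳ-≤ (2 ^ k) B₁)
    where
    l : ∀ n b → 78 * (2 * n * b) ≡ n * (78 * (2 * b))
    l = solve-∀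

  E₁≤β : E₁ ≤ 2 ^ k * B
  E₁≤β = ≤-trans (+-monoʳ-≤ (26 * e₁) (+-monoʳ-≤ (2 * (2 ^ k * C)) (≤-trans (≤-reflexive (sym (+-identityʳ _))) (*-monoˡ-≤ (2 * (4 + 9 * M)) 1≤2^k))))
    (≤-trans (≤-reflexive (l (2 ^ k) (3 + 9 * M) C (4 + 9 * M))) (*-monoʳ-≤ (2 ^ k) B₂))
    where
    l : ∀ n b c q → 26 * (2 * n * b) + (2 * (n * c) + n * (2 * q)) ≡ n * (26 * (2 * b) + (2 * c + 2 * q))
    l = solve-∀

  -- The factor 12 is `2 * (5 + 1)`. As `B` must cover `2 * C`, and `few` makes `C` exceed `K / M`,
  -- the conditions are compatible only for `M` above 24.
  d-large : 2 * (5 * (2 ^ k * B) + E₁) ≤ 2 ^ k * K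
  d-large = ≤-trans (*-monoʳ-≤ 2 (+-monoʳ-≤ (5 * (2 ^ k * B)) E₁≤β)) (≤-trans (≤-reflexive (l (2 ^ k) B)) (*-monoʳ-≤ (2 ^ k) large))
    where
    l : ∀ n b → 2 * (5 * (n * b) + n * b) ≡ n * (12 * b)
    l = solve-∀

  win : ∀ {L W} → Unique W → 1 ≤ length W → (∀ x → x ∈ W) → Simple L → Win L
  win = simple⇒win (2 ^ k * B) 78e₁≤β E₁≤β d-large (*-mono-≤ 1≤2^k 2≤K) (*-mono-≤ 1≤2^k 1≤B)
          (≤-trans (≤-reflexive (*-comm 2 (2 ^ k))) (*-monoʳ-≤ (2 ^ k) 2≤K))

-- A power of two is needed because `mix` halves the multigraph repeatedly.
power-between : ∀ t → 1 ≤ t → ∃ λ k → t ≤ 2 ^ k × 2 ^ k ≤ 2 * t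
power-between (suc zero) _ = 0 , s≤s z≤n , s≤s z≤n
power-between (suc (suc t)) _ with power-between (suc t) (s≤s z≤n)
... | k , lo , hi with 2 + t ≤? 2 ^ k
...   | yes p = k , p , ≤-trans hi (*-monoʳ-≤ 2 (n≤1+n (suc t)))
...   | no ¬p = suc k , ≤-trans (s≤s (s≤s (m≤m+n t _))) (≤-trans (≤-reflexive (sym (cong suc (+-suc t (t + 0))))) (*-monoʳ-≤ 2 lo)) , *-monoʳ-≤ 2 (<⇒≤ (≰⇒> ¬p))

-- Degrees of the digraph as multiplicities in its list of arcs

module Degrees {n : ℕ} (G : Digraph n) where

  open Mixing (Fin._≟_ {n}) using (tails; heads)
  open Counting (Fin._≟_ {n})
  open Realize G using (arcs)

  arcs-from : List (Fin n × Fin n) → List (Fin n × Fin n)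
  arcs-from = filter (λ (u , v) → Digraph.E G u v Boolₚ.≟ true)

  count-row : ∀ (π : Fin n × Fin n → Fin n) x u B r → (∀ es fs → count x (map π (es ++ fs)) ≡ count x (map π es) + count x (map π fs)) →
              count x (map π (arcs-from (map (u ,_) B))) ≡ r → ∀ A →
              count x (map π (arcs-from (cartesianProduct (u ∷ A) B))) ≡ r + count x (map π (arcs-from (cartesianProduct A B)))
  count-row π x u B r split row A = cong (count x ∘ map π) (filter-++ (λ (u , v) → Digraph.E G u v Boolₚ.≟ true) (map (u ,_) B) (cartesianProduct A B))
    ⊙ (split (arcs-from (map (u ,_) B)) _ ⊙ cong (_+ count x (map π (arcs-from (cartesianProduct A B)))) row)

  split : ∀ (π : Fin n × Fin n → Fin n) x es fs → count x (map π (es ++ fs)) ≡ count x (map π es) + count x (map π fs)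
  split π x es fs = cong (count x) (map-++ π es fs) ⊙ count-++ x (map π es) (map π fs)

  tails-row : ∀ x u B → count x (tails (arcs-from (map (u ,_) B))) ≡ ι (x Fin.≟ u) * sum (map (λ w → ind (Digraph.E G x w)) B)
  tails-row x u [] = sym (*-zeroʳ (ι (x Fin.≟ u)))
  tails-row x u (w ∷ B) with Digraph.E G u w in eq | x Fin.≟ u | tails-row x u B
  ... | true  | yes refl | ih rewrite eq | ι-yes (x Fin.≟ x) refl = cong suc ih
  ... | true  | no x≢u   | ih rewrite ι-no (x Fin.≟ u) x≢u = ih
  ... | false | yes refl | ih rewrite eq = ih
  ... | false | no _     | ih = ih

  heads-row : ∀ x u B → count x (heads (arcs-from (map (u ,_) B))) ≡ count x B * ind (Digraph.E G u x)
  heads-row x u [] = refl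
  heads-row x u (w ∷ B) with Digraph.E G u w in eq | x Fin.≟ w | heads-row x u B
  ... | true  | yes refl | ih rewrite eq | ι-yes (x Fin.≟ x) refl = cong suc ih
  ... | true  | no x≢w   | ih rewrite ι-no (x Fin.≟ w) x≢w = ih
  ... | false | yes refl | ih rewrite eq = ih
  ... | false | no _     | ih = ih

  tails-arcs : ∀ x A B → count x (tails (arcs-from (cartesianProduct A B))) ≡ count x A * sum (map (λ w → ind (Digraph.E G x w)) B)
  tails-arcs x [] B = refl
  tails-arcs x (u ∷ A) B = count-row proj₁ x u B _ (split proj₁ x) (tails-row x u B) A
    ⊙ (cong (_ +_) (tails-arcs x A B) ⊙ sym (*-distribʳ-+ (sum (map (λ w → ind (Digraph.E G x w)) B)) (ι (x Fin.≟ u)) (count x A)))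

  heads-arcs : ∀ x A B → count x (heads (arcs-from (cartesianProduct A B))) ≡ count x B * sum (map (λ u → ind (Digraph.E G u x)) A)
  heads-arcs x [] B = sym (*-zeroʳ (count x B))
  heads-arcs x (u ∷ A) B = count-row proj₂ x u B _ (split proj₂ x) (heads-row x u B) A
    ⊙ (cong (_ +_) (heads-arcs x A B) ⊙ sym (*-distribˡ-+ (count x B) (ind (Digraph.E G u x)) (sum (map (λ u → ind (Digraph.E G u x)) A))))

  count-allFin : ∀ x → count x (allFin n) ≡ 1
  count-allFin x = ≤-antisym (Unique⇒count≤1 (Uniqueₚ.allFin⁺ n) x) (count-∈ (∈-allFin x))

  outDeg-arcs : ∀ x → count x (tails arcs) ≡ outDeg G x
  outDeg-arcs x = tails-arcs x (allFin n) (allFin n) ⊙ (cong (_* outDeg G x) (count-allFin x) ⊙ +-identityʳ _)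

  inDeg-arcs : ∀ x → count x (heads arcs) ≡ inDeg G x
  inDeg-arcs x = heads-arcs x (allFin n) (allFin n) ⊙ (cong (_* inDeg G x) (count-allFin x) ⊙ +-identityʳ _)

  arcs-loopless : ∀ {a b} → (a , b) ∈ arcs → a ≢ b
  arcs-loopless {a} e∈ refl with () ← sym (proj₂ (∈-filter⁻ (λ (u , v) → Digraph.E G u v Boolₚ.≟ true) {xs = cartesianProduct (allFin n) (allFin n)} e∈)) ⊙ Digraph.loopless G a

-- A literal fraction: unlike `ℕtoℚ A` it involves no normalisation by a gcd, so its unnormalised
-- form is available by definition.
integral : ℕ → ℚ
integral A = mkℚ (ℤ.+ A) 0 (coprime-sym (1-coprimeTo A))

integral-≤ : ∀ A t i → integral A ℚ.* ℕtoℚ t ℚ.≤ ℕtoℚ i → A * t ≤ i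
integral-≤ A t i h = cleared (ℚᵘₚ.≤-respʳ-≃ (ℚₚ.toℚᵘ-fromℚᵘ (mkℚᵘ (ℤ.+ i) 0)) (ℚᵘₚ.≤-respˡ-≃
    (ℚᵘₚ.≃-trans (ℚₚ.toℚᵘ-homo-* (integral A) (ℕtoℚ t)) (ℚᵘₚ.*-congˡ {mkℚᵘ (ℤ.+ A) 0} (ℚₚ.toℚᵘ-fromℚᵘ (mkℚᵘ (ℤ.+ t) 0)))) (ℚₚ.toℚᵘ-mono-≤ h)))
  where
  cleared : mkℚᵘ (ℤ.+ A) 0 ℚᵘ.* mkℚᵘ (ℤ.+ t) 0 ℚᵘ.≤ mkℚᵘ (ℤ.+ i) 0 → A * t ≤ i
  cleared (*≤* le) = ℤₚ.drop‿+≤+ (subst (ℤ._≤ ℤ.+ i) (sym (ℤₚ.pos-* A t)) (subst₂ ℤ._≤_ (ℤₚ.*-identityʳ (ℤ.+ A ℤ.* ℤ.+ t)) (ℤₚ.*-identityʳ (ℤ.+ i)) le))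

theorem1p1 : Σ ℚ λ α → Positive α ×
  ((t : ℕ) → t ≥ 1 → (n : ℕ) → n ≥ 1 → (G : Digraph n) →
    Eulerian G → MinInDegAtLeast G (α ℚ.* ℕtoℚ t) → ImmersesComplete G t)
theorem1p1 = integral A , _ , λ t 1≤t n 1≤n G eulerian large → immerses t 1≤t n 1≤n G eulerian (λ v → integral-≤ A t (inDeg G v) (large v))
  where
  M K A B C : ℕ
  -- With N = 2 ^ k between t and 2 t, the digraph is made K N-regular, so that A = 2 K; the potential is at most B N per vertex.
  M = 1000
  K = 20000000
  A = 40000000
  B = 1500000
  C = 20001
  -- The seven numerical conditions are checked by evaluating `≤ᵇ` on the constants.
  leq : ∀ {m n} → {_ : T (m ≤ᵇ n)} → m ≤ n
  leq {m} {n} {p} = ≤ᵇ⇒≤ m n p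
  immerses : (t : ℕ) → t ≥ 1 → (n : ℕ) → n ≥ 1 → (G : Digraph n) → Eulerian G → (∀ v → A * t ≤ inDeg G v) → ImmersesComplete G t
  immerses t 1≤t n 1≤n G eulerian large =
    let k , t≤ , ≤2t = power-between t 1≤t
        open Degrees G
        open Realize G
        open Constants (Fin._≟_ {n}) k M K B C leq leq leq leq leq leq leq
        P , uP , lP , im = win (Uniqueₚ.allFin⁺ n) (≤-trans 1≤n (≤-reflexive (sym (length-tabulate id)))) ∈-allFin record
          { unique = arcs-Unique
          ; balanced = λ x → outDeg-arcs x ⊙ (sym (eulerian x) ⊙ sym (inDeg-arcs x))
          ; loopless = arcs-loopless
          ; degree = λ x → ≤-trans (*-monoˡ-≤ K ≤2t) (≤-trans (≤-reflexive (l t K)) (≤-trans (large x) (≤-reflexive (eulerian x ⊙ sym (outDeg-arcs x))))) }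
    in ⇝⇒ImmersesComplete uP (≤-trans t≤ (≤-reflexive (sym lP))) im
    where
    l : ∀ t K → 2 * t * K ≡ 2 * K * t
    l = solve-∀
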